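{- Let $n,r,k,t$ be positive integers with $r\ge 3$, $k\ge t+1$ and $n\ge 4k+6$. Let $\mathcal F_1,\dots,\mathcal F_r\subseteq\genfrac{[}{]}{0pt}{}{V}{k}$ be non-empty $r$-cross $t$-intersecting families with $\dim\big(\bigcap_{F\in\mathcal F_i}F\big)<t$ for every $i\in\{1,\dots,r\}$, such that $|\mathcal F_1||\mathcal F_2|\cdots|\mathcal F_r|$ is maximum among all non-empty $r$-cross $t$-intersecting families $\mathcal F_1',\dots,\mathcal F_r'\subseteq\genfrac{[}{]}{0pt}{}{V}{k}$ with $\dim\big(\bigcap_{F\in\mathcal F_i'}F\big)<t$ for every $i$. Then $r\le k-t+1$, and: (i) If $k>2t+2r-3$, then there exist $M\in\genfrac{[}{]}{0pt}{}{V}{k+1}$ and $T\in\genfrac{[}{]}{0pt}{}{M}{t+r-2}$ such that for every $i\in\{1,\dots,r\}$, $\mathcal F_i=\{F\in\genfrac{[}{]}{0pt}{}{V}{k}: T\subseteq F,\ \dim(F\cap M)\ge t+r-1\}\cup\{F\in\genfrac{[}{]}{0pt}{}{M}{k}: T\not\subseteq F\}$. (ii) If $k\le 2t+2r-3$, then there exists $Z\in\genfrac{[}{]}{0pt}{}{V}{t+r}$ such that for every $i\in\{1,\dots,r\}$, $\mathcal F_i=\{F\in\genfrac{[}{]}{0pt}{}{V}{k}: \dim(F\cap Z)\ge t+r-1\}$.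
   Context: Let $q$ be a prime power and $V$ an $n$-dimensional vector space over the finite field $\mathbb F_q$. For a subspace $W$ of $V$ and an integer $j$, $\genfrac{[}{]}{0pt}{}{W}{j}$ denotes the set of all $j$-dimensional subspaces of $W$. Families $\mathcal F_1,\dots,\mathcal F_r\subseteq\genfrac{[}{]}{0pt}{}{V}{k}$ are $r$-cross $t$-intersecting if $\dim(F_1\cap F_2\cap\cdots\cap F_r)\ge t$ for all choices $F_i\in\mathcal F_i$, $i=1,\dots,r$. -}

module Defs where

open import Level using (0ℓ)
open import Data.Nat using (ℕ; zero; suc; _*_)
open import Data.Fin using (Fin; zero; suc)
open import Data.Product using (Σ; ∃; _×_; _,_)
open import Relation.Nullary using (¬_)
open import Relation.Binary.PropositionalEquality using (_≡_)
open import Algebra.Structures using (IsCommutativeRing)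
open import Function.Bundles using (_↔_)

-- A finite field F_q (q = size).  Every finite field has prime-power order
-- and every prime power occurs, so quantifying over all finite fields is
-- the same as quantifying over all prime powers q.
record FiniteField : Set₁ where
  field
    Carrier : Set
    _+_ _·_  : Carrier → Carrier → Carrier
    -_       : Carrier → Carrier
    0# 1#    : Carrier
    isCommutativeRing : IsCommutativeRing _≡_ _+_ _·_ -_ 0# 1#
    0≢1      : ¬ (0# ≡ 1#)
    inverse  : ∀ x → ¬ (x ≡ 0#) → ∃ λ y → x · y ≡ 1#
    size     : ℕ
    enum     : Fin size ↔ Carrier

prodFin : (r : ℕ) → (Fin r → ℕ) → ℕ
prodFin zero    f = 1
prodFin (suc r) f = f zero * prodFin r (λ i → f (suc i))

module LinAlg (𝔽 : FiniteField) (n : ℕ) where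
  open FiniteField 𝔽

  V : Set
  V = Fin n → Carrier

  _≋_ : V → V → Set
  u ≋ v = ∀ i → u i ≡ v i

  0V : V
  0V _ = 0#

  _⊕_ : V → V → V
  (u ⊕ v) i = u i + v i

  _⊙_ : Carrier → V → V
  (c ⊙ v) i = c · v i

  lincomb : (m : ℕ) → (Fin m → Carrier) → (Fin m → V) → V
  lincomb zero    c b = 0V
  lincomb (suc m) c b = (c zero ⊙ b zero) ⊕ lincomb m (λ j → c (suc j)) (λ j → b (suc j))

  LinIndep : (m : ℕ) → (Fin m → V) → Set
  LinIndep m b = ∀ c → lincomb m c b ≋ 0V → ∀ j → c j ≡ 0#

  -- a k-dimensional subspace, presented by a basis
  Sub : ℕ → Set
  Sub k = Σ (Fin k → V) (LinIndep k)

  _∈_ : {k : ℕ} → V → Sub k → Set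
  _∈_ {k} v (b , _) = ∃ λ c → lincomb k c b ≋ v

  _⊆_ : {k l : ℕ} → Sub k → Sub l → Set
  S ⊆ T = ∀ v → v ∈ S → v ∈ T

  _≐_ : {k l : ℕ} → Sub k → Sub l → Set
  S ≐ T = (S ⊆ T) × (T ⊆ S)

  -- "the subspace {v | P v} has dimension ≥ d"
  -- (it contains d linearly independent vectors); used only for
  -- sets P that are subspaces (intersections of subspaces)
  DimGE : ℕ → (V → Set) → Set
  DimGE d P = Σ (Fin d → V) λ b → LinIndep d b × (∀ j → P (b j))

  Family : ℕ → Set₁
  Family k = Sub k → Set

  WellDefined : {k : ℕ} → Family k → Set
  WellDefined {k} 𝓕 = ∀ (S T : Sub k) → S ≐ T → 𝓕 S → 𝓕 T

  NonEmpty : {k : ℕ} → Family k → Set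
  NonEmpty {k} 𝓕 = Σ (Sub k) 𝓕

  HasSize : {k : ℕ} → Family k → ℕ → Set
  HasSize {k} 𝓕 m =
    Σ (Fin m → Sub k) λ xs →
      (∀ j → 𝓕 (xs j)) ×
      (∀ j j' → xs j ≐ xs j' → j ≡ j') ×
      (∀ S → 𝓕 S → ∃ λ j → S ≐ xs j)

  CrossIntersecting : {k : ℕ} (r t : ℕ) → (Fin r → Family k) → Set
  CrossIntersecting {k} r t 𝓕 =
    (F : Fin r → Sub k) → (∀ i → 𝓕 i (F i)) →
      DimGE t (λ v → ∀ i → v ∈ F i)

  KernelDimLT : {k : ℕ} → ℕ → Family k → Set
  KernelDimLT {k} t 𝓕 = ¬ DimGE t (λ v → ∀ (S : Sub k) → 𝓕 S → v ∈ S)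

  Admissible : {k : ℕ} (r t : ℕ) → (Fin r → Family k) → Set
  Admissible r t 𝓕 =
    (∀ i → WellDefined (𝓕 i)) × (∀ i → NonEmpty (𝓕 i)) ×
    CrossIntersecting r t 𝓕 × (∀ i → KernelDimLT t (𝓕 i))

{-# OPTIONS --safe #-}
module Submission where

open import Defs
open import Data.Nat
open import Data.Nat.Properties
open import Data.Nat.Tactic.RingSolver using (solve-∀)
open import Data.Fin using (Fin; zero; suc; combine; finToFun; funToFin; punchIn; punchOut)
import Data.Fin.Properties as Fin
open import Data.Product using (Σ; ∃; _×_; _,_; proj₁; proj₂)
open import Data.Sum using (_⊎_; inj₁; inj₂)
open import Data.Empty using (⊥-elim)
open import Data.Unit using (tt) renaming (⊤ to Unit)
open import Function using (_∘_; id)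
open import Function.Bundles using (_⇔_; mk⇔; _↔_; Inverse)
open import Relation.Nullary using (¬_; Dec; yes; no)
open import Relation.Nullary.Decidable using (_×-dec_; _⊎-dec_; ¬?; _→-dec_; map′)
open import Relation.Unary using (Decidable)
open import Relation.Binary.PropositionalEquality hiding (J)
open import Algebra.Bundles using (CommutativeRing)
import Algebra.Properties.Ring as RingProperties

-- Put s = t + r − 2.  If a choice of members met in too small a dimension, the
-- kernel condition would let each further family lower it by one more; hence any
-- two of the families are cross s-intersecting and k > s.  For two such families
-- F₁, F₂ (first closed under the Galois correspondence given by s-intersection)
-- let Cᵢ be the set of (s+1)-dimensional subspaces meeting every member of Fᵢ in
-- dimension at least s.  Branching over the vectors of members shows that
-- |F₁||F₂| is negligible unless both Cᵢ are nonempty, and that then |F₁| is at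
-- most (|C₂| + q^(−k−4)) N, where N is the number of k-subspaces through an
-- (s+1)-space.  C₁ and C₂ are cross s-intersecting families of
-- (s+1)-spaces, and |C₁||C₂| is too small unless they are the full pencil of an
-- s-space T in two (k+1)-spaces or all hyperplanes of one (s+2)-space Z.  This
-- bounds every product |Fᵢ||Fⱼ| by L², L being the size of the larger extremal
-- family, so maximality of the product over all r ≥ 3 families forces equality;
-- a third family then forces the two (k+1)-spaces to coincide.

-- One further dimension is dear to contain and cheap to find: k-spaces through a (d+1)-space are
-- rarer than those through a d-space by a factor of at least `q ^ (3 * k + 6)`, while branching
-- over a member to find the extra vector costs less than `q ^ (k + 1 ∸ s)`. Sizes can therefore be
-- compared by their coefficients of `N (suc s)`, up to an error of order 1/`K`. The coefficients
-- are integers, so a gap of one between c₁c₂ and μ² outweighs the error. The coefficients of the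
-- two extremal families are the q-numbers `h` of k + 1 - s and `g` of s + 2, which explains the
-- threshold k = 2s + 1. At the threshold they tie, and the comparison has to go one order further.
-- Closing a pair is what makes the covers cross s-intersecting: a k-space through a cover of one
-- family must belong to the other, and it can be taken in general position. Counts of subspaces are
-- compared by recurrences whose factors depend on dimensions only, so general Gaussian coefficients
-- never have to be evaluated.

-- Finite sums and double counting

module Sums where
  open import Algebra.Properties.CommutativeSemigroup +-commutativeSemigroup using (interchange)

  private variable
    N M : ℕ

  ∑ : (N : ℕ) → (Fin N → ℕ) → ℕ
  ∑ zero    f = 0
  ∑ (suc N) f = f zero + ∑ N (f ∘ suc)

  ∑-mono : ∀ N {f g : Fin N → ℕ} → (∀ i → f i ≤ g i) → ∑ N f ≤ ∑ N g
  ∑-mono zero    h = z≤n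
  ∑-mono (suc N) h = +-mono-≤ (h zero) (∑-mono N (h ∘ suc))

  ∑-cong : ∀ N {f g : Fin N → ℕ} → (∀ i → f i ≡ g i) → ∑ N f ≡ ∑ N g
  ∑-cong zero    h = refl
  ∑-cong (suc N) h = cong₂ _+_ (h zero) (∑-cong N (h ∘ suc))

  ∑-zero : ∀ N → ∑ N (λ _ → 0) ≡ 0
  ∑-zero zero    = refl
  ∑-zero (suc N) = ∑-zero N

  ∑-+ : ∀ N (f g : Fin N → ℕ) → ∑ N (λ i → f i + g i) ≡ ∑ N f + ∑ N g
  ∑-+ zero    f g = refl
  ∑-+ (suc N) f g = trans (cong (f zero + g zero +_) (∑-+ N (f ∘ suc) (g ∘ suc)))
                          (interchange (f zero) (g zero) _ _)

  ∑-* : ∀ N (f : Fin N → ℕ) c → ∑ N (λ i → f i * c) ≡ ∑ N f * c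
  ∑-* zero    f c = refl
  ∑-* (suc N) f c = trans (cong (f zero * c +_) (∑-* N (f ∘ suc) c))
                          (sym (*-distribʳ-+ c (f zero) _))

  ∑-swap : ∀ N M (f : Fin N → Fin M → ℕ) →
           ∑ N (λ i → ∑ M (f i)) ≡ ∑ M (λ j → ∑ N (λ i → f i j))
  ∑-swap zero    M f = sym (∑-zero M)
  ∑-swap (suc N) M f = trans (cong (∑ M (f zero) +_) (∑-swap N M (f ∘ suc)))
                             (sym (∑-+ M (f zero) _))

  ⟦_⟧ : {P : Set} → Dec P → ℕ
  ⟦ yes _ ⟧ = 1
  ⟦ no _ ⟧  = 0

  ⟦⟧-mono : {P Q : Set} (p : Dec P) (q : Dec Q) → (P → Q) → ⟦ p ⟧ ≤ ⟦ q ⟧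
  ⟦⟧-mono (yes p) (yes q) f = ≤-refl
  ⟦⟧-mono (yes p) (no ¬q) f = ⊥-elim (¬q (f p))
  ⟦⟧-mono (no ¬p) q       f = z≤n

  # : {P : Fin N → Set} → Decidable P → ℕ
  # {N} P? = ∑ N (λ i → ⟦ P? i ⟧)

  #-mono : {P Q : Fin N → Set} (P? : Decidable P) (Q? : Decidable Q) →
           (∀ i → P i → Q i) → # P? ≤ # Q?
  #-mono {N} P? Q? h = ∑-mono N (λ i → ⟦⟧-mono (P? i) (Q? i) (h i))

  #-cong : {P Q : Fin N → Set} (P? : Decidable P) (Q? : Decidable Q) →
           (∀ i → P i → Q i) → (∀ i → Q i → P i) → # P? ≡ # Q?
  #-cong P? Q? f g = ≤-antisym (#-mono P? Q? f) (#-mono Q? P? g)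

  #-none : {P : Fin N → Set} (P? : Decidable P) → (∀ i → ¬ P i) → # P? ≡ 0
  #-none {N} P? h = trans (∑-cong N (λ i → lem (P? i) (h i))) (∑-zero N)
    where
    lem : {A : Set} (d : Dec A) → ¬ A → ⟦ d ⟧ ≡ 0
    lem (yes a) ¬a = ⊥-elim (¬a a)
    lem (no _)  ¬a = refl

  #-∪ : {P Q R : Fin N → Set} (P? : Decidable P) (Q? : Decidable Q) (R? : Decidable R) →
        (∀ i → P i → Q i ⊎ R i) → # P? ≤ # Q? + # R?
  #-∪ {N} P? Q? R? h = ≤-trans (∑-mono N (λ i → lem (P? i) (Q? i) (R? i) (h i)))
                               (≤-reflexive (∑-+ N _ _))
    where
    lem : {A B C : Set} (p : Dec A) (q : Dec B) (r : Dec C) → (A → B ⊎ C) → ⟦ p ⟧ ≤ ⟦ q ⟧ + ⟦ r ⟧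
    lem (no _)  q       r       f = z≤n
    lem (yes a) (yes b) r       f = s≤s z≤n
    lem (yes a) (no ¬b) (yes c) f = s≤s z≤n
    lem (yes a) (no ¬b) (no ¬c) f with f a
    ... | inj₁ b = ⊥-elim (¬b b)
    ... | inj₂ c = ⊥-elim (¬c c)

  #-⊎ : {P Q R : Fin N → Set} (P? : Decidable P) (Q? : Decidable Q) (R? : Decidable R) →
        (∀ i → P i → Q i ⊎ R i) → (∀ i → Q i → P i) → (∀ i → R i → P i) →
        (∀ i → Q i → ¬ R i) → # P? ≡ # Q? + # R?
  #-⊎ {N} P? Q? R? h f g d =
    ≤-antisym (#-∪ P? Q? R? h)
      (≤-trans (≤-reflexive (sym (∑-+ N _ _)))
               (∑-mono N (λ i → lem (P? i) (Q? i) (R? i) (f i) (g i) (d i))))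
    where
    lem : {A B C : Set} (p : Dec A) (q : Dec B) (r : Dec C) →
          (B → A) → (C → A) → (B → ¬ C) → ⟦ q ⟧ + ⟦ r ⟧ ≤ ⟦ p ⟧
    lem p       (yes b) (yes c) f g d = ⊥-elim (d b c)
    lem (yes a) (yes b) (no _)  f g d = ≤-refl
    lem (no ¬a) (yes b) (no _)  f g d = ⊥-elim (¬a (f b))
    lem (yes a) (no _)  (yes c) f g d = ≤-refl
    lem (no ¬a) (no _)  (yes c) f g d = ⊥-elim (¬a (g c))
    lem p       (no _)  (no _)  f g d = z≤n

  #-split : {P : Fin N → Set} (P? : Decidable P) {Q : Fin N → Set} (Q? : Decidable Q) →
            # P? ≡ # (λ i → P? i ×-dec Q? i) + # (λ i → P? i ×-dec ¬? (Q? i))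
  #-split {P = P} P? {Q} Q? = #-⊎ P? (λ i → P? i ×-dec Q? i) (λ i → P? i ×-dec ¬? (Q? i))
    split (λ _ → proj₁) (λ _ → proj₁) (λ _ a b → proj₂ b (proj₂ a))
    where
    split : ∀ i → P i → (P i × Q i) ⊎ (P i × ¬ Q i)
    split i p with Q? i
    ... | yes y = inj₁ (p , y)
    ... | no y  = inj₂ (p , y)

  #-pos : {P : Fin N → Set} (P? : Decidable P) (i : Fin N) → P i → 1 ≤ # P?
  #-pos {suc N} P? zero p with P? zero
  ... | yes _ = s≤s z≤n
  ... | no ¬p = ⊥-elim (¬p p)
  #-pos {suc N} P? (suc i) p = ≤-trans (#-pos (P? ∘ suc) i p) (m≤n+m _ ⟦ P? zero ⟧)

  #-≤1 : {P : Fin N → Set} (P? : Decidable P) → (∀ i j → P i → P j → i ≡ j) → # P? ≤ 1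
  #-≤1 {zero}  P? u = z≤n
  #-≤1 {suc N} P? u with P? zero
  ... | yes p = ≤-reflexive (cong suc (#-none (P? ∘ suc) (λ i pi → Fin.0≢1+n (u zero (suc i) p pi))))
  ... | no _  = #-≤1 (P? ∘ suc) (λ i j pi pj → Fin.suc-injective (u (suc i) (suc j) pi pj))

  #-one : {P : Fin N → Set} (P? : Decidable P) (i : Fin N) → P i → (∀ i j → P i → P j → i ≡ j) → # P? ≡ 1
  #-one P? i p u = ≤-antisym (#-≤1 P? u) (#-pos P? i p)

  #-subset-eq : {P Q : Fin N → Set} (P? : Decidable P) (Q? : Decidable Q) →
                (∀ i → P i → Q i) → # Q? ≤ # P? → ∀ i → Q i → P i
  #-subset-eq {P = P} P? Q? sub le i qi with P? i
  ... | yes pi = pi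
  ... | no ¬pi = ⊥-elim (<-irrefl refl (begin-strict
          # P?                                          <⟨ m<m+n _ (#-pos rest? i (qi , ¬pi)) ⟩
          # P? + # rest?                                ≡⟨ sym (#-⊎ Q? P? rest? split sub (λ _ → proj₁) (λ _ p r → proj₂ r p)) ⟩
          # Q?                                          ≤⟨ le ⟩
          # P?                                          ∎))
    where
    open ≤-Reasoning
    rest? = λ j → Q? j ×-dec ¬? (P? j)
    split : ∀ j → _ → P j ⊎ _
    split j qj with P? j
    ... | yes p = inj₁ p
    ... | no ¬p = inj₂ (qj , ¬p)

  ⟦⟧*-≤ : {P : Set} (p : Dec P) {m n : ℕ} → (P → m ≤ n) → ⟦ p ⟧ * m ≤ ⟦ p ⟧ * n
  ⟦⟧*-≤ (yes p) h = +-mono-≤ (h p) z≤n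
  ⟦⟧*-≤ (no _)  h = z≤n

  private
    pull : ∀ M {A : Set} (p : Dec A) {R : Fin M → Set} (R? : Decidable R) →
           ⟦ p ⟧ * # R? ≡ # (λ j → p ×-dec R? j)
    pull M (yes a) R? = trans (+-identityʳ _) (#-cong R? _ (λ j r → a , r) (λ j → proj₂))
    pull M (no ¬a) R? = sym (#-none (λ j → no ¬a ×-dec R? j) (λ j → ¬a ∘ proj₁))

  -- Interchanging the two summations. Rows keep their individual lengths, which `hm<ball` exploits:
  -- there some rows are longer than others and the surplus is what counts.
  weighted-count-≤ : {P : Fin N → Set} {Q : Fin M → Set} {R : Fin N → Fin M → Set}
    (P? : Decidable P) (Q? : Decidable Q) (R? : ∀ i j → Dec (R i j)) (b : ℕ) →
    (∀ j → Q j → # (λ i → P? i ×-dec R? i j) ≤ b) →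
    (∀ i j → P i → R i j → Q j) →
    ∑ N (λ i → ⟦ P? i ⟧ * # (R? i)) ≤ # Q? * b
  weighted-count-≤ {N} {M} P? Q? R? b hi PQ = begin
    ∑ N (λ i → ⟦ P? i ⟧ * # (R? i))                      ≡⟨ ∑-cong N (λ i → pull M (P? i) (R? i)) ⟩
    ∑ N (λ i → # (λ j → P? i ×-dec R? i j))              ≡⟨ ∑-swap N M _ ⟩
    ∑ M (λ j → # (λ i → P? i ×-dec R? i j))              ≤⟨ ∑-mono M col ⟩
    ∑ M (λ j → ⟦ Q? j ⟧ * b)                             ≡⟨ ∑-* M _ b ⟩
    # Q? * b                                             ∎
    where
    open ≤-Reasoning
    col : ∀ j → # (λ i → P? i ×-dec R? i j) ≤ ⟦ Q? j ⟧ * b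
    col j with Q? j
    ... | yes qj = ≤-trans (hi j qj) (≤-reflexive (sym (+-identityʳ b)))
    ... | no ¬qj = ≤-reflexive (#-none _ (λ i pr → ¬qj (PQ i j (proj₁ pr) (proj₂ pr))))

  double-count-≤ : {P : Fin N → Set} {Q : Fin M → Set} {R : Fin N → Fin M → Set}
    (P? : Decidable P) (Q? : Decidable Q) (R? : ∀ i j → Dec (R i j)) (a b : ℕ) →
    (∀ i → P i → a ≤ # (R? i)) →
    (∀ j → Q j → # (λ i → P? i ×-dec R? i j) ≤ b) →
    (∀ i j → P i → R i j → Q j) →
    # P? * a ≤ # Q? * b
  double-count-≤ {N} P? Q? R? a b lo hi PQ = begin
    # P? * a                                             ≡⟨ sym (∑-* N _ a) ⟩
    ∑ N (λ i → ⟦ P? i ⟧ * a)                             ≤⟨ ∑-mono N (λ i → ⟦⟧*-≤ (P? i) (lo i)) ⟩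
    ∑ N (λ i → ⟦ P? i ⟧ * # (R? i))                      ≤⟨ weighted-count-≤ P? Q? R? b hi PQ ⟩
    # Q? * b                                             ∎
    where open ≤-Reasoning

  double-count-≥ : {P : Fin N → Set} {Q : Fin M → Set} {R : Fin N → Fin M → Set}
    (P? : Decidable P) (Q? : Decidable Q) (R? : ∀ i j → Dec (R i j)) (a b : ℕ) →
    (∀ i → P i → # (R? i) ≤ a) →
    (∀ j → Q j → b ≤ # (λ i → P? i ×-dec R? i j)) →
    # Q? * b ≤ # P? * a
  double-count-≥ P? Q? R? a b hi lo =
    double-count-≤ Q? P? (λ j i → P? i ×-dec R? i j) b a lo
      (λ i p → ≤-trans (#-mono _ (R? i) (λ _ → proj₂ ∘ proj₂)) (hi i p))
      (λ _ _ _ → proj₁)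

open Sums

-- Arithmetic of q-numbers

-- The q-number 1 + q + ... + q^(m-1), that is, the number of lines of an m-dimensional space; the
-- recursion avoids dividing by q - 1.
θ : ℕ → ℕ → ℕ
θ q zero    = 0
θ q (suc m) = 1 + q * θ q m

θ-geometric : ∀ p m → suc p ^ m ≡ 1 + p * θ (suc p) m
θ-geometric p zero    = cong suc (sym (*-zeroʳ p))
θ-geometric p (suc m) = trans (cong (suc p *_) (θ-geometric p m)) (lem p (θ (suc p) m))
  where
  lem : ∀ p t → suc p * (1 + p * t) ≡ 1 + p * (1 + suc p * t)
  lem = solve-∀

θ-mono : ∀ q {a b} → a ≤ b → θ q a ≤ θ q b
θ-mono q z≤n     = z≤n
θ-mono q (s≤s h) = s≤s (*-monoʳ-≤ q (θ-mono q h))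

θ<^ : ∀ {q} → 2 ≤ q → ∀ m → θ q m < q ^ m
θ<^ {suc (suc p)} (s≤s (s≤s _)) m = ≤-trans (s≤s (m≤m+n _ (p * θ (suc (suc p)) m)))
                                            (≤-reflexive (sym (θ-geometric (suc p) m)))

θ-strict : ∀ {q} → 1 ≤ q → ∀ m → θ q m < θ q (suc m)
θ-strict h zero    = s≤s z≤n
θ-strict {q} h (suc m) = s≤s (*-monoʳ-< q {{>-nonZero h}} (θ-strict h m))

θ≥1 : ∀ q m → 1 ≤ θ q (suc m)
θ≥1 q m = s≤s z≤n

^≤θ : ∀ q m → q ^ m ≤ θ q (suc m)
^≤θ q zero    = s≤s z≤n
^≤θ q (suc m) = m≤n⇒m≤1+n (*-monoʳ-≤ q (^≤θ q m))

1≤^ : ∀ {q} m → 1 ≤ q → 1 ≤ q ^ m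
1≤^ {q} m h = m^n>0 q {{>-nonZero h}} m

^∸^ : ∀ p u j → suc p ^ (u + j) ∸ suc p ^ u ≡ suc p ^ u * (p * θ (suc p) j)
^∸^ p u j = begin
  suc p ^ (u + j) ∸ suc p ^ u                         ≡⟨ cong (_∸ suc p ^ u) (^-distribˡ-+-* (suc p) u j) ⟩
  suc p ^ u * suc p ^ j ∸ suc p ^ u                   ≡⟨ cong (λ z → suc p ^ u * z ∸ suc p ^ u) (θ-geometric p j) ⟩
  suc p ^ u * (1 + p * θ (suc p) j) ∸ suc p ^ u       ≡⟨ cong (_∸ suc p ^ u) (*-suc (suc p ^ u) _) ⟩
  suc p ^ u + suc p ^ u * (p * θ (suc p) j) ∸ suc p ^ u ≡⟨ m+n∸m≡n (suc p ^ u) _ ⟩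
  suc p ^ u * (p * θ (suc p) j)                       ∎
  where open ≡-Reasoning

-- For e < s ≤ b the quotient (q^b - q^e)/(q^s - q^e) grows with e, and at e = s - 1 it is exactly
-- the q-number of b + 1 - s. This is the factor lost in one branching.
^∸^-≤ : ∀ p {e s b} → e < s → s ≤ b →
        suc p ^ b ∸ suc p ^ e ≤ θ (suc p) (b + 1 ∸ s) * (suc p ^ s ∸ suc p ^ e)
^∸^-≤ p {e} {suc s} {b} (s≤s e≤s) s<b = m≤n+o⇒m∸n≤o _ (suc p ^ e) main
  where
  q = suc p
  m = b + 1 ∸ suc s
  D = q ^ s ∸ q ^ e
  split : q ^ s ≡ D + q ^ e
  split = sym (m∸n+n≡m (^-monoʳ-≤ q e≤s))
  b≡ : b ≡ s + m
  b≡ = suc-injective (trans (sym (+-comm b 1)) (sym (m+[n∸m]≡n {suc s} {b + 1} (≤-trans s<b (m≤m+n b 1)))))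
  m>0 : 1 ≤ θ q m
  m>0 = ≤-trans (θ≥1 q 0) (θ-mono q (m<n⇒0<n∸m (≤-trans (s≤s s<b) (≤-reflexive (+-comm 1 b)))))
  rhs : q ^ suc s ∸ q ^ e ≡ p * (D + q ^ e) + D
  rhs = begin
    q ^ suc s ∸ q ^ e                      ≡⟨ cong (λ z → q * z ∸ q ^ e) split ⟩
    q * (D + q ^ e) ∸ q ^ e                ≡⟨ cong (_∸ q ^ e) (lem p D (q ^ e)) ⟩
    (p * (D + q ^ e) + D) + q ^ e ∸ q ^ e  ≡⟨ m+n∸n≡m _ (q ^ e) ⟩
    p * (D + q ^ e) + D                    ∎
    where
    open ≡-Reasoning
    lem : ∀ p D x → suc p * (D + x) ≡ (p * (D + x) + D) + x
    lem = solve-∀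
  main : q ^ b ≤ q ^ e + θ q m * (q ^ suc s ∸ q ^ e)
  main = begin
    q ^ b                                       ≡⟨ trans (cong (q ^_) b≡) (^-distribˡ-+-* q s m) ⟩
    q ^ s * q ^ m                               ≡⟨ cong₂ _*_ split (θ-geometric p m) ⟩
    (D + q ^ e) * (1 + p * θ q m)               ≡⟨ lem₁ p D (q ^ e) (θ q m) ⟩
    (q ^ e + θ q m * (p * (D + q ^ e))) + 1 * D ≤⟨ +-monoʳ-≤ (q ^ e + θ q m * (p * (D + q ^ e))) (*-monoˡ-≤ D m>0) ⟩
    (q ^ e + θ q m * (p * (D + q ^ e))) + θ q m * D ≡⟨ lem₂ p D (q ^ e) (θ q m) ⟩
    q ^ e + θ q m * (p * (D + q ^ e) + D)       ≡⟨ cong (λ z → q ^ e + θ q m * z) (sym rhs) ⟩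
    q ^ e + θ q m * (q ^ suc s ∸ q ^ e)         ∎
    where
    open ≤-Reasoning
    lem₁ : ∀ p D x t → (D + x) * (1 + p * t) ≡ (x + t * (p * (D + x))) + 1 * D
    lem₁ = solve-∀
    lem₂ : ∀ p D x t → (x + t * (p * (D + x))) + t * D ≡ x + t * (p * (D + x) + D)
    lem₂ = solve-∀

-- The subspace lattice

-- The subspaces of a finite vector space of order q ^ n, seen through their
-- incidence with the (codes of the) vectors.
record Geometry : Set₁ where
  infix 4 _∈_ _⊆_ _∈?_
  infixr 7 _∩_
  field
    q n Q : ℕ
    2≤q   : 2 ≤ q
    Sp    : Set
    dim   : Sp → ℕ
    _∈_   : Fin Q → Sp → Set
    _∈?_  : ∀ x U → Dec (x ∈ U)
  _⊆_ : Sp → Sp → Set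
  U ⊆ W = ∀ x → x ∈ U → x ∈ W
  field
    dim-mono  : ∀ {U W} → U ⊆ W → dim U ≤ dim W
    ⊥ˢ ⊤ˢ     : Sp
    dim-⊥     : dim ⊥ˢ ≡ 0
    dim-⊤     : dim ⊤ˢ ≡ n
    ∈-⊤       : ∀ x → x ∈ ⊤ˢ
    add       : Sp → Fin Q → Sp
    add-⊆     : ∀ U x → U ⊆ add U x
    add-∈     : ∀ U x → x ∈ add U x
    add-least : ∀ {U W x} → U ⊆ W → x ∈ W → add U x ⊆ W
    dim-add   : ∀ {U x} → ¬ (x ∈ U) → dim (add U x) ≡ suc (dim U)
    _∩_       : Sp → Sp → Sp
    ∩-intro   : ∀ {U W} x → x ∈ U → x ∈ W → x ∈ U ∩ W
    ∩-⊆ˡ      : ∀ U W → (U ∩ W) ⊆ U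
    ∩-⊆ʳ      : ∀ U W → (U ∩ W) ⊆ W
    -- The modular law W ∩ (U + x) = (U ∩ W) + x for x in W, one vector at a time; the dimension
    -- formula `modular` rests on it.
    add-mod   : ∀ {U W x y} → x ∈ W → y ∈ W → y ∈ add U x → y ∈ add (U ∩ W) x
    card      : ∀ U → # (_∈? U) ≡ q ^ dim U
    num       : ℕ → ℕ
    sub       : ∀ d → Fin (num d) → Sp
    dim-sub   : ∀ {d} i → dim (sub d i) ≡ d
    -- Inclusion is enough because both spaces have dimension `d`. Each subspace thus has a single
    -- index, and counting indices counts subspaces.
    sub-inj   : ∀ {d i j} → sub d i ⊆ sub d j → i ≡ j
    sub-surj  : ∀ U → Σ (Fin (num (dim U))) λ i → U ⊆ sub (dim U) i × sub (dim U) i ⊆ U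

module Lattice (G : Geometry) where
  open Geometry G public

  private variable
    U W X Y Z : Sp
    x y : Fin Q
    d m : ℕ

  ⊆-refl : U ⊆ U
  ⊆-refl x = id

  ⊆-trans : U ⊆ W → W ⊆ X → U ⊆ X
  ⊆-trans f g x = g x ∘ f x

  ∩-least : X ⊆ U → X ⊆ W → X ⊆ U ∩ W
  ∩-least f g x h = ∩-intro x (f x h) (g x h)

  ∩-mono : X ⊆ U → Y ⊆ W → X ∩ Y ⊆ U ∩ W
  ∩-mono {X} {Y = Y} f g = ∩-least (⊆-trans (∩-⊆ˡ X Y) f) (⊆-trans (∩-⊆ʳ X Y) g)

  ∩-comm-⊆ : X ∩ Y ⊆ Y ∩ X
  ∩-comm-⊆ {X} {Y} = ∩-least (∩-⊆ʳ X Y) (∩-⊆ˡ X Y)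

  ⊆-⊤ : U ⊆ ⊤ˢ
  ⊆-⊤ x _ = ∈-⊤ x

  abstract
    _⊆?_ : ∀ U W → Dec (U ⊆ W)
    U ⊆? W = Fin.all? (λ x → (x ∈? U) →-dec (x ∈? W))

  abstract
    ⊈-witness : ¬ (U ⊆ W) → ∃ λ x → x ∈ U × ¬ (x ∈ W)
    ⊈-witness {U} {W} h with Fin.any? (λ x → (x ∈? U) ×-dec ¬? (x ∈? W))
    ... | yes w = w
    ... | no ¬w = ⊥-elim (h λ x x∈U → decide x x∈U (x ∈? W))
      where
      decide : ∀ x → x ∈ U → Dec (x ∈ W) → x ∈ W
      decide x x∈U (yes p) = p
      decide x x∈U (no ¬p) = ⊥-elim (¬w (x , x∈U , ¬p))

  add-mono : U ⊆ W → add U x ⊆ add W x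
  add-mono {W = W} {x} f = add-least (⊆-trans f (add-⊆ W x)) (add-∈ W x)

  abstract
    ⊆-of-dim : U ⊆ W → dim W ≤ dim U → W ⊆ U
    ⊆-of-dim {U} {W} U⊆W le x x∈W with x ∈? U
    ... | yes p = p
    ... | no ¬p = ⊥-elim (<-irrefl refl (≤-trans (≤-reflexive (sym (dim-add ¬p)))
                    (≤-trans (dim-mono (add-least U⊆W x∈W)) le)))

  abstract
    dim-strict : U ⊆ W → ¬ (W ⊆ U) → dim U < dim W
    dim-strict U⊆W W⊈U = ≰⇒> (W⊈U ∘ ⊆-of-dim U⊆W)

  dim<⇒⊈ : dim U < dim W → ¬ (W ⊆ U)
  dim<⇒⊈ lt h = <⇒≱ lt (dim-mono h)

  dim-≤n : dim U ≤ n
  dim-≤n = ≤-trans (dim-mono ⊆-⊤) (≤-reflexive dim-⊤)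

  ⊥-⊆ : ⊥ˢ ⊆ U
  ⊥-⊆ {U} = ⊆-trans (⊆-of-dim (∩-⊆ˡ ⊥ˢ U) (≤-trans (≤-reflexive dim-⊥) z≤n)) (∩-⊆ʳ ⊥ˢ U)

  dim-add-≤ : dim (add U x) ≤ suc (dim U)
  dim-add-≤ {U} {x} with x ∈? U
  ... | yes p = m≤n⇒m≤1+n (dim-mono (add-least ⊆-refl p))
  ... | no ¬p = ≤-reflexive (dim-add ¬p)

  abstract
    exchange : y ∈ add U x → ¬ (y ∈ U) → x ∈ add U y
    exchange {y} {U} {x} y∈ y∉ = ⊆-of-dim (add-least (add-⊆ U x) y∈)
      (≤-trans dim-add-≤ (≤-reflexive (sym (dim-add y∉)))) x (add-∈ U x)

  private
    addAll : ∀ {m} → (Fin m → Fin Q) → Sp → Sp → Sp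
    addAll {zero}  f W U = U
    addAll {suc m} f W U with f zero ∈? W
    ... | yes _ = add (addAll (f ∘ suc) W U) (f zero)
    ... | no _  = addAll (f ∘ suc) W U

    addAll-⊆ : ∀ {m} (f : Fin m → Fin Q) → U ⊆ addAll f W U
    addAll-⊆ {m = zero}  f = ⊆-refl
    addAll-⊆ {W = W} {m = suc m} f with f zero ∈? W
    ... | yes _ = ⊆-trans (addAll-⊆ (f ∘ suc)) (add-⊆ _ _)
    ... | no _  = addAll-⊆ (f ∘ suc)

    addAll-∈ : ∀ {m} (f : Fin m → Fin Q) i → f i ∈ W → f i ∈ addAll f W U
    addAll-∈ {W} f zero h with f zero ∈? W
    ... | yes _ = add-∈ _ _
    ... | no ¬p = ⊥-elim (¬p h)
    addAll-∈ {W} f (suc i) h with f zero ∈? W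
    ... | yes _ = add-⊆ _ _ _ (addAll-∈ (f ∘ suc) i h)
    ... | no _  = addAll-∈ (f ∘ suc) i h

    addAll-least : ∀ {m} (f : Fin m → Fin Q) → U ⊆ X → W ⊆ X → addAll f W U ⊆ X
    addAll-least {m = zero} f g h = g
    addAll-least {W = W} {m = suc m} f g h with f zero ∈? W
    ... | yes p = add-least (addAll-least (f ∘ suc) g h) (h _ p)
    ... | no _  = addAll-least (f ∘ suc) g h

  infixr 6 _∨_
  -- Only single vectors can be adjoined, so the join runs through all codes and adjoins those lying
  -- in `W`.
  _∨_ : Sp → Sp → Sp
  U ∨ W = addAll id W U

  abstract
    ∨-⊆ˡ : ∀ U W → U ⊆ U ∨ W
    ∨-⊆ˡ U W = addAll-⊆ id

  abstract
    ∨-⊆ʳ : ∀ U W → W ⊆ U ∨ W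
    ∨-⊆ʳ U W x = addAll-∈ id x

  abstract
    ∨-least : U ⊆ X → W ⊆ X → U ∨ W ⊆ X
    ∨-least = addAll-least id

  -- `U` grows by vectors of `W` until it contains `W`. Each of them raises `dim U` and, by
  -- `add-mod`, also `dim (U ∩ W)` by one and leaves the join unchanged; the fuel bounds
  -- `dim W ∸ dim (U ∩ W)`.
  modular : ∀ U W → dim (U ∩ W) + dim (U ∨ W) ≡ dim U + dim W
  modular U W = go (dim W) U (m≤n+m (dim W) (dim (U ∩ W)))
    where
    go : ∀ fuel U → dim W ≤ dim (U ∩ W) + fuel → dim (U ∩ W) + dim (U ∨ W) ≡ dim U + dim W
    inside : ∀ {U} → W ⊆ U → dim (U ∩ W) + dim (U ∨ W) ≡ dim U + dim W
    inside {U} W⊆U = trans (+-comm (dim (U ∩ W)) _) (cong₂ _+_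
      (≤-antisym (dim-mono (∨-least ⊆-refl W⊆U)) (dim-mono (∨-⊆ˡ U W)))
      (≤-antisym (dim-mono (∩-⊆ʳ U W)) (dim-mono (∩-least W⊆U ⊆-refl))))
    go zero U le = inside (⊆-trans (⊆-of-dim (∩-⊆ʳ U W) (≤-trans le (≤-reflexive (+-identityʳ _)))) (∩-⊆ˡ U W))
    go (suc fuel) U le with W ⊆? U
    ... | yes W⊆U = inside W⊆U
    ... | no W⊈U with ⊈-witness W⊈U
    ... | w , w∈W , w∉U = suc-injective (begin
            suc (dim (U ∩ W) + dim (U ∨ W))          ≡⟨ cong₂ _+_ (sym dim∩) (sym dim∨) ⟩
            dim (U′ ∩ W) + dim (U′ ∨ W)              ≡⟨ go fuel U′ (≤-trans le (≤-reflexive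
                                                          (trans (+-suc _ fuel) (cong (_+ fuel) (sym dim∩))))) ⟩
            dim U′ + dim W                           ≡⟨ cong (_+ dim W) (dim-add w∉U) ⟩
            suc (dim U + dim W)                      ∎)
      where
      open ≡-Reasoning
      U′ = add U w
      dim∩ : dim (U′ ∩ W) ≡ suc (dim (U ∩ W))
      dim∩ = trans (≤-antisym
        (dim-mono (λ y y∈ → add-mod w∈W (∩-⊆ʳ U′ W y y∈) (∩-⊆ˡ U′ W y y∈)))
        (dim-mono (add-least (∩-mono (add-⊆ U w) ⊆-refl) (∩-intro w (add-∈ U w) w∈W))))
        (dim-add (w∉U ∘ ∩-⊆ˡ U W w))
      dim∨ : dim (U′ ∨ W) ≡ dim (U ∨ W)
      dim∨ = ≤-antisym
        (dim-mono (∨-least (add-least (∨-⊆ˡ U W) (∨-⊆ʳ U W w w∈W)) (∨-⊆ʳ U W)))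
        (dim-mono (∨-least (⊆-trans (add-⊆ U w) (∨-⊆ˡ U′ W)) (∨-⊆ʳ U′ W)))

  abstract
    dim-sum-≤ : U ⊆ Z → W ⊆ Z → dim U + dim W ≤ dim (U ∩ W) + dim Z
    dim-sum-≤ {U} {Z} {W} f g = ≤-trans (≤-reflexive (sym (modular U W)))
                                        (+-monoʳ-≤ (dim (U ∩ W)) (dim-mono (∨-least f g)))

  abstract
    -- Greedy choice of a vector `x` outside `U ∨ W`: a new vector common with `W` would, by
    -- exchange, put `x` into `U ∨ W`.
    extend-avoiding : ∀ j → U ⊆ Z → dim (U ∨ W) + j ≤ dim Z →
      ∃ λ X → U ⊆ X × X ⊆ Z × dim X ≡ dim U + j × X ∩ W ⊆ U
    extend-avoiding {U} {Z} {W} zero U⊆Z le = U , ⊆-refl , U⊆Z , sym (+-identityʳ _) , ∩-⊆ˡ U W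
    extend-avoiding {U} {Z} {W} (suc j) U⊆Z le
      with ⊈-witness (dim<⇒⊈ {U ∨ W} {Z} (≤-trans (≤-trans (s≤s (m≤m+n _ j)) (≤-reflexive (sym (+-suc _ j)))) le))
    ... | x , x∈Z , x∉ with extend-avoiding {add U x} {Z} {W} j (add-least U⊆Z x∈Z)
                             (≤-trans (+-monoˡ-≤ j dim′) (≤-trans (≤-reflexive (sym (+-suc _ j))) le))
      where
      dim′ : dim (add U x ∨ W) ≤ suc (dim (U ∨ W))
      dim′ = ≤-trans (dim-mono (∨-least (add-mono (∨-⊆ˡ U W)) (⊆-trans (∨-⊆ʳ U W) (add-⊆ (U ∨ W) x))))
                     dim-add-≤
    ... | X , U⊆X , X⊆Z , dX , av =
          X , ⊆-trans (add-⊆ U x) U⊆X , X⊆Z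
        , trans dX (trans (cong (_+ j) (dim-add (x∉ ∘ ∨-⊆ˡ U W x))) (sym (+-suc _ j)))
        , avoid
      where
      avoid : X ∩ W ⊆ U
      avoid y y∈ with y ∈? U
      ... | yes p = p
      ... | no ¬p = ⊥-elim (x∉ (add-least (∨-⊆ˡ U W) (∨-⊆ʳ U W y (∩-⊆ʳ X W y y∈)) x
                                  (exchange (av y y∈) ¬p)))

  abstract
    interpolate : ∀ d → U ⊆ Z → dim U ≤ d → d ≤ dim Z → ∃ λ X → U ⊆ X × X ⊆ Z × dim X ≡ d
    interpolate {U} {Z} d U⊆Z lo hi with extend-avoiding {U} {Z} {U} (d ∸ dim U) U⊆Z
       (≤-trans (+-monoˡ-≤ (d ∸ dim U) (dim-mono (∨-least (⊆-refl {U}) ⊆-refl)))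
                (≤-trans (≤-reflexive (m+[n∸m]≡n lo)) hi))
    ... | X , f , g , e , _ = X , f , g , trans e (m+[n∸m]≡n lo)

  sub-index : ∀ U → dim U ≡ d → Σ (Fin (num d)) λ i → U ⊆ sub d i × sub d i ⊆ U
  sub-index U refl = sub-surj U

-- Numbers of subspaces with prescribed incidences

module Counting (G : Geometry) where
  open Lattice G public

  private variable
    U W X Y Z M U′ M′ W′ : Sp
    x y : Fin Q
    d e : ℕ

  1≤q : 1 ≤ q
  1≤q = ≤-trans (s≤s z≤n) 2≤q

  1<q^ : ∀ {m} → 1 ≤ m → 1 < q ^ m
  1<q^ {m} h = ≤-trans 2≤q (≤-trans (≤-reflexive (sym (*-identityʳ q))) (^-monoʳ-≤ q {{>-nonZero 1≤q}} h))

  q^-mono : ∀ {a b} → a ≤ b → q ^ a ≤ q ^ b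
  q^-mono = ^-monoʳ-≤ q {{>-nonZero 1≤q}}

  q^-strict : ∀ {a b} → a < b → q ^ a < q ^ b
  q^-strict {a} {b} h = begin-strict
    q ^ a        <⟨ m<m*n (q ^ a) q {{>-nonZero (1≤^ a 1≤q)}} 2≤q ⟩
    q ^ a * q    ≡⟨ *-comm (q ^ a) q ⟩
    q ^ suc a    ≤⟨ q^-mono h ⟩
    q ^ b        ∎
    where open ≤-Reasoning

  #-∖ : ∀ U W → # (λ x → (x ∈? W) ×-dec ¬? (x ∈? U)) ≡ q ^ dim W ∸ q ^ dim (U ∩ W)
  #-∖ U W = sym (begin
    q ^ dim W ∸ q ^ dim (U ∩ W)
      ≡⟨ cong₂ _∸_ (sym (card W)) (sym (card (U ∩ W))) ⟩
    # (_∈? W) ∸ # (_∈? (U ∩ W))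
      ≡⟨ cong (_∸ # (_∈? (U ∩ W))) (#-split (_∈? W) (_∈? U)) ⟩
    # (λ x → (x ∈? W) ×-dec (x ∈? U)) + # (λ x → (x ∈? W) ×-dec ¬? (x ∈? U)) ∸ # (_∈? (U ∩ W))
      ≡⟨ cong (λ z → z + # (λ x → (x ∈? W) ×-dec ¬? (x ∈? U)) ∸ # (_∈? (U ∩ W))) (#-cong _ (_∈? (U ∩ W))
           (λ x p → ∩-intro x (proj₂ p) (proj₁ p)) (λ x p → ∩-⊆ʳ U W x p , ∩-⊆ˡ U W x p)) ⟩
    # (_∈? (U ∩ W)) + # (λ x → (x ∈? W) ×-dec ¬? (x ∈? U)) ∸ # (_∈? (U ∩ W))
      ≡⟨ m+n∸m≡n (# (_∈? (U ∩ W))) _ ⟩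
    # (λ x → (x ∈? W) ×-dec ¬? (x ∈? U)) ∎)
    where open ≡-Reasoning

  dim-∩-⊆ : U ⊆ W → dim (U ∩ W) ≡ dim U
  dim-∩-⊆ {U} {W} h = ≤-antisym (dim-mono (∩-⊆ˡ U W)) (dim-mono (∩-least ⊆-refl h))

  #-∖-⊆ : U ⊆ W → # (λ x → (x ∈? W) ×-dec ¬? (x ∈? U)) ≡ q ^ dim W ∸ q ^ dim U
  #-∖-⊆ {U} {W} h = trans (#-∖ U W) (cong (λ z → q ^ dim W ∸ q ^ z) (dim-∩-⊆ h))

  module _ (d : ℕ) (U M W : Sp) where
    -- For U ⊆ M the first two conditions say that the space meets `M` exactly in `U`. Taking M = U
    -- leaves the interval from `U` to `W`; taking W = `⊤ˢ` lifts the upper bound.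
    Between : Fin (num d) → Set
    Between i = U ⊆ sub d i × sub d i ∩ M ⊆ U × sub d i ⊆ W

    between? : Decidable Between
    between? i = (U ⊆? sub d i) ×-dec ((sub d i ∩ M) ⊆? U) ×-dec (sub d i ⊆? W)

    E : ℕ
    E = # between?

  E-base : dim U ≡ d → U ⊆ W → E d U M W ≡ 1
  E-base {U} {d} {W} {M} eq U⊆W with sub-index U eq
  ... | i , f , g = #-one (between? d U M W) i (f , ⊆-trans (∩-⊆ˡ _ M) g , ⊆-trans g U⊆W)
    λ a b pa pb → sub-inj (⊆-trans (⊆-of-dim (proj₁ pa)
        (≤-reflexive (trans (dim-sub a) (sym eq)))) (proj₁ pb))

  E-empty : d < dim U → E d U M W ≡ 0
  E-empty {d} {U} {M} {W} lt = #-none (between? d U M W)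
    λ i p → <⇒≱ lt (≤-trans (dim-mono (proj₁ p)) (≤-reflexive (dim-sub i)))

  -- Double counting of the pairs (F, x) with x ∈ F ∖ U.
  E-rec : U ⊆ M → M ⊆ W → (c : ℕ) →
          (∀ x → x ∈ W → ¬ (x ∈ M) → E d (add U x) (add M x) W ≡ c) →
          E d U M W * (q ^ d ∸ q ^ dim U) ≡ (q ^ dim W ∸ q ^ dim M) * c
  E-rec {U} {M} {W} {d} U⊆M M⊆W c hc = trans
    (≤-antisym
      (double-count-≤ (between? d U M W) Q? R? _ c
        (λ i p → ≤-reflexive (sym (row i (proj₁ p))))
        (λ x p → ≤-reflexive (col x (proj₁ p) (proj₂ p)))
        λ i x p r → proj₂ (proj₂ p) x (proj₁ r)
                  , λ x∈M → proj₂ r (proj₁ (proj₂ p) x (∩-intro x (proj₁ r) x∈M)))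
      (double-count-≥ (between? d U M W) Q? R? _ c
        (λ i p → ≤-reflexive (row i (proj₁ p)))
        (λ x p → ≤-reflexive (sym (col x (proj₁ p) (proj₂ p))))))
    (cong (_* c) (#-∖-⊆ M⊆W))
    where
    Q? = λ x → (x ∈? W) ×-dec ¬? (x ∈? M)
    R? = λ i x → (x ∈? sub d i) ×-dec ¬? (x ∈? U)
    row : ∀ i → U ⊆ sub d i → # (R? i) ≡ q ^ d ∸ q ^ dim U
    row i h = trans (#-∖-⊆ h) (cong (λ z → q ^ z ∸ q ^ dim U) (dim-sub i))
    col : ∀ x → x ∈ W → ¬ (x ∈ M) → # (λ i → between? d U M W i ×-dec R? i x) ≡ c
    col x x∈W x∉M = trans (#-cong _ (between? d (add U x) (add M x) W) to from) (hc x x∈W x∉M)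
      where
      to : ∀ i → Between d U M W i × (x ∈ sub d i × ¬ (x ∈ U)) → Between d (add U x) (add M x) W i
      to i ((a , b , c) , x∈F , _) = add-least a x∈F
        , (λ y y∈ → add-mono (⊆-trans ∩-comm-⊆ b) y
             (add-mod x∈F (∩-⊆ˡ _ (add M x) y y∈) (∩-⊆ʳ _ (add M x) y y∈))) , c
      from : ∀ i → Between d (add U x) (add M x) W i → Between d U M W i × (x ∈ sub d i × ¬ (x ∈ U))
      from i (a , b , c) = (⊆-trans (add-⊆ U x) a , avoid , c) , a x (add-∈ U x) , x∉M ∘ U⊆M x
        where
        avoid : sub d i ∩ M ⊆ U
        avoid y y∈ with y ∈? U
        ... | yes p = p
        ... | no ¬p = ⊥-elim (x∉M (add-least U⊆M (∩-⊆ʳ (sub d i) M y y∈) x (exchange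
                (b y (∩-mono (⊆-refl {sub d i}) (add-⊆ M x) y y∈)) ¬p)))

  private
    gap>0 : ∀ {a b} → a < b → 1 ≤ q ^ b ∸ q ^ a
    gap>0 h = m<n⇒0<n∸m (q^-strict h)

    -- Induction on d - dim U. `E-rec` reduces both counts to counts one dimension up, with factors
    -- that depend on dimensions only, and the value `c` at one fixed `x₀` serves as the next count
    -- for both triples. If `W` has no vector outside `M`, the factor and hence both counts vanish.
    E-dims′ : ∀ j → U ⊆ M → M ⊆ W → U′ ⊆ M′ → M′ ⊆ W′ →
      dim U + j ≡ d → dim U′ ≡ dim U → dim M′ ≡ dim M → dim W′ ≡ dim W →
      E d U M W ≡ E d U′ M′ W′
    E-dims′ zero f g f′ g′ eq eu em ew =
      trans (E-base (trans (sym (+-identityʳ _)) eq) (⊆-trans f g))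
            (sym (E-base (trans eu (trans (sym (+-identityʳ _)) eq)) (⊆-trans f′ g′)))
    E-dims′ {U} {M} {W} {U′} {M′} {W′} {d} (suc j) f g f′ g′ eq eu em ew
      with Fin.any? (λ x → (x ∈? W) ×-dec ¬? (x ∈? M))
    ... | yes (x₀ , x₀∈W , x₀∉M) = *-cancelʳ-≡ _ _ (q ^ d ∸ q ^ dim U) {{>-nonZero gap}} (begin
            E d U M W * (q ^ d ∸ q ^ dim U)       ≡⟨ E-rec f g c step ⟩
            (q ^ dim W ∸ q ^ dim M) * c           ≡⟨ cong₂ (λ a b → (q ^ a ∸ q ^ b) * c) (sym ew) (sym em) ⟩
            (q ^ dim W′ ∸ q ^ dim M′) * c         ≡⟨ sym (E-rec f′ g′ c step′) ⟩
            E d U′ M′ W′ * (q ^ d ∸ q ^ dim U′)   ≡⟨ cong (λ z → E d U′ M′ W′ * (q ^ d ∸ q ^ z)) eu ⟩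
            E d U′ M′ W′ * (q ^ d ∸ q ^ dim U)    ∎)
      where
      open ≡-Reasoning
      c = E d (add U x₀) (add M x₀) W
      gap : 1 ≤ q ^ d ∸ q ^ dim U
      gap = gap>0 (≤-trans (m<m+n (dim U) (s≤s z≤n)) (≤-reflexive eq))
      dU = dim-add (x₀∉M ∘ f x₀)
      step : ∀ x → x ∈ W → ¬ (x ∈ M) → E d (add U x) (add M x) W ≡ c
      step x x∈W x∉M = E-dims′ j (add-mono f) (add-least g x∈W) (add-mono f) (add-least g x₀∈W)
        (trans (cong (_+ j) (dim-add (x∉M ∘ f x))) (trans (sym (+-suc _ j)) eq))
        (trans dU (sym (dim-add (x∉M ∘ f x)))) (trans (dim-add x₀∉M) (sym (dim-add x∉M))) refl
      step′ : ∀ x → x ∈ W′ → ¬ (x ∈ M′) → E d (add U′ x) (add M′ x) W′ ≡ c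
      step′ x x∈W x∉M = sym (E-dims′ j (add-mono f) (add-least g x₀∈W) (add-mono f′) (add-least g′ x∈W)
        (trans (cong (_+ j) dU) (trans (sym (+-suc _ j)) eq))
        (trans (dim-add (x∉M ∘ f′ x)) (trans (cong suc eu) (sym dU)))
        (trans (dim-add x∉M) (trans (cong suc em) (sym (dim-add x₀∉M)))) ew)
    ... | no none = trans (zero-of f g refl refl refl none) (sym (zero-of f′ g′ eu em ew
             λ { (x , x∈ , x∉) → <⇒≱ (≤-trans (≤-reflexive (cong suc (sym em)))
                  (≤-trans (≤-reflexive (sym (dim-add x∉))) (≤-trans (dim-mono (add-least g′ x∈)) (≤-reflexive ew)))) W≤M }))
      where
      W≤M : dim W ≤ dim M
      W≤M with W ⊆? M
      ... | yes h = dim-mono h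
      ... | no h = ⊥-elim (none (⊈-witness h))
      zero-of : ∀ {U′ M′ W′} → U′ ⊆ M′ → M′ ⊆ W′ → dim U′ ≡ dim U → dim M′ ≡ dim M → dim W′ ≡ dim W →
                ¬ (∃ λ x → x ∈ W′ × ¬ (x ∈ M′)) → E d U′ M′ W′ ≡ 0
      zero-of {U′} {M′} {W′} f g eu em ew none = m*n≡0⇒m≡0 _ (q ^ d ∸ q ^ dim U′)
        {{>-nonZero (gap>0 (≤-trans (m<m+n (dim U′) (s≤s z≤n)) (≤-reflexive (trans (cong (_+ suc j) eu) eq))))}}
        (trans (E-rec f g 0 (λ x a b → ⊥-elim (none (x , a , b)))) (*-zeroʳ (q ^ dim W′ ∸ q ^ dim M′)))

  E-dims : U ⊆ M → M ⊆ W → U′ ⊆ M′ → M′ ⊆ W′ →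
    dim U′ ≡ dim U → dim M′ ≡ dim M → dim W′ ≡ dim W → E d U M W ≡ E d U′ M′ W′
  E-dims {U} {d = d} f g f′ g′ eu em ew with dim U ≤? d
  ... | yes le = E-dims′ (d ∸ dim U) f g f′ g′ (m+[n∸m]≡n le) eu em ew
  ... | no nle = trans (E-empty (≰⇒> nle)) (sym (E-empty (≤-trans (≰⇒> nle) (≤-reflexive (sym eu)))))

  E-step : U ⊆ M → M ⊆ W → x ∈ W → ¬ (x ∈ M) →
    E d U M W * (q ^ d ∸ q ^ dim U) ≡ (q ^ dim W ∸ q ^ dim M) * E d (add U x) (add M x) W
  E-step {U} {M} {W} {x} f g x∈ x∉ = E-rec f g _ λ y y∈ y∉ →
    E-dims (add-mono f) (add-least g y∈) (add-mono f) (add-least g x∈)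
      (trans (dim-add (x∉ ∘ f x)) (sym (dim-add (y∉ ∘ f y))))
      (trans (dim-add x∉) (sym (dim-add y∉))) refl

  interval : ℕ → Sp → Sp → ℕ
  interval d U W = E d U U W

  -- The recurrence of the Gaussian coefficients: both differences of powers in `E-step` contain the
  -- factor q^u (q - 1), and q-numbers remain after cancelling it.
  interval-step : U ⊆ W → x ∈ W → ¬ (x ∈ U) → dim U ≤ d →
    interval d U W * θ q (d ∸ dim U) ≡ θ q (dim W ∸ dim U) * interval d (add U x) W
  interval-step {U} {W} {x} {d} U⊆W x∈ x∉ u≤d = go q refl
    where
    u = dim U
    I = interval d U W
    J = interval d (add U x) W
    go : ∀ q′ → q ≡ q′ → I * θ q (d ∸ u) ≡ θ q (dim W ∸ u) * J
    go zero eq = ⊥-elim (<⇒≱ 1≤q (≤-reflexive eq))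
    go (suc zero) eq = ⊥-elim (<⇒≱ 2≤q (≤-reflexive eq))
    go (suc p@(suc _)) refl = *-cancelˡ-≡ _ _ (q ^ u * p) {{>-nonZero (*-mono-≤ (1≤^ {q} u (s≤s z≤n)) (s≤s {n = _} z≤n))}} (begin
      q ^ u * p * (I * θ q (d ∸ u))          ≡⟨ lem (q ^ u) p I (θ q (d ∸ u)) ⟩
      I * (q ^ u * (p * θ q (d ∸ u)))        ≡⟨ cong (I *_) (sym (diff u≤d)) ⟩
      I * (q ^ d ∸ q ^ u)                    ≡⟨ E-step ⊆-refl U⊆W x∈ x∉ ⟩
      (q ^ dim W ∸ q ^ u) * J                ≡⟨ cong (_* J) (diff (dim-mono U⊆W)) ⟩
      q ^ u * (p * θ q (dim W ∸ u)) * J      ≡⟨ lem₂ (q ^ u) p (θ q (dim W ∸ u)) J ⟩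
      q ^ u * p * (θ q (dim W ∸ u) * J)      ∎)
      where
      open ≡-Reasoning
      diff : ∀ {b} → u ≤ b → q ^ b ∸ q ^ u ≡ q ^ u * (p * θ q (b ∸ u))
      diff {b} le = trans (cong (λ z → q ^ z ∸ q ^ u) (sym (m+[n∸m]≡n le))) (^∸^ p u (b ∸ u))
      lem : ∀ a p i t → a * p * (i * t) ≡ i * (a * (p * t))
      lem = solve-∀
      lem₂ : ∀ a p t j → a * (p * t) * j ≡ a * p * (t * j)
      lem₂ = solve-∀

  private
    witness< : U ⊆ W → dim U < dim W → ∃ λ x → x ∈ W × ¬ (x ∈ U)
    witness< _ lt = ⊈-witness (dim<⇒⊈ lt)

    θ-gap : ∀ {a b} → a < b → 1 ≤ θ q (b ∸ a)
    θ-gap h = ≤-trans (θ≥1 q 0) (θ-mono q (m<n⇒0<n∸m h))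

  pencil-size : U ⊆ W → dim U ≡ e → interval (suc e) U W ≡ θ q (dim W ∸ e)
  pencil-size {U} {W} {_} U⊆W refl with dim U <? dim W
  ... | yes lt with witness< U⊆W lt
  ... | x , x∈ , x∉ = *-cancelʳ-≡ _ _ (θ q (suc (dim U) ∸ dim U)) {{>-nonZero (θ-gap {dim U} ≤-refl)}} (begin
        interval (suc (dim U)) U W * θ q (suc (dim U) ∸ dim U)
          ≡⟨ interval-step U⊆W x∈ x∉ (n≤1+n _) ⟩
        θ q (dim W ∸ dim U) * interval (suc (dim U)) (add U x) W
          ≡⟨ cong (θ q (dim W ∸ dim U) *_) (E-base (dim-add x∉) (add-least U⊆W x∈)) ⟩
        θ q (dim W ∸ dim U) * 1
          ≡⟨ cong (θ q (dim W ∸ dim U) *_) (sym (trans (cong (θ q) (m+n∸n≡m 1 (dim U))) (cong suc (*-zeroʳ q)))) ⟩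
        θ q (dim W ∸ dim U) * θ q (suc (dim U) ∸ dim U) ∎)
    where open ≡-Reasoning
  pencil-size {U} {W} U⊆W refl | no nlt = trans
    (#-none (between? (suc (dim U)) U U W) (λ i p → nlt (≤-trans (≤-reflexive (sym (dim-sub i))) (dim-mono (proj₂ (proj₂ p))))))
    (cong (θ q) (sym (m≤n⇒m∸n≡0 (≮⇒≥ nlt))))

  hyperplanes-size : ∀ j → U ⊆ W → dim U + j ≡ d → dim W ≡ suc d → interval d U W ≡ θ q (suc j)
  hyperplanes-size zero U⊆W eq _ = trans (E-base (trans (sym (+-identityʳ _)) eq) U⊆W) (cong suc (sym (*-zeroʳ q)))
  hyperplanes-size {U} {W} {d} (suc j) U⊆W eq ew
    with witness< U⊆W (≤-trans (s≤s (m≤m+n _ (suc j))) (≤-reflexive (trans (cong suc eq) (sym ew))))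
  ... | x , x∈ , x∉ = *-cancelʳ-≡ _ _ (θ q (suc j)) (begin
        interval d U W * θ q (suc j)                              ≡⟨ cong (λ z → interval d U W * θ q z) (sym d-u) ⟩
        interval d U W * θ q (d ∸ dim U)                          ≡⟨ interval-step U⊆W x∈ x∉ u≤d ⟩
        θ q (dim W ∸ dim U) * interval d (add U x) W              ≡⟨ cong₂ (λ a b → θ q a * b) w-u
            (hyperplanes-size j (add-least U⊆W x∈) (trans (cong (_+ j) (dim-add x∉)) (trans (sym (+-suc _ j)) eq)) ew) ⟩
        θ q (suc (suc j)) * θ q (suc j)                           ∎)
    where
    open ≡-Reasoning
    u≤d : dim U ≤ d
    u≤d = ≤-trans (m≤m+n _ (suc j)) (≤-reflexive eq)
    d-u : d ∸ dim U ≡ suc j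
    d-u = trans (cong (_∸ dim U) (sym eq)) (m+n∸m≡n (dim U) (suc j))
    w-u : dim W ∸ dim U ≡ suc (suc j)
    w-u = trans (cong (_∸ dim U) (trans ew (trans (cong suc (sym eq)) (sym (+-suc (dim U) (suc j)))))) (m+n∸m≡n (dim U) _)

  -- Choosing first an (e+1)-space over `U` and then a member of its pencil reaches each space
  -- `θ q 2` times.
  colines-size : U ⊆ W → dim U ≡ e → dim U < dim W →
    interval (suc (suc e)) U W * θ q 2 ≡ θ q (dim W ∸ e) * θ q (dim W ∸ suc e)
  colines-size {U} {W} {_} U⊆W refl lt with witness< U⊆W lt
  ... | x , x∈ , x∉ = begin
        interval (suc (suc (dim U))) U W * θ q 2
          ≡⟨ cong (λ z → interval (suc (suc (dim U))) U W * θ q z) (sym (m+n∸n≡m 2 (dim U))) ⟩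
        interval (suc (suc (dim U))) U W * θ q (suc (suc (dim U)) ∸ dim U)
          ≡⟨ interval-step U⊆W x∈ x∉ (≤-trans (n≤1+n _) (n≤1+n _)) ⟩
        θ q (dim W ∸ dim U) * interval (suc (suc (dim U))) (add U x) W
          ≡⟨ cong (θ q (dim W ∸ dim U) *_) (pencil-size (add-least U⊆W x∈) (dim-add x∉)) ⟩
        θ q (dim W ∸ dim U) * θ q (dim W ∸ suc (dim U)) ∎
    where open ≡-Reasoning

  above : ℕ → Sp → ℕ
  above d U = interval d U ⊤ˢ

  above-dims : dim U ≡ dim U′ → above d U ≡ above d U′
  above-dims eq = E-dims ⊆-refl ⊆-⊤ ⊆-refl ⊆-⊤ (sym eq) (sym eq) refl

  -- For u = dim U < d the ratio of the two counts is (q^n - q^u)/(q^d - q^u), which is at least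
  -- q^(n-d).
  above-add : ¬ (x ∈ U) → d ≤ n → above d (add U x) * q ^ (n ∸ d) ≤ above d U
  above-add {x} {U} {d} x∉ d≤n with dim U <? d
  ... | no nlt = ≤-trans (≤-reflexive (cong (_* q ^ (n ∸ d)) (E-empty (≤-trans (s≤s (≮⇒≥ nlt)) (≤-reflexive (sym (dim-add x∉))))))) z≤n
  ... | yes lt = *-cancelʳ-≤ _ _ (q ^ d ∸ q ^ dim U) {{>-nonZero (m<n⇒0<n∸m (q^-strict lt))}} (begin
        above d (add U x) * q ^ (n ∸ d) * (q ^ d ∸ q ^ dim U)      ≡⟨ *-assoc (above d (add U x)) _ _ ⟩
        above d (add U x) * (q ^ (n ∸ d) * (q ^ d ∸ q ^ dim U))    ≤⟨ *-monoʳ-≤ (above d (add U x)) gap ⟩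
        above d (add U x) * (q ^ n ∸ q ^ dim U)                    ≡⟨ *-comm (above d (add U x)) _ ⟩
        (q ^ n ∸ q ^ dim U) * above d (add U x)                    ≡⟨ cong (λ z → (q ^ z ∸ q ^ dim U) * above d (add U x)) (sym dim-⊤) ⟩
        (q ^ dim ⊤ˢ ∸ q ^ dim U) * above d (add U x)               ≡⟨ sym (E-step ⊆-refl ⊆-⊤ (∈-⊤ x) x∉) ⟩
        above d U * (q ^ d ∸ q ^ dim U)                            ∎)
    where
    open ≤-Reasoning
    gap : q ^ (n ∸ d) * (q ^ d ∸ q ^ dim U) ≤ q ^ n ∸ q ^ dim U
    gap = begin
      q ^ (n ∸ d) * (q ^ d ∸ q ^ dim U)                ≡⟨ *-distribˡ-∸ (q ^ (n ∸ d)) _ _ ⟩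
      q ^ (n ∸ d) * q ^ d ∸ q ^ (n ∸ d) * q ^ dim U    ≡⟨ cong (_∸ q ^ (n ∸ d) * q ^ dim U) (trans (sym (^-distribˡ-+-* q (n ∸ d) d)) (cong (q ^_) (m∸n+n≡m d≤n))) ⟩
      q ^ n ∸ q ^ (n ∸ d) * q ^ dim U                  ≤⟨ ∸-monoʳ-≤ (q ^ n) (m≤n*m (q ^ dim U) (q ^ (n ∸ d)) {{>-nonZero (1≤^ (n ∸ d) 1≤q)}}) ⟩
      q ^ n ∸ q ^ dim U                                ∎

-- The extremal families

module Model (G : Geometry) (k s : ℕ) (2≤s : 2 ≤ s) (s<k : s < k) (big : 4 * k + 6 ≤ Geometry.n G) where
  open Counting G public

  private variable
    U W X Y Z M S B T U′ W′ M′ M₁ M₂ M₁′ M₂′ T′ Z′ : Sp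
    x y : Fin Q
    d : ℕ

  through : {P : Fin (num d) → Set} → Decidable P → Sp → ℕ
  through {d} P? S = # (λ i → P? i ×-dec (S ⊆? sub d i))

  -- Each member of P through S contains a vector of B ∖ S; indeed it contains
  -- at least q ^ s ∸ q ^ dim (S ∩ B) of them.
  branch : {P : Fin (num d) → Set} (P? : Decidable P) (c : ℕ) →
    dim (S ∩ B) < s → s ≤ dim B →
    (∀ i → P i → S ⊆ sub d i → s ≤ dim (sub d i ∩ B)) →
    (∀ x → x ∈ B → ¬ (x ∈ S) → through P? (add S x) ≤ c) →
    through P? S ≤ θ q (dim B + 1 ∸ s) * c
  branch {d} {S} {B} {P} P? c e<s s≤b meets bound = *-cancelʳ-≤ _ _ a {{>-nonZero (m<n⇒0<n∸m (q^-strict e<s))}} (begin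
      through P? S * a                         ≤⟨ double-count-≤ (λ i → P? i ×-dec (S ⊆? sub d i)) Q? R? a c row col (λ i x _ → proj₂) ⟩
      # Q? * c                                 ≡⟨ cong (_* c) (#-∖ S B) ⟩
      (q ^ dim B ∸ q ^ dim (S ∩ B)) * c        ≤⟨ *-monoˡ-≤ c (arith q refl) ⟩
      θ q (dim B + 1 ∸ s) * a * c              ≡⟨ lem (θ q (dim B + 1 ∸ s)) a c ⟩
      θ q (dim B + 1 ∸ s) * c * a              ∎)
    where
    open ≤-Reasoning
    lem : ∀ t a c → t * a * c ≡ t * c * a
    lem = solve-∀
    a = q ^ s ∸ q ^ dim (S ∩ B)
    arith : ∀ q′ → q ≡ q′ → q ^ dim B ∸ q ^ dim (S ∩ B) ≤ θ q (dim B + 1 ∸ s) * a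
    arith zero eq = ⊥-elim (<⇒≱ 1≤q (≤-reflexive eq))
    arith (suc p) refl = ^∸^-≤ p e<s s≤b
    Q? = λ x → (x ∈? B) ×-dec ¬? (x ∈? S)
    R? = λ i x → (x ∈? sub d i) ×-dec ((x ∈? B) ×-dec ¬? (x ∈? S))
    row : ∀ i → P i × S ⊆ sub d i → a ≤ # (R? i)
    row i (p , S⊆F) = begin
      q ^ s ∸ q ^ dim (S ∩ B)                          ≤⟨ ∸-monoˡ-≤ (q ^ dim (S ∩ B)) (q^-mono (meets i p S⊆F)) ⟩
      q ^ dim (sub d i ∩ B) ∸ q ^ dim (S ∩ B)          ≤⟨ ∸-monoʳ-≤ (q ^ dim (sub d i ∩ B)) (q^-mono (dim-mono
                                                            (∩-mono {S} {S} {sub d i ∩ B} {B} ⊆-refl (∩-⊆ʳ (sub d i) B)))) ⟩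
      q ^ dim (sub d i ∩ B) ∸ q ^ dim (S ∩ (sub d i ∩ B)) ≡⟨ sym (#-∖ S (sub d i ∩ B)) ⟩
      # (λ x → (x ∈? (sub d i ∩ B)) ×-dec ¬? (x ∈? S)) ≤⟨ #-mono _ (R? i) (λ x p → ∩-⊆ˡ (sub d i) B x (proj₁ p)
                                                            , ∩-⊆ʳ (sub d i) B x (proj₁ p) , proj₂ p) ⟩
      # (R? i)                                         ∎
    col : ∀ x → x ∈ B × ¬ (x ∈ S) → # (λ i → (P? i ×-dec (S ⊆? sub d i)) ×-dec R? i x) ≤ c
    col x (x∈B , x∉S) = ≤-trans (#-mono _ (λ i → P? i ×-dec (add S x ⊆? sub d i))
      λ i p → proj₁ (proj₁ p) , add-least (proj₂ (proj₁ p)) (proj₁ (proj₂ p))) (bound x x∈B x∉S)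

  through-full : {P : Fin (num d) → Set} (P? : Decidable P) → d ≤ dim S → through P? S ≤ 1
  through-full {d} {S} P? le = #-≤1 _ λ i j pi pj → sub-inj (⊆-trans (⊆-of-dim (proj₂ pi)
    (≤-trans (≤-reflexive (dim-sub i)) le)) (proj₂ pj))

  through≤above : {P : Fin (num d) → Set} (P? : Decidable P) → through P? S ≤ above d S
  through≤above {d} {S} P? = #-mono _ (between? d S S ⊤ˢ) λ i p → proj₂ p , ∩-⊆ʳ (sub d i) S , ⊆-⊤

  abstract
    k≤n : k ≤ n
    k≤n = ≤-trans (≤-trans (m≤m+n k (3 * k)) (m≤m+n (4 * k) 6)) big

  -- Reference spaces, one for each dimension up to n; they turn counts that depend on dimension
  -- alone into the numerical function `N`.
  std : ℕ → Sp
  std zero = ⊥ˢ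
  std (suc d) with ⊤ˢ ⊆? std d
  ... | yes _ = std d
  ... | no h  = add (std d) (proj₁ (⊈-witness h))

  dim-std : d ≤ n → dim (std d) ≡ d
  dim-std {zero}  _  = dim-⊥
  dim-std {suc d} le with ⊤ˢ ⊆? std d
  ... | yes h = ⊥-elim (<⇒≱ le (≤-trans (≤-reflexive (sym dim-⊤)) (≤-trans (dim-mono h) (≤-reflexive (dim-std (<⇒≤ le))))))
  ... | no h  = trans (dim-add (proj₂ (proj₂ (⊈-witness h)))) (cong suc (dim-std (<⇒≤ le)))

  N : ℕ → ℕ
  N d = above k (std d)

  above-N : dim U ≡ d → above k U ≡ N d
  above-N {U} refl = above-dims (sym (dim-std dim-≤n))

  N-ratio : suc d ≤ n → N (suc d) * q ^ (n ∸ k) ≤ N d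
  N-ratio {d} le with ⊈-witness {⊤ˢ} {std d} (dim<⇒⊈ (≤-trans (s≤s (≤-reflexive (dim-std (<⇒≤ le)))) (≤-trans le (≤-reflexive (sym dim-⊤)))))
  ... | x , _ , x∉ = ≤-trans (≤-reflexive (cong (_* q ^ (n ∸ k)) (sym (above-N (trans (dim-add x∉) (cong suc (dim-std (<⇒≤ le))))))))
                             (above-add x∉ k≤n)

  N-pos : d ≤ k → 1 ≤ N d
  N-pos {d} le with interpolate k (⊆-⊤ {std d}) (≤-trans (≤-reflexive (dim-std (≤-trans le k≤n))) le) (≤-trans k≤n (≤-reflexive (sym dim-⊤)))
  ... | X , f , _ , eq with sub-index X eq
  ... | i , a , b = #-pos (between? k (std d) (std d) ⊤ˢ) i (⊆-trans f a , ∩-⊆ʳ (sub k i) (std d) , ⊆-⊤)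

  -- A space through `U` that meets `M` in more than `U` contains `add U x` for some `x` in `M`; a
  -- union bound over the vectors of `M` takes care of these.
  above≤E+ : U ⊆ M → dim U ≡ d → above k U ≤ E k U M ⊤ˢ + q ^ dim M * N (suc d)
  above≤E+ {U} {M} {d} U⊆M eq = begin
      above k U                       ≤⟨ #-∪ (between? k U U ⊤ˢ) (between? k U M ⊤ˢ) bad? split ⟩
      E k U M ⊤ˢ + # bad?             ≡⟨ cong (E k U M ⊤ˢ +_) (sym (*-identityʳ (# bad?))) ⟩
      E k U M ⊤ˢ + # bad? * 1         ≤⟨ +-monoʳ-≤ (E k U M ⊤ˢ) (double-count-≤ bad? (_∈? M) R? 1 (N (suc d)) row col
                                            (λ i x _ r → proj₁ (proj₂ r))) ⟩
      E k U M ⊤ˢ + # (_∈? M) * N (suc d) ≡⟨ cong (λ z → E k U M ⊤ˢ + z * N (suc d)) (card M) ⟩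
      E k U M ⊤ˢ + q ^ dim M * N (suc d) ∎
    where
    open ≤-Reasoning
    bad? = λ i → (U ⊆? sub k i) ×-dec ¬? ((sub k i ∩ M) ⊆? U)
    R? = λ i x → (x ∈? sub k i) ×-dec ((x ∈? M) ×-dec ¬? (x ∈? U))
    split : ∀ i → Between k U U ⊤ˢ i → Between k U M ⊤ˢ i ⊎ (U ⊆ sub k i × ¬ (sub k i ∩ M ⊆ U))
    split i (a , _ , c) with (sub k i ∩ M) ⊆? U
    ... | yes h = inj₁ (a , h , c)
    ... | no h  = inj₂ (a , h)
    row : ∀ i → U ⊆ sub k i × ¬ (sub k i ∩ M ⊆ U) → 1 ≤ # (R? i)
    row i (_ , h) with ⊈-witness h
    ... | x , x∈ , x∉ = #-pos (R? i) x (∩-⊆ˡ (sub k i) M x x∈ , ∩-⊆ʳ (sub k i) M x x∈ , x∉)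
    col : ∀ x → x ∈ M → # (λ i → bad? i ×-dec R? i x) ≤ N (suc d)
    col x x∈M = col′ (x ∈? U)
      where
      col′ : Dec (x ∈ U) → # (λ i → bad? i ×-dec R? i x) ≤ N (suc d)
      col′ (yes x∈U) = ≤-trans (≤-reflexive (#-none (λ i → bad? i ×-dec R? i x) (λ i p → proj₂ (proj₂ (proj₂ p)) x∈U))) z≤n
      col′ (no x∉U) = ≤-trans (#-mono (λ i → bad? i ×-dec R? i x) (between? k (add U x) (add U x) ⊤ˢ)
           (λ i p → add-least (proj₁ (proj₁ p)) (proj₁ (proj₂ p)) , ∩-⊆ʳ (sub k i) (add U x) , ⊆-⊤))
           (≤-reflexive (above-N (trans (dim-add x∉U) (cong suc eq))))

  Ball : Sp → Fin (num k) → Set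
  Ball Z i = suc s ≤ dim (sub k i ∩ Z)

  ball? : ∀ Z → Decidable (Ball Z)
  ball? Z i = suc s ≤? dim (sub k i ∩ Z)

  Star : Sp → Sp → Fin (num k) → Set
  Star T M i = T ⊆ sub k i × suc s ≤ dim (sub k i ∩ M)

  star? : ∀ T M → Decidable (Star T M)
  star? T M i = (T ⊆? sub k i) ×-dec (suc s ≤? dim (sub k i ∩ M))

  Rest : Sp → Sp → Fin (num k) → Set
  Rest T M i = sub k i ⊆ M × ¬ (T ⊆ sub k i)

  rest? : ∀ T M → Decidable (Rest T M)
  rest? T M i = (sub k i ⊆? M) ×-dec ¬? (T ⊆? sub k i)

  -- HM T M M and Ball Z are the families of (i) and (ii).  Distinct M₁, M₂ occur
  -- in extremal pairs of families.
  HM : Sp → Sp → Sp → Fin (num k) → Set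
  HM T M₁ M₂ i = Star T M₁ i ⊎ Rest T M₂ i

  hm? : ∀ T M₁ M₂ → Decidable (HM T M₁ M₂)
  hm? T M₁ M₂ i = star? T M₁ i ⊎-dec rest? T M₂ i

  star-size : T ⊆ M → dim T ≡ s → # (star? T M) + E k T M ⊤ˢ ≡ above k T
  star-size {T} {M} T⊆M eq = sym (#-⊎ (between? k T T ⊤ˢ) (star? T M) (between? k T M ⊤ˢ) split
      (λ i p → proj₁ p , ∩-⊆ʳ (sub k i) T , ⊆-⊤)
      (λ i p → proj₁ p , ∩-⊆ʳ (sub k i) T , ⊆-⊤)
      λ i p r → <⇒≱ (proj₂ p) (≤-trans (dim-mono (proj₁ (proj₂ r))) (≤-reflexive eq)))
    where
    split : ∀ i → Between k T T ⊤ˢ i → Star T M i ⊎ Between k T M ⊤ˢ i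
    split i (a , _ , c) with suc s ≤? dim (sub k i ∩ M)
    ... | yes h = inj₁ (a , h)
    ... | no h  = inj₂ (a , ⊆-of-dim (∩-least a T⊆M) (≤-trans (s≤s⁻¹ (≰⇒> h)) (≤-reflexive (sym eq))) , c)

  rest-size : T ⊆ M → # (rest? T M) + interval k T M ≡ interval k ⊥ˢ M
  rest-size {T} {M} T⊆M = sym (#-⊎ (between? k ⊥ˢ ⊥ˢ M) (rest? T M) (between? k T T M) split
      (λ i p → ⊥-⊆ , ∩-⊆ʳ (sub k i) ⊥ˢ , proj₁ p)
      (λ i p → ⊥-⊆ , ∩-⊆ʳ (sub k i) ⊥ˢ , proj₂ (proj₂ p))
      λ i p r → proj₂ p (proj₁ r))
    where
    split : ∀ i → Between k ⊥ˢ ⊥ˢ M i → Rest T M i ⊎ Between k T T M i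
    split i (_ , _ , c) with T ⊆? sub k i
    ... | yes h = inj₂ (h , ∩-⊆ʳ (sub k i) T , c)
    ... | no h  = inj₁ (c , h)

  hm-size : # (hm? T M₁ M₂) ≡ # (star? T M₁) + # (rest? T M₂)
  hm-size {T} {M₁} {M₂} = #-⊎ (hm? T M₁ M₂) (star? T M₁) (rest? T M₂) (λ i → id) (λ i → inj₁) (λ i → inj₂)
    λ i p r → proj₂ r (proj₁ p)

  -- No closed formula is involved: the star and the rest are complements within counts that, by
  -- `E-dims`, depend on dimensions alone, and the counts removed do so too.
  hm-size-dims : T ⊆ M₁ → T ⊆ M₂ → T′ ⊆ M₁′ → T′ ⊆ M₂′ → dim T ≡ s → dim T′ ≡ s →
    dim M₁ ≡ dim M₁′ → dim M₂ ≡ dim M₂′ → # (hm? T M₁ M₂) ≡ # (hm? T′ M₁′ M₂′)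
  hm-size-dims {T} {M₁} {M₂} {T′} {M₁′} {M₂′} f g f′ g′ eT eT′ e₁ e₂ = trans (hm-size {T} {M₁} {M₂}) (trans (cong₂ _+_
      (+-cancelʳ-≡ (E k T M₁ ⊤ˢ) _ _ (begin
        # (star? T M₁) + E k T M₁ ⊤ˢ        ≡⟨ star-size f eT ⟩
        above k T                           ≡⟨ above-dims (trans eT (sym eT′)) ⟩
        above k T′                          ≡⟨ sym (star-size f′ eT′) ⟩
        # (star? T′ M₁′) + E k T′ M₁′ ⊤ˢ    ≡⟨ cong (# (star? T′ M₁′) +_) (E-dims f′ ⊆-⊤ f ⊆-⊤ (trans eT (sym eT′)) e₁ refl) ⟩
        # (star? T′ M₁′) + E k T M₁ ⊤ˢ      ∎))
      (+-cancelʳ-≡ (interval k T M₂) _ _ (begin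
        # (rest? T M₂) + interval k T M₂     ≡⟨ rest-size g ⟩
        interval k ⊥ˢ M₂                     ≡⟨ E-dims ⊆-refl ⊥-⊆ ⊆-refl ⊥-⊆ refl refl (sym e₂) ⟩
        interval k ⊥ˢ M₂′                    ≡⟨ sym (rest-size g′) ⟩
        # (rest? T′ M₂′) + interval k T′ M₂′ ≡⟨ cong (# (rest? T′ M₂′) +_) (E-dims ⊆-refl g′ ⊆-refl g (trans eT (sym eT′)) (trans eT (sym eT′)) e₂) ⟩
        # (rest? T′ M₂′) + interval k T M₂   ∎)))
      (sym (hm-size {T′} {M₁′} {M₂′})))
    where open ≡-Reasoning

  -- A space determines its intersection with `W`, so the slices belonging to different d-spaces
  -- between `U` and `W` are disjoint.
  slices : {P : Fin (num k) → Set} (P? : Decidable P) (c : ℕ) →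
    (∀ i j → U ⊆ sub d j → sub d j ⊆ W → Between k (sub d j) W ⊤ˢ i → P i) →
    (∀ j → U ⊆ sub d j → sub d j ⊆ W → c ≤ E k (sub d j) W ⊤ˢ) →
    interval d U W * c ≤ # P?
  slices {U} {d} {W} P? c mem low = ≤-trans
      (double-count-≤ (between? d U U W) P? R? c 1
         (λ j p → ≤-trans (low j (proj₁ p) (proj₂ (proj₂ p))) (#-mono (between? k (sub d j) W ⊤ˢ) (R? j) (λ _ → id)))
         (λ i _ → #-≤1 _ λ a b pa pb → sub-inj (λ x x∈ →
             proj₁ (proj₂ (proj₂ pb)) x (∩-intro x (proj₁ (proj₂ pa) x x∈) (proj₂ (proj₂ (proj₁ pa)) x x∈))))
         λ j i p r → mem i j (proj₁ p) (proj₂ (proj₂ p)) r)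
      (≤-reflexive (*-identityʳ (# P?)))
    where
    R? = λ j i → between? k (sub d j) W ⊤ˢ i

  abstract
    N-tail : suc d ≤ n → N (suc d) * q ^ (3 * k + 6) ≤ N d
    N-tail {d} le = ≤-trans (*-monoʳ-≤ (N (suc d)) (q^-mono (m+n≤o⇒m≤o∸n (3 * k + 6) (≤-trans (≤-reflexive (lem k)) big)))) (N-ratio le)
      where
      lem : ∀ k → 3 * k + 6 + k ≡ 4 * k + 6
      lem = solve-∀

  abstract
    2+s≤n : 2 + s ≤ n
    2+s≤n = ≤-trans (s≤s s<k) (≤-trans (≤-trans (≤-trans (≤-reflexive (+-comm 1 k)) (+-monoʳ-≤ k {1} {6} (s≤s z≤n)))
              (+-monoˡ-≤ 6 (m≤m+n k (3 * k)))) big)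

  -- The error terms below are at most N (suc s) / K.
  K : ℕ
  K = q ^ (k + 4)

  abstract
    -- The exponents 2(k + 1) and k + 4 add up to 3k + 6, the lower bound on n - k that 4k + 6 ≤ n
    -- provides.
    K-tail : q ^ suc k * q ^ suc k * K * N (2 + s) ≤ N (1 + s)
    K-tail = ≤-trans (≤-reflexive (trans (cong (_* N (2 + s)) powers) (*-comm _ (N (2 + s))))) (N-tail 2+s≤n)
      where
      lem : ∀ k → suc k + suc k + (k + 4) ≡ 3 * k + 6
      lem = solve-∀
      powers : q ^ suc k * q ^ suc k * K ≡ q ^ (3 * k + 6)
      powers = trans (cong (_* K) (sym (^-distribˡ-+-* q (suc k) (suc k))))
        (trans (sym (^-distribˡ-+-* q (suc k + suc k) (k + 4))) (cong (q ^_) (lem k)))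

  -- Each of the μ slices misses at most `q ^ suc k * N (2 + s)` of the `N (suc s)` spaces through
  -- its (s+1)-space, and by `K-tail` all losses together do not exceed `N (suc s)` / `K`.
  slices-lower : {P : Fin (num k) → Set} (P? : Decidable P) (μ : ℕ) →
    interval (suc s) U W ≡ μ → μ ≤ q ^ suc k → dim W ≤ suc k →
    (∀ i j → U ⊆ sub (suc s) j → sub (suc s) j ⊆ W → Between k (sub (suc s) j) W ⊤ˢ i → P i) →
    μ * K * N (suc s) ≤ # P? * K + N (suc s)
  slices-lower {U} {W} P? μ size μ≤ dW mem = begin
      μ * K * N (suc s)                            ≤⟨ *-monoʳ-≤ (μ * K) (m≤n+m∸n (N (suc s)) t) ⟩
      μ * K * (t + c)                              ≡⟨ lem₁ μ K (q ^ suc k) (N (2 + s)) c ⟩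
      μ * c * K + μ * q ^ suc k * K * N (2 + s)    ≤⟨ +-mono-≤ (*-monoˡ-≤ K (≤-trans (≤-reflexive (cong (_* c) (sym size)))
                                                        (slices P? c mem low)))
                                                       (≤-trans (*-monoˡ-≤ (N (2 + s)) (*-monoˡ-≤ K (*-monoˡ-≤ (q ^ suc k) μ≤))) K-tail) ⟩
      # P? * K + N (suc s)                         ∎
    where
    open ≤-Reasoning
    t = q ^ suc k * N (2 + s)
    c = N (suc s) ∸ t
    lem₁ : ∀ μ K b m c → μ * K * (b * m + c) ≡ μ * c * K + μ * b * K * m
    lem₁ = solve-∀
    low : ∀ j → U ⊆ sub (suc s) j → sub (suc s) j ⊆ W → c ≤ E k (sub (suc s) j) W ⊤ˢ
    low j _ X⊆W = m≤n+o⇒m∸n≤o (N (suc s)) t (begin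
      N (suc s)                                              ≡⟨ sym (above-N (dim-sub j)) ⟩
      above k (sub (suc s) j)                                ≤⟨ above≤E+ X⊆W (dim-sub j) ⟩
      E k (sub (suc s) j) W ⊤ˢ + q ^ dim W * N (2 + s)       ≤⟨ +-monoʳ-≤ _ (*-monoˡ-≤ (N (2 + s)) (q^-mono dW)) ⟩
      E k (sub (suc s) j) W ⊤ˢ + t                           ≡⟨ +-comm _ t ⟩
      t + E k (sub (suc s) j) W ⊤ˢ                           ∎)

  -- The numbers of hyperplanes of an (s+2)-space and of members of the pencil
  -- of an s-space in a (k+1)-space: the leading coefficients, relative to
  -- N (suc s), of the sizes of Ball Z and HM T M M.
  g h : ℕ
  g = θ q (2 + s)
  h = θ q (k + 1 ∸ s)

  g≤ : g ≤ q ^ suc k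
  g≤ = ≤-trans (<⇒≤ (θ<^ 2≤q (2 + s))) (q^-mono (s≤s s<k))

  h≤ : h ≤ q ^ suc k
  h≤ = ≤-trans (<⇒≤ (θ<^ 2≤q (k + 1 ∸ s))) (q^-mono (≤-trans (m∸n≤m (k + 1) s) (≤-reflexive (+-comm k 1))))

  interval-ball : dim Z ≡ 2 + s → interval (suc s) ⊥ˢ Z ≡ g
  interval-ball eq = hyperplanes-size (suc s) ⊥-⊆ (cong (_+ suc s) dim-⊥) eq

  between-dim : ∀ {i j} → Between k (sub d j) W ⊤ˢ i → sub d j ⊆ W → d ≤ dim (sub k i ∩ W)
  between-dim {j = j} p f = ≤-trans (≤-reflexive (sym (dim-sub j))) (dim-mono (∩-least (proj₁ p) f))

  ball-lower : dim Z ≡ 2 + s → g * K * N (suc s) ≤ # (ball? Z) * K + N (suc s)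
  ball-lower {Z} eq = slices-lower (ball? Z) g (interval-ball eq) g≤ (≤-trans (≤-reflexive eq) (s≤s s<k))
    λ i j _ f p → between-dim p f

  hm-lower : T ⊆ M₁ → dim T ≡ s → dim M₁ ≡ suc k → h * K * N (suc s) ≤ # (hm? T M₁ M₂) * K + N (suc s)
  hm-lower {T} {M₁} {M₂} f eT eM = slices-lower (hm? T M₁ M₂) h
    (trans (pencil-size f eT) (cong (λ z → θ q (z ∸ s)) (trans eM (+-comm 1 k)))) h≤ (≤-reflexive eM)
    λ i j a b p → inj₁ (⊆-trans a (proj₁ p) , between-dim p b)

  -- Summing `N (suc s)` over the `g` hyperplanes of `Z` counts a space that meets `Z` in a
  -- hyperplane once and a space containing `Z` g times. The exact value is what the tie in
  -- `hm<ball` requires.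
  ball-size : dim Z ≡ 2 + s → # (ball? Z) + g * N (2 + s) ≡ g * N (suc s) + N (2 + s)
  ball-size {Z} eq = begin
      # (ball? Z) + g * N (2 + s)                          ≡⟨ cong (_+ g * N (2 + s)) (#-split (ball? Z) (λ i → Z ⊆? sub k i)) ⟩
      # full? + # thin? + g * N (2 + s)                    ≡⟨ cong₂ (λ a b → a + b + g * N (2 + s)) full-size (trans (sym (*-identityʳ (# thin?))) (≤-antisym up down)) ⟩
      N (2 + s) + #Q * e + g * N (2 + s)                   ≡⟨ cong (λ z → N (2 + s) + z * e + g * N (2 + s)) (interval-ball eq) ⟩
      N (2 + s) + g * e + g * N (2 + s)                    ≡⟨ lem (N (2 + s)) g e ⟩
      g * (e + N (2 + s)) + N (2 + s)                      ≡⟨ cong (λ z → g * z + N (2 + s)) slice ⟩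
      g * N (suc s) + N (2 + s)                            ∎
    where
    open ≡-Reasoning
    lem : ∀ n g e → n + g * e + g * n ≡ g * (e + n) + n
    lem = solve-∀
    hyp = interpolate {⊥ˢ} {Z} (suc s) ⊥-⊆ (≤-trans (≤-reflexive dim-⊥) z≤n) (≤-trans (n≤1+n _) (≤-reflexive (sym eq)))
    X₀ = proj₁ hyp
    X₀⊆Z : X₀ ⊆ Z
    X₀⊆Z = proj₁ (proj₂ (proj₂ hyp))
    dX : dim X₀ ≡ suc s
    dX = proj₂ (proj₂ (proj₂ hyp))
    e = E k X₀ Z ⊤ˢ
    #Q = interval (suc s) ⊥ˢ Z
    full? = λ i → ball? Z i ×-dec (Z ⊆? sub k i)
    thin? = λ i → ball? Z i ×-dec ¬? (Z ⊆? sub k i)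
    full-size : # full? ≡ N (2 + s)
    full-size = trans (#-cong full? (between? k Z Z ⊤ˢ) (λ i p → proj₂ p , ∩-⊆ʳ (sub k i) Z , ⊆-⊤)
       (λ i p → ≤-trans (n≤1+n _) (≤-trans (≤-reflexive (sym eq)) (dim-mono (∩-least (proj₁ p) ⊆-refl))) , proj₁ p)) (above-N eq)
    slice : e + N (2 + s) ≡ N (suc s)
    slice = trans (cong (e +_) (sym (above-N eq))) (trans (sym (#-⊎ (between? k X₀ X₀ ⊤ˢ) (between? k X₀ Z ⊤ˢ) (between? k Z Z ⊤ˢ) split
        (λ i p → proj₁ p , ∩-⊆ʳ (sub k i) X₀ , ⊆-⊤)
        (λ i p → ⊆-trans X₀⊆Z (proj₁ p) , ∩-⊆ʳ (sub k i) X₀ , ⊆-⊤)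
        λ i p r → <⇒≱ (≤-reflexive (trans (cong suc dX) (sym eq))) (dim-mono (⊆-trans (∩-least (proj₁ r) ⊆-refl) (proj₁ (proj₂ p))))))
      (above-N dX))
      where
      split : ∀ i → Between k X₀ X₀ ⊤ˢ i → Between k X₀ Z ⊤ˢ i ⊎ Between k Z Z ⊤ˢ i
      split i (a , _ , c) with (sub k i ∩ Z) ⊆? X₀
      ... | yes f = inj₁ (a , f , c)
      ... | no nf = inj₂ (⊆-trans (⊆-of-dim (∩-⊆ʳ (sub k i) Z) (≤-trans (≤-reflexive (trans eq (cong suc (sym dX))))
                (dim-strict (∩-least a X₀⊆Z) nf))) (∩-⊆ˡ (sub k i) Z) , ∩-⊆ʳ (sub k i) Z , c)
    R? = λ i j → between? k (sub (suc s) j) Z ⊤ˢ i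
    Q? = between? (suc s) ⊥ˢ ⊥ˢ Z
    e-same : ∀ j → sub (suc s) j ⊆ Z → E k (sub (suc s) j) Z ⊤ˢ ≡ e
    e-same j f = E-dims f ⊆-⊤ X₀⊆Z ⊆-⊤ (trans dX (sym (dim-sub j))) refl refl
    thin-dim : ∀ i → Ball Z i × ¬ (Z ⊆ sub k i) → dim (sub k i ∩ Z) ≡ suc s
    thin-dim i (b , Z⊈) = ≤-antisym (s≤s⁻¹ (≤-trans (dim-strict (∩-⊆ʳ (sub k i) Z) (λ f → Z⊈ (⊆-trans f (∩-⊆ˡ (sub k i) Z)))) (≤-reflexive eq))) b
    up : # thin? * 1 ≤ #Q * e
    up = double-count-≤ thin? Q? (λ i j → R? i j ×-dec (sub (suc s) j ⊆? Z)) 1 e row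
         (λ j p → ≤-trans (#-mono _ (between? k (sub (suc s) j) Z ⊤ˢ) (λ i → proj₁ ∘ proj₂)) (≤-reflexive (e-same j (proj₂ (proj₂ p)))))
         (λ i j _ r → ⊥-⊆ , ∩-⊆ʳ (sub (suc s) j) ⊥ˢ , proj₂ r)
      where
      row : ∀ i → Ball Z i × ¬ (Z ⊆ sub k i) → 1 ≤ # (λ j → R? i j ×-dec (sub (suc s) j ⊆? Z))
      row i p with sub-index (sub k i ∩ Z) (thin-dim i p)
      ... | j , a , b = #-pos (λ j → R? i j ×-dec (sub (suc s) j ⊆? Z)) j
            ((⊆-trans b (∩-⊆ˡ (sub k i) Z) , a , ⊆-⊤) , ⊆-trans b (∩-⊆ʳ (sub k i) Z))
    down : #Q * e ≤ # thin? * 1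
    down = ≤-trans (slices (thin?) e mem (λ j _ f → ≤-reflexive (sym (e-same j f)))) (≤-reflexive (sym (*-identityʳ (# thin?))))
      where
      mem : ∀ i j → ⊥ˢ ⊆ sub (suc s) j → sub (suc s) j ⊆ Z → Between k (sub (suc s) j) Z ⊤ˢ i → Ball Z i × ¬ (Z ⊆ sub k i)
      mem i j _ f p = between-dim p f , λ Z⊆F → <⇒≱ (≤-reflexive (trans (cong suc (dim-sub j)) (sym eq)))
        (dim-mono (⊆-trans (∩-least Z⊆F ⊆-refl) (proj₁ (proj₂ p))))

  abstract
    -- Lets an intersection condition on k-spaces descend to the small spaces they contain: a
    -- k-space through `U` in general position meets `W` no more than `U` does.
    generic : dim U ≤ k → dim W + k ≤ n → ∃ λ i → U ⊆ sub k i × sub k i ∩ W ⊆ U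
    generic {U} {W} le le′ with extend-avoiding {U} {⊤ˢ} {W} (k ∸ dim U) ⊆-⊤ (begin
        dim (U ∨ W) + (k ∸ dim U)                  ≤⟨ +-monoˡ-≤ _ (≤-trans (m≤n+m _ (dim (U ∩ W))) (≤-reflexive (modular U W))) ⟩
        dim U + dim W + (k ∸ dim U)                ≡⟨ trans (cong (_+ (k ∸ dim U)) (+-comm (dim U) (dim W))) (+-assoc (dim W) _ _) ⟩
        dim W + (dim U + (k ∸ dim U))              ≡⟨ cong (dim W +_) (m+[n∸m]≡n le) ⟩
        dim W + k                                  ≤⟨ le′ ⟩
        n                                          ≡⟨ sym dim-⊤ ⟩
        dim ⊤ˢ                                     ∎)
      where open ≤-Reasoning
    ... | X , f , _ , dX , av with sub-index X (trans dX (m+[n∸m]≡n le))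
    ... | i , a , b = i , ⊆-trans f a , ⊆-trans (∩-mono b ⊆-refl) av

-- Bounds by branching

module Estimates (G : Geometry) (k s : ℕ) (2≤s : 2 ≤ s) (s<k : s < k) (big : 4 * k + 6 ≤ Geometry.n G) where
  open Model G k s 2≤s s<k big public

  private variable
    U W S C T Z : Sp
    d : ℕ
    P P₁ P₂ : Fin (num k) → Set

  Fam : Set₁
  Fam = Fin (num k) → Set

  Cross : Fam → Fam → Set
  Cross P₁ P₂ = ∀ i j → P₁ i → P₂ j → s ≤ dim (sub k i ∩ sub k j)

  -- The form in which the kernel condition is used: as t ≤ s, an s-space inside all members would
  -- violate it.
  Spread : Fam → Set
  Spread P = ∀ U → dim U ≡ s → ∃ λ i → P i × ¬ (U ⊆ sub k i)

  Cover : Fam → Sp → Set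
  Cover P C = ∀ i → P i → s ≤ dim (sub k i ∩ C)

  abstract
    cover? : Decidable P → ∀ C → Dec (Cover P C)
    cover? P? C = Fin.all? (λ i → P? i →-dec (s ≤? dim (sub k i ∩ C)))

  non-cover : Decidable P → ¬ Cover P C → ∃ λ i → P i × dim (sub k i ∩ C) < s
  non-cover {P} {C} P? h with Fin.any? (λ i → P? i ×-dec (suc (dim (sub k i ∩ C)) ≤? s))
  ... | yes w = w
  ... | no ¬w = ⊥-elim (h λ i p → ≮⇒≥ λ lt → ¬w (i , p , lt))

  -- A cover of dimension at most s would have dimension s and lie in every member, against
  -- `Spread`. That condition speaks of s-spaces, so `C` is first enlarged to one; the member it
  -- yields shows that nothing was added.
  Cover-dim : Spread P → Cover P C → suc s ≤ dim C
  Cover-dim {P} {C} nt cov with suc s ≤? dim C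
  ... | yes h = h
  ... | no ¬h = ⊥-elim absurd
    where
    C≤s : dim C ≤ s
    C≤s = s≤s⁻¹ (≰⇒> ¬h)
    std-s = interpolate {C} {⊤ˢ} s ⊆-⊤ C≤s (≤-trans (≤-trans (n≤1+n _) (<⇒≤ 2+s≤n)) (≤-reflexive (sym dim-⊤)))
    absurd : _
    absurd with nt (proj₁ std-s) (proj₂ (proj₂ (proj₂ std-s)))
    ... | i , p , h = h (⊆-trans (⊆-of-dim (proj₁ (proj₂ std-s)) (≤-trans (≤-reflexive (proj₂ (proj₂ (proj₂ std-s))))
              (≤-trans (cov i p) (dim-mono (∩-⊆ʳ (sub k i) C)))))
           (⊆-trans (⊆-of-dim (∩-⊆ʳ (sub k i) C) (≤-trans C≤s (cov i p))) (∩-⊆ˡ (sub k i) C)))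

  dim-∩-comm : ∀ X Y → dim (X ∩ Y) ≡ dim (Y ∩ X)
  dim-∩-comm X Y = ≤-antisym (dim-mono ∩-comm-⊆) (dim-mono ∩-comm-⊆)

  -- As long as dim S < s, the space `W` meets `S` in less than s dimensions and its vectors can be
  -- branched over; this works s times, starting from the zero space.
  branch-to-s : {P : Fin (num d) → Set} (P? : Decidable P) (c : ℕ) → s ≤ dim W →
    (∀ i → P i → s ≤ dim (sub d i ∩ W)) →
    (∀ S → dim S ≡ s → through P? S ≤ c) →
    # P? ≤ θ q (dim W + 1 ∸ s) ^ s * c
  branch-to-s {d} {W} P? c s≤W meets bound = ≤-trans
      (#-mono P? (λ i → P? i ×-dec (⊥ˢ ⊆? sub d i)) (λ i p → p , ⊥-⊆))
      (go s ⊥ˢ (cong (_+ s) dim-⊥))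
    where
    t = θ q (dim W + 1 ∸ s)
    go : ∀ j S → dim S + j ≡ s → through P? S ≤ t ^ j * c
    go zero S eq = ≤-trans (bound S (trans (sym (+-identityʳ _)) eq)) (≤-reflexive (sym (+-identityʳ c)))
    go (suc j) S eq = ≤-trans (branch P? (t ^ j * c)
        (≤-trans (s≤s (dim-mono (∩-⊆ˡ S W))) (≤-trans (m<m+n (dim S) (s≤s z≤n)) (≤-reflexive eq)))
        s≤W (λ i p _ → meets i p)
        (λ x _ x∉ → go j (add S x) (trans (cong (_+ j) (dim-add x∉)) (trans (sym (+-suc _ j)) eq))))
      (≤-reflexive (sym (*-assoc t (t ^ j) c)))

  -- A space that is no cover of `P₂` meets some member of `P₂` in less than s dimensions. Branching
  -- over that k-dimensional member costs the factor `h`.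
  branch-once : {P : Fin (num d) → Set} (P? : Decidable P) (c : ℕ) → Decidable P₂ →
    (∀ i → P i → Cover P₂ (sub d i)) → ¬ Cover P₂ S →
    (∀ x → ¬ (x ∈ S) → through P? (add S x) ≤ c) →
    through P? S ≤ h * c
  branch-once {d} {S = S} P? c P₂? cov ¬cov bound with non-cover P₂? ¬cov
  ... | j , pj , lt = ≤-trans (branch {S = S} {B = sub k j} P? c
          (≤-trans (s≤s (≤-reflexive (dim-∩-comm S (sub k j)))) lt)
          (≤-trans (<⇒≤ s<k) (≤-reflexive (sym (dim-sub j))))
          (λ i p _ → ≤-trans (cov i p j pj) (≤-reflexive (dim-∩-comm (sub k j) (sub d i)))) (λ x _ → bound x))
        (≤-reflexive (cong (λ z → θ q (z + 1 ∸ s) * c) (dim-sub j)))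

  -- Below the least dimension of a cover of `P₂` no space is a cover, so `branch-once` can be
  -- repeated, gaining one dimension for each factor `h`.
  branch-from-s : (P₁? : Decidable P₁) (P₂? : Decidable P₂) → Cross P₂ P₁ → ∀ j S →
    (∀ C → dim C < dim S + j → ¬ Cover P₂ C) → through P₁? S ≤ h ^ j * N (dim S + j)
  branch-from-s P₁? P₂? cr zero S none = ≤-trans (through≤above P₁?)
    (≤-reflexive (trans (above-N (sym (+-identityʳ _))) (sym (+-identityʳ _))))
  branch-from-s P₁? P₂? cr (suc j) S none = ≤-trans (branch-once P₁? (h ^ j * N (dim S + suc j)) P₂?
      (λ i p l q → cr l i q p) (none S (m<m+n (dim S) (s≤s z≤n)))
      (λ x x∉ → let e = trans (cong (_+ j) (dim-add x∉)) (sym (+-suc _ j)) in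
         ≤-trans (branch-from-s P₁? P₂? cr j (add S x) (λ C lt → none C (≤-trans lt (≤-reflexive e))))
                 (≤-reflexive (cong (λ z → h ^ j * N z) e))))
    (≤-reflexive (sym (*-assoc h (h ^ j) _)))

  m : ℕ
  m = k + 1 ∸ s

  m+s : m + s ≡ k + 1
  m+s = m∸n+n≡m (≤-trans (<⇒≤ s<k) (m≤m+n k 1))

  ^-pow-≤ : ∀ {a b} j → a ≤ q ^ b → a ^ j ≤ q ^ (b * j)
  ^-pow-≤ {a} {b} j le = ≤-trans (^-monoˡ-≤ j le) (≤-reflexive (^-*-assoc q b j))

  N-ratio* : ∀ j → d + j ≤ n → N (d + j) * q ^ ((n ∸ k) * j) ≤ N d
  N-ratio* {d} zero le = ≤-reflexive (trans (cong₂ (λ a b → N a * q ^ b) (+-identityʳ d) (*-zeroʳ (n ∸ k))) (*-identityʳ _))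
  N-ratio* {d} (suc j) le = begin
      N (d + suc j) * q ^ ((n ∸ k) * suc j)             ≡⟨ cong₂ (λ a b → N a * q ^ b) (+-suc d j) (*-suc (n ∸ k) j) ⟩
      N (suc d + j) * q ^ (n ∸ k + (n ∸ k) * j)         ≡⟨ cong (N (suc d + j) *_) (trans (^-distribˡ-+-* q (n ∸ k) _) (*-comm (q ^ (n ∸ k)) _)) ⟩
      N (suc d + j) * (q ^ ((n ∸ k) * j) * q ^ (n ∸ k)) ≡⟨ sym (*-assoc (N (suc d + j)) _ _) ⟩
      N (suc d + j) * q ^ ((n ∸ k) * j) * q ^ (n ∸ k)   ≤⟨ *-monoˡ-≤ (q ^ (n ∸ k)) (N-ratio* j le′) ⟩
      N (suc d) * q ^ (n ∸ k)                           ≤⟨ N-ratio (≤-trans (m≤m+n (suc d) j) le′) ⟩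
      N d                                               ∎
    where
    open ≤-Reasoning
    le′ : suc d + j ≤ n
    le′ = ≤-trans (≤-reflexive (sym (+-suc d j))) le

  -- In use, s + 1 + b₁ and s + 1 + b₂ are the least cover dimensions. The cover `W` of `P₁` leads
  -- to s-spaces, members of `P₂` lead on to dimension s + 1 + b₂, and there N has dropped below
  -- `N (suc s)` by the factor `q ^ ((n ∸ k) * b₂)`.
  size-by-covers : (P₁? : Decidable P₁) (P₂? : Decidable P₂) → Cross P₂ P₁ → ∀ b₁ b₂ →
    Cover P₁ W → dim W ≡ s + suc b₁ → (∀ C → dim C < s + suc b₂ → ¬ Cover P₂ C) → s + suc b₂ ≤ n →
    # P₁? * q ^ ((n ∸ k) * b₂) ≤ q ^ ((b₁ + 2) * s + m * suc b₂) * N (suc s)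
  size-by-covers {P₁} {P₂} {W} P₁? P₂? cr b₁ b₂ cov dW none le = begin
      # P₁? * Y                                            ≤⟨ *-monoˡ-≤ Y (branch-to-s P₁? (h ^ suc b₂ * N (s + suc b₂))
                                                               (≤-trans (m≤m+n s (suc b₁)) (≤-reflexive (sym dW))) cov
                                                               λ S dS → ≤-trans (branch-from-s P₁? P₂? cr (suc b₂) S
                                                                   (λ C lt → none C (≤-trans lt (≤-reflexive (cong (_+ suc b₂) dS)))))
                                                                 (≤-reflexive (cong (λ z → h ^ suc b₂ * N (z + suc b₂)) dS))) ⟩
      θ q (dim W + 1 ∸ s) ^ s * (h ^ suc b₂ * N (s + suc b₂)) * Y
                                                           ≤⟨ *-monoˡ-≤ Y (*-mono-≤ (^-pow-≤ {b = b₁ + 2} s t≤) (*-monoˡ-≤ (N (s + suc b₂)) (^-pow-≤ {b = m} (suc b₂) (<⇒≤ (θ<^ 2≤q m))))) ⟩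
      q ^ ((b₁ + 2) * s) * (q ^ (m * suc b₂) * N (s + suc b₂)) * Y ≡⟨ lem (q ^ ((b₁ + 2) * s)) (q ^ (m * suc b₂)) (N (s + suc b₂)) Y ⟩
      q ^ ((b₁ + 2) * s) * q ^ (m * suc b₂) * (N (s + suc b₂) * Y) ≡⟨ cong₂ (λ a b → a * (N b * Y)) (sym (^-distribˡ-+-* q ((b₁ + 2) * s) (m * suc b₂))) (+-suc s b₂) ⟩
      q ^ ((b₁ + 2) * s + m * suc b₂) * (N (suc s + b₂) * Y) ≤⟨ *-monoʳ-≤ (q ^ ((b₁ + 2) * s + m * suc b₂)) (N-ratio* b₂ (≤-trans (≤-reflexive (sym (+-suc s b₂))) le)) ⟩
      q ^ ((b₁ + 2) * s + m * suc b₂) * N (suc s)          ∎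
    where
    open ≤-Reasoning
    Y = q ^ ((n ∸ k) * b₂)
    lem : ∀ a b c y → a * (b * c) * y ≡ a * b * (c * y)
    lem = solve-∀
    t≤ : θ q (dim W + 1 ∸ s) ≤ q ^ (b₁ + 2)
    t≤ = ≤-trans (<⇒≤ (θ<^ 2≤q (dim W + 1 ∸ s))) (≤-reflexive (cong (q ^_)
      (trans (cong (λ z → z + 1 ∸ s) dW) (trans (cong (_∸ s) (lem′ s b₁)) (m+n∸m≡n s (b₁ + 2))))))
      where
      lem′ : ∀ s b → s + suc b + 1 ≡ s + (b + 2)
      lem′ = solve-∀

  -- Each unit of b₁ + b₂ gains a factor `q ^ (n ∸ k)` in the product, whereas all branching
  -- together costs q^(2s + (k+1)(b₁ + b₂ + 2)). Once b₁ + b₂ is positive the gain wins, with q^3 to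
  -- spare for strictness.
  product-by-covers : ∀ {x y} b₁ b₂ → 1 ≤ b₁ + b₂ →
    x * q ^ ((n ∸ k) * b₂) ≤ q ^ ((b₁ + 2) * s + m * suc b₂) * N (suc s) →
    y * q ^ ((n ∸ k) * b₁) ≤ q ^ ((b₂ + 2) * s + m * suc b₁) * N (suc s) →
    x * y * q ^ 3 ≤ q ^ (2 * s) * (N (suc s) * N (suc s))
  product-by-covers {x} {y} b₁ b₂ 1≤b hx hy = *-cancelʳ-≤ _ _ (q ^ F) {{>-nonZero (1≤^ F 1≤q)}} (begin
      x * y * q ^ 3 * q ^ F                                ≡⟨ trans (*-assoc (x * y) _ _) (cong (x * y *_) (sym (^-distribˡ-+-* q 3 F))) ⟩
      x * y * q ^ (3 + F)                                  ≤⟨ *-monoʳ-≤ (x * y) (q^-mono exponent) ⟩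
      x * y * q ^ ((n ∸ k) * b₂ + (n ∸ k) * b₁)            ≡⟨ cong (x * y *_) (^-distribˡ-+-* q ((n ∸ k) * b₂) _) ⟩
      x * y * (q ^ ((n ∸ k) * b₂) * q ^ ((n ∸ k) * b₁))    ≡⟨ lem₁ x y _ _ ⟩
      x * q ^ ((n ∸ k) * b₂) * (y * q ^ ((n ∸ k) * b₁))    ≤⟨ *-mono-≤ hx hy ⟩
      q ^ e₁ * N₁ * (q ^ e₂ * N₁)                          ≡⟨ lem₂ (q ^ e₁) N₁ (q ^ e₂) ⟩
      q ^ e₁ * q ^ e₂ * (N₁ * N₁)                          ≡⟨ cong (_* (N₁ * N₁)) (trans (sym (^-distribˡ-+-* q e₁ e₂)) (trans (cong (q ^_) total) (^-distribˡ-+-* q (2 * s) F))) ⟩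
      q ^ (2 * s) * q ^ F * (N₁ * N₁)                      ≡⟨ lem₃ (q ^ (2 * s)) (q ^ F) (N₁ * N₁) ⟩
      q ^ (2 * s) * (N₁ * N₁) * q ^ F                      ∎)
    where
    open ≤-Reasoning
    N₁ = N (suc s)
    b = b₁ + b₂
    F = (k + 1) * (b + 2)
    e₁ = (b₁ + 2) * s + m * suc b₂
    e₂ = (b₂ + 2) * s + m * suc b₁
    lem₁ : ∀ x y a b → x * y * (a * b) ≡ x * a * (y * b)
    lem₁ = solve-∀
    lem₂ : ∀ a n b → a * n * (b * n) ≡ a * b * (n * n)
    lem₂ = solve-∀
    lem₃ : ∀ a b n → a * b * n ≡ a * n * b
    lem₃ = solve-∀
    total : e₁ + e₂ ≡ 2 * s + F
    total = trans (lem₄ b₁ b₂ s m) (cong (λ z → 2 * s + z * (b + 2)) m+s)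
      where
      lem₄ : ∀ b c s m → ((b + 2) * s + m * suc c) + ((c + 2) * s + m * suc b) ≡ 2 * s + (m + s) * (b + c + 2)
      lem₄ = solve-∀
    -- For b = 1 the two ends of the estimate through 3k + 6 coincide: 3 + 3(k + 1) = 3k + 6.
    exponent : 3 + F ≤ (n ∸ k) * b₂ + (n ∸ k) * b₁
    exponent = begin
      3 + (k + 1) * (b + 2)                  ≡⟨ lem₅ k b ⟩
      (k + 1) * b + (2 * k + 5) * 1          ≤⟨ +-monoʳ-≤ ((k + 1) * b) (*-monoʳ-≤ (2 * k + 5) 1≤b) ⟩
      (k + 1) * b + (2 * k + 5) * b          ≡⟨ lem₆ k b ⟩
      (3 * k + 6) * b                        ≤⟨ *-monoˡ-≤ b (m+n≤o⇒m≤o∸n (3 * k + 6) (≤-trans (≤-reflexive (lem₇ k)) big)) ⟩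
      (n ∸ k) * b                            ≡⟨ trans (*-distribˡ-+ (n ∸ k) b₁ b₂) (+-comm ((n ∸ k) * b₁) _) ⟩
      (n ∸ k) * b₂ + (n ∸ k) * b₁            ∎
      where
      lem₅ : ∀ k b → 3 + (k + 1) * (b + 2) ≡ (k + 1) * b + (2 * k + 5) * 1
      lem₅ = solve-∀
      lem₆ : ∀ k b → (k + 1) * b + (2 * k + 5) * b ≡ (3 * k + 6) * b
      lem₆ = solve-∀
      lem₇ : ∀ k → 3 * k + 6 + k ≡ 4 * k + 6
      lem₇ = solve-∀

  -- L is the size to beat and μ its leading coefficient.
  module Threshold (μ L : ℕ) (g≤μ : g ≤ μ) (h≤μ : h ≤ μ) (μ≤ : μ ≤ q ^ suc k)
                   (lower : μ * K * N (suc s) ≤ L * K + N (suc s)) where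

    private
      N₁ = N (suc s)

      N₁>0 : 1 ≤ N₁
      N₁>0 = N-pos s<k

      K>0 : 1 ≤ K
      K>0 = 1≤^ (k + 4) 1≤q

      μ>q^s : suc (q ^ s) ≤ μ
      μ>q^s = begin
        1 + q ^ s                  ≤⟨ +-monoˡ-≤ (q ^ s) (1≤^ s 1≤q) ⟩
        q ^ s + q ^ s              ≡⟨ cong (q ^ s +_) (sym (+-identityʳ (q ^ s))) ⟩
        2 * q ^ s                  ≤⟨ *-monoˡ-≤ (q ^ s) 2≤q ⟩
        q ^ suc s                  ≤⟨ ^≤θ q (suc s) ⟩
        g                          ≤⟨ g≤μ ⟩
        μ                          ∎
        where open ≤-Reasoning

      q^s≤L : q ^ s * N₁ ≤ L
      q^s≤L = *-cancelʳ-≤ _ _ K {{>-nonZero K>0}} (+-cancelʳ-≤ N₁ _ _ (begin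
        q ^ s * N₁ * K + N₁        ≤⟨ +-monoʳ-≤ (q ^ s * N₁ * K) (m≤m*n N₁ K {{>-nonZero K>0}}) ⟩
        q ^ s * N₁ * K + N₁ * K    ≡⟨ lem (q ^ s) N₁ K ⟩
        suc (q ^ s) * K * N₁       ≤⟨ *-monoˡ-≤ N₁ (*-monoˡ-≤ K μ>q^s) ⟩
        μ * K * N₁                 ≤⟨ lower ⟩
        L * K + N₁                 ∎))
        where
        open ≤-Reasoning
        lem : ∀ a n K → a * n * K + n * K ≡ suc a * K * n
        lem = solve-∀

      L>0 : 1 ≤ L
      L>0 = ≤-trans (*-mono-≤ (1≤^ s 1≤q) N₁>0) q^s≤L

    no-cover-small : ∀ {x y} → x * y * q ^ 3 ≤ q ^ (2 * s) * (N₁ * N₁) → x * y < L * L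
    no-cover-small {x} {y} le with x * y in eq
    ... | zero  = *-mono-≤ L>0 L>0
    ... | suc z = begin-strict
        suc z                          <⟨ m<m*n (suc z) (q ^ 3) (1<q^ {3} (s≤s z≤n)) ⟩
        suc z * q ^ 3                  ≤⟨ le ⟩
        q ^ (2 * s) * (N₁ * N₁)        ≡⟨ cong (λ w → w * (N₁ * N₁)) (trans (cong (q ^_) (cong (s +_) (+-identityʳ s))) (^-distribˡ-+-* q s s)) ⟩
        q ^ s * q ^ s * (N₁ * N₁)      ≡⟨ lem (q ^ s) N₁ ⟩
        q ^ s * N₁ * (q ^ s * N₁)      ≤⟨ *-mono-≤ q^s≤L q^s≤L ⟩
        L * L                          ∎
      where
      open ≤-Reasoning
      lem : ∀ a n → a * a * (n * n) ≡ a * n * (a * n)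
      lem = solve-∀

    -- After scaling by K², (c₂K + 1)(c₁K + 1) has to stay below (μK - 1)². Integrality gives c₁c₂ ≤
    -- μ² - 1, a gap of K², and the linear terms (c₁ + c₂ + 2μ)K are smaller than that.
    few-covers-small : ∀ {x y c₁ c₂} → x * K ≤ (c₂ * K + 1) * N₁ → y * K ≤ (c₁ * K + 1) * N₁ →
      c₁ * c₂ < μ * μ → c₁ + c₂ + 2 * μ < K → x * y < L * L
    few-covers-small {x} {y} {c₁} {c₂} hx hy cc cs = *-cancelʳ-< (K * K) _ _ (begin-strict
        x * y * (K * K)                               ≡⟨ lem₁ x y K ⟩
        x * K * (y * K)                               ≤⟨ *-mono-≤ hx hy ⟩
        (c₂ * K + 1) * N₁ * ((c₁ * K + 1) * N₁)       ≡⟨ lem₂ c₁ c₂ K N₁ ⟩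
        (c₂ * K + 1) * (c₁ * K + 1) * (N₁ * N₁)       <⟨ *-monoˡ-< (N₁ * N₁) {{>-nonZero (*-mono-≤ N₁>0 N₁>0)}} core ⟩
        z * z * (N₁ * N₁)                             ≡⟨ lem₃ z N₁ ⟩
        z * N₁ * (z * N₁)                             ≤⟨ *-mono-≤ zN≤ zN≤ ⟩
        L * K * (L * K)                               ≡⟨ lem₄ L K ⟩
        L * L * (K * K)                               ∎)
      where
      open ≤-Reasoning
      z = μ * K ∸ 1
      μK>0 : 1 ≤ μ * K
      μK>0 = *-mono-≤ (≤-trans (s≤s z≤n) μ>q^s) K>0
      z+1 : z + 1 ≡ μ * K
      z+1 = m∸n+n≡m μK>0
      lem₁ : ∀ x y K → x * y * (K * K) ≡ x * K * (y * K)
      lem₁ = solve-∀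
      lem₂ : ∀ c d K n → (d * K + 1) * n * ((c * K + 1) * n) ≡ (d * K + 1) * (c * K + 1) * (n * n)
      lem₂ = solve-∀
      lem₃ : ∀ z n → z * z * (n * n) ≡ z * n * (z * n)
      lem₃ = solve-∀
      lem₄ : ∀ L K → L * K * (L * K) ≡ L * L * (K * K)
      lem₄ = solve-∀
      zN≤ : z * N₁ ≤ L * K
      zN≤ = +-cancelʳ-≤ N₁ _ _ (≤-trans (≤-reflexive (trans (lem₅ z N₁) (cong (_* N₁) z+1))) lower)
        where
        lem₅ : ∀ z n → z * n + n ≡ (z + 1) * n
        lem₅ = solve-∀
      core : (c₂ * K + 1) * (c₁ * K + 1) < z * z
      core = +-cancelʳ-< (2 * (z + 1)) _ _ (begin-strict
        (c₂ * K + 1) * (c₁ * K + 1) + 2 * (z + 1)                ≡⟨ cong (λ w → (c₂ * K + 1) * (c₁ * K + 1) + 2 * w) z+1 ⟩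
        (c₂ * K + 1) * (c₁ * K + 1) + 2 * (μ * K)                ≡⟨ lem₆ c₁ c₂ μ K ⟩
        c₁ * c₂ * (K * K) + ((c₁ + c₂ + 2 * μ) * K + 1)          <⟨ +-monoʳ-< (c₁ * c₂ * (K * K)) (+-monoˡ-< 1 (*-monoˡ-< K {{>-nonZero K>0}} cs)) ⟩
        c₁ * c₂ * (K * K) + (K * K + 1)                          ≡⟨ lem₇ (c₁ * c₂) (K * K) ⟩
        suc (c₁ * c₂) * (K * K) + 1                              ≤⟨ +-monoˡ-≤ 1 (*-monoˡ-≤ (K * K) cc) ⟩
        μ * μ * (K * K) + 1                                      ≡⟨ cong (_+ 1) (trans (sym (lem₄ μ K)) (cong₂ _*_ (sym z+1) (sym z+1))) ⟩
        (z + 1) * (z + 1) + 1                                    ≡⟨ lem₈ z ⟩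
        z * z + 2 * (z + 1)                                      ∎)
        where
        lem₆ : ∀ c d μ K → (d * K + 1) * (c * K + 1) + 2 * (μ * K) ≡ c * d * (K * K) + ((c + d + 2 * μ) * K + 1)
        lem₆ = solve-∀
        lem₇ : ∀ c K → c * K + (K + 1) ≡ suc c * K + 1
        lem₇ = solve-∀
        lem₈ : ∀ z → (z + 1) * (z + 1) + 1 ≡ z * z + 2 * (z + 1)
        lem₈ = solve-∀

-- Numbers of covers of dimension s + 1

module CoverBounds (G : Geometry) (k s : ℕ) (2≤s : 2 ≤ s) (s<k : s < k) (big : 4 * k + 6 ≤ Geometry.n G) where
  open Estimates G k s 2≤s s<k big public

  private variable
    S : Sp
    P P₁ P₂ : Fin (num k) → Set

  abstract
    span-hyperplanes : ∀ {X C Y} → X ⊆ C → Y ⊆ C → dim C ≤ suc s → s ≤ dim X → ¬ (Y ⊆ X) → C ⊆ X ∨ Y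
    span-hyperplanes {X} {C} {Y} f g dC dX Y⊈X = ⊆-of-dim (∨-least f g) (≤-trans dC (≤-trans (s≤s dX)
      (dim-strict (∨-⊆ˡ X Y) (λ h → Y⊈X (⊆-trans (∨-⊆ʳ X Y) h)))))

  abstract
    -- If `C` misses part of `D₀ ∩ D₁`, then `C ∩ D₁` is not contained in `C ∩ D₀`, which is at
    -- least a hyperplane of `C`; so the two span `C`.
    meet-or-join : ∀ {D₀ D₁ C} → dim (D₀ ∩ D₁) ≤ s → dim C ≤ suc s → s ≤ dim (C ∩ D₀) → s ≤ dim (C ∩ D₁) →
      D₀ ∩ D₁ ⊆ C ⊎ C ⊆ D₀ ∨ D₁
    meet-or-join {D₀} {D₁} {C} d∩ dC d₀ d₁ with (D₀ ∩ D₁) ⊆? C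
    ... | yes f = inj₁ f
    ... | no nf = inj₂ (⊆-trans (span-hyperplanes (∩-⊆ˡ C D₀) (∩-⊆ˡ C D₁) dC d₀ distinct)
          (∨-least (⊆-trans (∩-⊆ʳ C D₀) (∨-⊆ˡ D₀ D₁)) (⊆-trans (∩-⊆ʳ C D₁) (∨-⊆ʳ D₀ D₁))))
      where
      distinct : ¬ (C ∩ D₁ ⊆ C ∩ D₀)
      distinct h = nf (⊆-trans (⊆-of-dim (∩-least (⊆-trans h (∩-⊆ʳ C D₀)) (∩-⊆ʳ C D₁)) (≤-trans d∩ d₁)) (∩-⊆ˡ C D₁))

  -- Otherwise D₀ ∨ D, of dimension at most s+2, would contain C ∨ C′.
  abstract
    through-skew : ∀ {C C′ D₀ D} → dim C ≡ suc s → dim C′ ≡ suc s → dim (C ∩ C′) < s → dim D₀ ≡ suc s → dim D ≡ suc s →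
      s ≤ dim (D ∩ D₀) → s ≤ dim (D ∩ C) → s ≤ dim (D ∩ C′) → (D₀ ∩ C) ⊆ D ⊎ (D₀ ∩ C′) ⊆ D
    through-skew {C} {C′} {D₀} {D} dC dC′ skew dD₀ dD m₀ m₁ m₂ with (D₀ ∩ C) ⊆? D | (D₀ ∩ C′) ⊆? D
    ... | yes f | _     = inj₁ f
    ... | no _  | yes f = inj₂ f
    ... | no f  | no f′ = ⊥-elim (<-irrefl refl (begin-strict
          suc s + suc s                      ≡⟨ cong₂ _+_ (sym dC) (sym dC′) ⟩
          dim C + dim C′                     ≤⟨ dim-sum-≤ (inside C dC m₁ f) (inside C′ dC′ m₂ f′) ⟩
          dim (C ∩ C′) + dim (D ∨ D₀)        <⟨ +-monoˡ-< (dim (D ∨ D₀)) skew ⟩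
          s + dim (D ∨ D₀)                   ≤⟨ +-monoˡ-≤ _ m₀ ⟩
          dim (D ∩ D₀) + dim (D ∨ D₀)        ≡⟨ modular D D₀ ⟩
          dim D + dim D₀                     ≡⟨ cong₂ _+_ dD dD₀ ⟩
          suc s + suc s                      ∎))
      where
      open ≤-Reasoning
      inside : ∀ C → dim C ≡ suc s → s ≤ dim (D ∩ C) → ¬ (D₀ ∩ C ⊆ D) → C ⊆ D ∨ D₀
      inside C dC m nf = ⊆-trans (span-hyperplanes (∩-⊆ʳ D C) (∩-⊆ʳ D₀ C) (≤-reflexive dC) m
          (λ h → nf (⊆-trans h (∩-⊆ˡ D C))))
        (∨-least (⊆-trans (∩-⊆ˡ D C) (∨-⊆ˡ D D₀)) (⊆-trans (∩-⊆ˡ D₀ C) (∨-⊆ʳ D D₀)))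

  CoverAt : Fam → Fin (num (suc s)) → Set
  CoverAt P j = Cover P (sub (suc s) j)

  cov? : Decidable P → Decidable (CoverAt P)
  cov? P? j = cover? P? (sub (suc s) j)

  #cov : Decidable P → ℕ
  #cov P? = # (cov? P?)

  dim-C : ∀ j → dim (sub (suc s) j) ≡ suc s
  dim-C j = dim-sub j

  dim-C+1∸s : ∀ j → dim (sub (suc s) j) + 1 ∸ s ≡ 2
  dim-C+1∸s j = trans (cong (λ z → z + 1 ∸ s) (dim-C j)) (trans (cong (_∸ s) (trans (+-comm (suc s) 1) (+-comm 2 s))) (m+n∸m≡n s 2))

  -- By `Cover-dim` an s-space is never a cover, so one branching over a member leads to
  -- (s+1)-spaces, and at most one cover of that dimension contains such a space.
  pencil-covers : (P? : Decidable P) → Spread P → dim S ≡ s → through (cov? P?) S ≤ h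
  pencil-covers {S = S} P? sp dS = ≤-trans (branch-once (cov? P?) 1 P? (λ _ c → c)
      (λ c → <⇒≱ (s≤s (≤-reflexive dS)) (Cover-dim sp c))
      (λ x x∉ → through-full (cov? P?) (≤-reflexive (sym (trans (dim-add x∉) (cong suc dS))))))
    (≤-reflexive (*-identityʳ h))

  -- Members containing an (s+1)-dimensional cover of `P₂` give the main term. For the others no
  -- (s+1)-space met on the way is a cover, so branching continues to dimension s + 2. Its cost,
  -- `θ q 2 ^ s` times h², is at most q^(2(k+1)) and is absorbed by `K-tail`.
  size-by-cov : (P₁? : Decidable P₁) (P₂? : Decidable P₂) → Spread P₁ → Spread P₂ → Cross P₂ P₁ →
    ∀ j → CoverAt P₁ j → # P₁? * K ≤ (#cov P₂? * K + 1) * N (suc s)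
  size-by-cov {P₁} {P₂} P₁? P₂? sp₁ sp₂ cr j₀ c₀ = begin
      # P₁? * K                                              ≤⟨ *-monoˡ-≤ K (≤-reflexive (#-split P₁? has?)) ⟩
      (# good? + # bad?) * K                                 ≡⟨ *-distribʳ-+ K (# good?) (# bad?) ⟩
      # good? * K + # bad? * K                               ≤⟨ +-mono-≤ (*-monoˡ-≤ K good≤) (≤-trans (*-monoˡ-≤ K bad≤) bad-tail) ⟩
      #cov P₂? * N (suc s) * K + N (suc s)                   ≡⟨ lem (#cov P₂?) (N (suc s)) K ⟩
      (#cov P₂? * K + 1) * N (suc s)                         ∎
    where
    open ≤-Reasoning
    lem : ∀ c n K → c * n * K + n ≡ (c * K + 1) * n
    lem = solve-∀
    Has : Fin (num k) → Set
    Has i = ∃ λ j → CoverAt P₂ j × sub (suc s) j ⊆ sub k i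
    has? : Decidable Has
    has? i = Fin.any? (λ j → cov? P₂? j ×-dec (sub (suc s) j ⊆? sub k i))
    good? = λ i → P₁? i ×-dec has? i
    bad? = λ i → P₁? i ×-dec ¬? (has? i)
    good≤ : # good? ≤ #cov P₂? * N (suc s)
    good≤ = ≤-trans (≤-reflexive (sym (*-identityʳ _))) (double-count-≤ good? (cov? P₂?)
      (λ i j → cov? P₂? j ×-dec (sub (suc s) j ⊆? sub k i)) 1 (N (suc s))
      (λ { i (_ , j , c , f) → #-pos _ j (c , f) })
      (λ j _ → ≤-trans (#-mono _ (between? k (sub (suc s) j) (sub (suc s) j) ⊤ˢ)
         (λ i p → proj₂ (proj₂ p) , ∩-⊆ʳ (sub k i) (sub (suc s) j) , ⊆-⊤)) (≤-reflexive (above-N (dim-C j))))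
      (λ i j _ → proj₁))
    bad≤ : # bad? ≤ θ q 2 ^ s * (h * (h * N (2 + s)))
    bad≤ = ≤-trans (branch-to-s {W = sub (suc s) j₀} bad? (h * (h * N (2 + s))) (≤-trans (n≤1+n s) (≤-reflexive (sym (dim-C j₀))))
        (λ i p → c₀ i (proj₁ p))
        λ S dS → branch-once bad? (h * N (2 + s)) P₂? (λ i p l pl → cr l i pl (proj₁ p))
          (λ c → <⇒≱ (s≤s (≤-reflexive dS)) (Cover-dim sp₂ c))
          λ x x∉ → next (add S x) (trans (dim-add x∉) (cong suc dS)))
      (≤-reflexive (cong (λ z → θ q z ^ s * (h * (h * N (2 + s)))) (dim-C+1∸s j₀)))
      where
      next : ∀ S → dim S ≡ suc s → through bad? S ≤ h * N (2 + s)
      next S dS with cover? P₂? S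
      ... | no ¬c = branch-once bad? (N (2 + s)) P₂? (λ i p l pl → cr l i pl (proj₁ p)) ¬c
             λ x x∉ → ≤-trans (through≤above bad?) (≤-reflexive (above-N (trans (dim-add x∉) (cong suc dS))))
      ... | yes c = ≤-trans (≤-reflexive (#-none (λ i → bad? i ×-dec (S ⊆? sub k i)) λ i p → proj₂ (proj₁ p) (index i (proj₂ p)))) z≤n
        where
        index : ∀ i → S ⊆ sub k i → Has i
        index i f with sub-index S dS
        ... | j , a , b = j , (λ l pl → ≤-trans (c l pl) (dim-mono (∩-mono {sub k l} ⊆-refl a))) , ⊆-trans b f
    bad-tail : θ q 2 ^ s * (h * (h * N (2 + s))) * K ≤ N (suc s)
    bad-tail = begin
      θ q 2 ^ s * (h * (h * N (2 + s))) * K              ≤⟨ *-monoˡ-≤ K (*-mono-≤ (^-pow-≤ {b = 2} s (<⇒≤ (θ<^ 2≤q 2)))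
                                                             (*-mono-≤ (<⇒≤ (θ<^ 2≤q m)) (*-monoˡ-≤ (N (2 + s)) (<⇒≤ (θ<^ 2≤q m))))) ⟩
      q ^ (2 * s) * (q ^ m * (q ^ m * N (2 + s))) * K    ≡⟨ lem₁ (q ^ (2 * s)) (q ^ m) (N (2 + s)) K ⟩
      q ^ (2 * s) * q ^ m * q ^ m * K * N (2 + s)        ≡⟨ cong (λ z → z * K * N (2 + s)) (trans (cong (_* q ^ m) (sym (^-distribˡ-+-* q (2 * s) m)))
                                                             (trans (sym (^-distribˡ-+-* q (2 * s + m) m)) (trans (cong (q ^_) exps) (^-distribˡ-+-* q (suc k) (suc k))))) ⟩
      q ^ suc k * q ^ suc k * K * N (2 + s)              ≤⟨ K-tail ⟩
      N (suc s)                                          ∎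
      where
      lem₁ : ∀ a b n K → a * (b * (b * n)) * K ≡ a * b * b * K * n
      lem₁ = solve-∀
      lem₂ : ∀ s m → 2 * s + m + m ≡ (m + s) + (m + s)
      lem₂ = solve-∀
      exps : 2 * s + m + m ≡ suc k + suc k
      exps = trans (lem₂ s m) (cong₂ _+_ (trans m+s (+-comm k 1)) (trans m+s (+-comm k 1)))

  Pairwise : Fam → Set
  Pairwise P = ∀ i j → CoverAt P i → CoverAt P j → s ≤ dim (sub (suc s) i ∩ sub (suc s) j)

  CrossCov : Fam → Fam → Set
  CrossCov P₁ P₂ = ∀ i j → CoverAt P₁ i → CoverAt P₂ j → s ≤ dim (sub (suc s) j ∩ sub (suc s) i)

  Skew : Fam → Set
  Skew P = ∃ λ i → ∃ λ j → CoverAt P i × CoverAt P j × dim (sub (suc s) i ∩ sub (suc s) j) < s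

  pairwise? : Decidable P → Pairwise P ⊎ Skew P
  pairwise? {P} P? with Fin.any? (λ i → Fin.any? (λ j → cov? P? i ×-dec cov? P? j ×-dec (suc (dim (sub (suc s) i ∩ sub (suc s) j)) ≤? s)))
  ... | yes w = inj₂ w
  ... | no ¬w = inj₁ λ i j ci cj → ≮⇒≥ λ lt → ¬w (i , j , ci , cj , lt)

  -- The space R = C ∩ C′ has dimension at most s - 1. A cover D of `P₂` meets C and C′ in at least
  -- s of its s + 1 dimensions each, hence R in at least s - 1, so it contains R. One branching over
  -- C and one over C′ then determine D.
  skew-bound : (P₂? : Decidable P₂) → CrossCov P₁ P₂ → Skew P₁ → #cov P₂? ≤ θ q 2 * θ q 2
  skew-bound {P₂} {P₁} P₂? cr (i , i′ , ci , ci′ , lt) = begin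
      #cov P₂?                                ≤⟨ #-mono (cov? P₂?) (λ j → cov? P₂? j ×-dec (R ⊆? sub (suc s) j)) (λ j c → c , R⊆ j c) ⟩
      through (cov? P₂?) R                    ≤⟨ branch {S = R} {B = C} (cov? P₂?) (θ q 2) (≤-trans (s≤s (dim-mono (∩-⊆ˡ R C))) lt)
                                                   (≤-trans (n≤1+n s) (≤-reflexive (sym (dim-C i)))) (λ j c _ → cr i j ci c) next ⟩
      θ q (dim C + 1 ∸ s) * θ q 2             ≡⟨ cong (λ z → θ q z * θ q 2) (dim-C+1∸s i) ⟩
      θ q 2 * θ q 2                           ∎
    where
    open ≤-Reasoning
    C = sub (suc s) i
    C′ = sub (suc s) i′
    R = C ∩ C′
    low : ∀ j → CoverAt P₂ j → s + s ≤ dim ((sub (suc s) j ∩ C) ∩ (sub (suc s) j ∩ C′)) + suc s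
    low j c = ≤-trans (+-mono-≤ (cr i j ci c) (cr i′ j ci′ c))
      (≤-trans (dim-sum-≤ (∩-⊆ˡ (sub (suc s) j) C) (∩-⊆ˡ (sub (suc s) j) C′)) (≤-reflexive (cong (dim ((sub (suc s) j ∩ C) ∩ (sub (suc s) j ∩ C′)) +_) (dim-C j))))
    R⊆ : ∀ j → CoverAt P₂ j → R ⊆ sub (suc s) j
    R⊆ j c = ⊆-trans (⊆-of-dim {I} {R} (∩-mono (∩-⊆ʳ D′ C) (∩-⊆ʳ D′ C′))
        (s≤s⁻¹ (≤-trans lt (+-cancelʳ-≤ s _ _ (≤-trans (low j c) (≤-reflexive (+-suc (dim I) s)))))))
      (⊆-trans (∩-⊆ˡ (D′ ∩ C) (D′ ∩ C′)) (∩-⊆ˡ D′ C))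
      where
      D′ = sub (suc s) j
      I = (D′ ∩ C) ∩ (D′ ∩ C′)
    next : ∀ x → x ∈ C → ¬ (x ∈ R) → through (cov? P₂?) (add R x) ≤ θ q 2
    -- That dim R is at least s - 1 is read off from an actual cover of `P₂`, hence the case
    -- distinction.
    next x x∈C x∉R = nonempty (Fin.any? (cov? P₂?))
      where
      nonempty : Dec (∃ (CoverAt P₂)) → through (cov? P₂?) (add R x) ≤ θ q 2
      nonempty (no none) = ≤-trans (≤-reflexive (#-none (λ j → cov? P₂? j ×-dec (add R x ⊆? sub (suc s) j)) λ j p → none (j , proj₁ p))) z≤n
      nonempty (yes (j₀ , c₀)) = begin
        through (cov? P₂?) (add R x)              ≤⟨ branch {S = add R x} {B = C′} (cov? P₂?) 1 small (≤-trans (n≤1+n s) (≤-reflexive (sym (dim-C i′))))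
                                                      (λ j c _ → cr i′ j ci′ c) (λ y _ y∉ → through-full (cov? P₂?)
                                                        (≤-trans (s≤s s≤add) (≤-reflexive (sym (dim-add y∉))))) ⟩
        θ q (dim C′ + 1 ∸ s) * 1                  ≡⟨ trans (*-identityʳ _) (cong (θ q) (dim-C+1∸s i′)) ⟩
        θ q 2                                     ∎
        where
        dR : s ≤ suc (dim R)
        dR = +-cancelʳ-≤ s _ _ (≤-trans (low j₀ c₀) (≤-trans (≤-reflexive (+-suc _ s)) (s≤s (+-monoˡ-≤ s
              (dim-mono (∩-mono (∩-⊆ʳ (sub (suc s) j₀) C) (∩-⊆ʳ (sub (suc s) j₀) C′)))))))
        s≤add : s ≤ dim (add R x)
        s≤add = ≤-trans dR (≤-reflexive (sym (dim-add x∉R)))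
        small : dim (add R x ∩ C′) < s
        small = ≤-trans (s≤s (dim-mono (∩-least (⊆-trans (∩-⊆ˡ (add R x) C′) (add-least (∩-⊆ˡ C C′) x∈C)) (∩-⊆ʳ (add R x) C′)))) lt

  -- By `through-skew` a fixed D₀ confines every cover to one of two pencils, through D₀ ∩ C or D₀ ∩
  -- C′. Each is cut down to `θ q 2` by branching over the other space of the skew pair.
  skew-pairwise-bound : (P₂? : Decidable P₂) → CrossCov P₁ P₂ → Skew P₁ → Pairwise P₂ →
    ∃ (CoverAt P₂) → #cov P₂? ≤ θ q 2 + θ q 2
  skew-pairwise-bound {P₂} {P₁} P₂? cr (i , i′ , ci , ci′ , lt) pw (j₀ , c₀) = ≤-trans
      (#-∪ (cov? P₂?) (λ j → cov? P₂? j ×-dec ((D₀ ∩ C) ⊆? sub (suc s) j)) (λ j → cov? P₂? j ×-dec ((D₀ ∩ C′) ⊆? sub (suc s) j)) split)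
      (+-mono-≤ (half C i′ (cr i j₀ ci c₀) ci′ lt) (half C′ i (cr i′ j₀ ci′ c₀) ci (≤-trans (s≤s (≤-reflexive (dim-∩-comm C′ C))) lt)))
    where
    C = sub (suc s) i
    C′ = sub (suc s) i′
    D₀ = sub (suc s) j₀
    split : ∀ j → CoverAt P₂ j → (CoverAt P₂ j × D₀ ∩ C ⊆ sub (suc s) j) ⊎ (CoverAt P₂ j × D₀ ∩ C′ ⊆ sub (suc s) j)
    split j c with through-skew {C} {C′} {D₀} {sub (suc s) j} (dim-C i) (dim-C i′) lt (dim-C j₀) (dim-C j) (pw j j₀ c c₀) (cr i j ci c) (cr i′ j ci′ c)
    ... | inj₁ f = inj₁ (c , f)
    ... | inj₂ f = inj₂ (c , f)
    half : ∀ C l → s ≤ dim (D₀ ∩ C) → CoverAt P₁ l → dim (C ∩ sub (suc s) l) < s → through (cov? P₂?) (D₀ ∩ C) ≤ θ q 2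
    half C l dX cl lt = ≤-trans (branch {S = D₀ ∩ C} {B = sub (suc s) l} (cov? P₂?) 1
        (≤-trans (s≤s (dim-mono (∩-mono (∩-⊆ʳ D₀ C) ⊆-refl))) lt) (≤-trans (n≤1+n s) (≤-reflexive (sym (dim-C l))))
        (λ j c _ → cr l j cl c) (λ x _ x∉ → through-full (cov? P₂?) (≤-trans (s≤s dX) (≤-reflexive (sym (dim-add x∉))))))
      (≤-reflexive (trans (*-identityʳ _) (cong (θ q) (dim-C+1∸s l))))

  -- D₀ and D₁ meet in an s-space and span an (s+2)-space. By `meet-or-join` a cover of `P₁` is in
  -- the pencil of the former or among the hyperplanes of the latter.
  two-covers-bound : (P₁? : Decidable P₁) → Spread P₁ → CrossCov P₂ P₁ → Pairwise P₂ →
    ∀ j₀ j₁ → CoverAt P₂ j₀ → CoverAt P₂ j₁ → ¬ j₁ ≡ j₀ → #cov P₁? ≤ h + g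
  two-covers-bound {P₁} P₁? sp cr pw j₀ j₁ c₀ c₁ ne = ≤-trans
      (#-∪ (cov? P₁?) (λ i → cov? P₁? i ×-dec ((D₀ ∩ D₁) ⊆? sub (suc s) i)) (between? (suc s) ⊥ˢ ⊥ˢ (D₀ ∨ D₁)) split)
      (+-mono-≤ (pencil-covers P₁? sp d∩) (≤-reflexive (interval-ball d∨)))
    where
    D₀ = sub (suc s) j₀
    D₁ = sub (suc s) j₁
    d∩ : dim (D₀ ∩ D₁) ≡ s
    d∩ = ≤-antisym (s≤s⁻¹ (≤-trans (dim-strict (∩-⊆ʳ D₀ D₁) (λ f → ne (sub-inj (⊆-trans f (∩-⊆ˡ D₀ D₁))))) (≤-reflexive (dim-C j₁))))
                   (pw j₀ j₁ c₀ c₁)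
    d∨ : dim (D₀ ∨ D₁) ≡ 2 + s
    d∨ = +-cancelˡ-≡ s _ _ (trans (cong (_+ dim (D₀ ∨ D₁)) (sym d∩)) (trans (modular D₀ D₁)
           (trans (cong₂ _+_ (dim-C j₀) (dim-C j₁)) (lem s))))
      where
      lem : ∀ s → suc s + suc s ≡ s + (2 + s)
      lem = solve-∀
    split : ∀ i → CoverAt P₁ i → (CoverAt P₁ i × D₀ ∩ D₁ ⊆ sub (suc s) i) ⊎ Between (suc s) ⊥ˢ ⊥ˢ (D₀ ∨ D₁) i
    split i c with meet-or-join {D₀} {D₁} {sub (suc s) i} (≤-reflexive d∩) (≤-reflexive (dim-C i)) (cr j₀ i c₀ c) (cr j₁ i c₁ c)
    ... | inj₁ f = inj₁ (c , f)
    ... | inj₂ f = inj₂ (⊥-⊆ , ∩-⊆ʳ (sub (suc s) i) ⊥ˢ , f)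

  -- Covers are sorted by an s-space they share with D₀: there are `θ q (suc s)` candidates, each
  -- contained in at most `h` covers.
  one-cover-bound : (P₁? : Decidable P₁) → Spread P₁ → CrossCov P₂ P₁ → ∀ j₀ → CoverAt P₂ j₀ → #cov P₁? ≤ θ q (suc s) * h
  one-cover-bound {P₁} P₁? sp cr j₀ c₀ = ≤-trans (≤-reflexive (sym (*-identityʳ _)))
      (≤-trans (double-count-≤ (cov? P₁?) (between? s ⊥ˢ ⊥ˢ D₀) (λ i l → (sub s l ⊆? sub (suc s) i) ×-dec (sub s l ⊆? D₀)) 1 h
        row (λ l p → ≤-trans (#-mono _ (λ i → cov? P₁? i ×-dec (sub s l ⊆? sub (suc s) i)) (λ i r → proj₁ r , proj₁ (proj₂ r))) (pencil-covers P₁? sp (dim-sub l)))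
        (λ i l _ r → ⊥-⊆ , ∩-⊆ʳ (sub s l) ⊥ˢ , proj₂ r))
      (≤-reflexive (cong (_* h) (hyperplanes-size s ⊥-⊆ (cong (_+ s) dim-⊥) (dim-C j₀)))))
    where
    D₀ = sub (suc s) j₀
    row : ∀ i → CoverAt P₁ i → 1 ≤ # (λ l → (sub s l ⊆? sub (suc s) i) ×-dec (sub s l ⊆? D₀))
    row i c with interpolate {⊥ˢ} {sub (suc s) i ∩ D₀} s ⊥-⊆ (≤-trans (≤-reflexive dim-⊥) z≤n) (cr j₀ i c₀ c)
    ... | X , _ , f , dX with sub-index X dX
    ... | l , a , b = #-pos _ l (⊆-trans b (⊆-trans f (∩-⊆ˡ (sub (suc s) i) D₀)) , ⊆-trans b (⊆-trans f (∩-⊆ʳ (sub (suc s) i) D₀)))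

-- Shape of the families of covers

module CoverShapes (G : Geometry) (k s : ℕ) (2≤s : 2 ≤ s) (s<k : s < k) (big : 4 * k + 6 ≤ Geometry.n G) where
  open CoverBounds G k s 2≤s s<k big public

  private variable
    P P₁ P₂ : Fin (num k) → Set

  -- `a` keeps a concrete member not containing `T`, against which `star-hm` tests the members of
  -- the other family.
  record StarHull (P : Fam) (T : Sp) : Set where
    field
      M      : Sp
      T⊆M    : T ⊆ M
      dim-M  : dim M ≡ suc k
      inside : ∀ i → P i → ¬ (T ⊆ sub k i) → sub k i ⊆ M
      a      : Fin (num k)
      a∈P    : P a
      T⊈a    : ¬ (T ⊆ sub k a)

  -- A member A not containing `T` meets each cover outside `T`, so every cover lies in T ∨ A, a
  -- (k+1)-space. If another such member sticks out of T ∨ A, the covers lie in an intersection of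
  -- two joins, of dimension at most k.
  star-dichotomy : (P? : Decidable P) → Spread P → ∀ T → dim T ≡ s → ∃ (CoverAt P) →
    (∀ j → CoverAt P j → T ⊆ sub (suc s) j) → #cov P? ≤ θ q (k ∸ s) ⊎ StarHull P T
  star-dichotomy {P} P? sp T dT (j₀ , c₀) all = finish (sp T dT)
    where
    join-dim : ∀ A → P A → ¬ (T ⊆ sub k A) → dim (T ∨ sub k A) ≡ suc k
    join-dim a pa T⊈ = ≤-antisym
      (+-cancelˡ-≤ s _ _ (begin
        s + dim (T ∨ A)                         ≤⟨ +-monoˡ-≤ _ low ⟩
        suc (dim (T ∩ A)) + dim (T ∨ A)         ≡⟨ cong suc (modular T A) ⟩
        suc (dim T + dim A)                     ≡⟨ cong suc (cong₂ _+_ dT (dim-sub a)) ⟩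
        suc (s + k)                             ≡⟨ sym (+-suc s k) ⟩
        s + suc k                               ∎))
      (≤-trans (s≤s (≤-reflexive (sym (dim-sub a)))) (dim-strict (∨-⊆ʳ T A) (λ f → T⊈ (⊆-trans (∨-⊆ˡ T A) f))))
      where
      open ≤-Reasoning
      A = sub k a
      C = sub (suc s) j₀
      low : s ≤ suc (dim (T ∩ A))
      low = +-cancelʳ-≤ s _ _ (begin
        s + s                                   ≤⟨ +-mono-≤ (≤-reflexive (sym dT)) (c₀ a pa) ⟩
        dim T + dim (A ∩ C)                     ≤⟨ dim-sum-≤ (all j₀ c₀) (∩-⊆ʳ A C) ⟩
        dim (T ∩ (A ∩ C)) + dim C               ≤⟨ +-mono-≤ (dim-mono (∩-mono {T} ⊆-refl (∩-⊆ˡ A C))) (≤-reflexive (dim-C j₀)) ⟩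
        dim (T ∩ A) + suc s                     ≡⟨ +-suc _ s ⟩
        suc (dim (T ∩ A)) + s                   ∎)
    below : ∀ a → P a → ¬ (T ⊆ sub k a) → ∀ j → CoverAt P j → sub (suc s) j ⊆ T ∨ sub k a
    below a pa T⊈ j c = ⊆-trans (span-hyperplanes (all j c) (∩-⊆ʳ A C) (≤-reflexive (dim-C j)) (≤-reflexive (sym dT))
        (λ f → T⊈ (⊆-trans (⊆-of-dim f (≤-trans (≤-reflexive dT) (c a pa))) (∩-⊆ˡ A C))))
      (∨-least (∨-⊆ˡ T A) (⊆-trans (∩-⊆ˡ A C) (∨-⊆ʳ T A)))
      where
      A = sub k a
      C = sub (suc s) j
    finish : (∃ λ a → P a × ¬ (T ⊆ sub k a)) → #cov P? ≤ θ q (k ∸ s) ⊎ StarHull P T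
    finish (a , pa , T⊈a) with Fin.any? (λ b → P? b ×-dec (¬? (T ⊆? sub k b) ×-dec ¬? (sub k b ⊆? (T ∨ sub k a))))
    ... | no none = inj₂ record { M = T ∨ sub k a ; T⊆M = ∨-⊆ˡ T _ ; dim-M = join-dim a pa T⊈a
              ; inside = inside ; a = a ; a∈P = pa ; T⊈a = T⊈a }
      where
      inside : ∀ i → P i → ¬ (T ⊆ sub k i) → sub k i ⊆ T ∨ sub k a
      inside i p T⊈ with sub k i ⊆? (T ∨ sub k a)
      ... | yes f = f
      ... | no nf = ⊥-elim (none (i , p , T⊈ , nf))
    ... | yes (b , pb , T⊈b , nf) = inj₁ (begin
        #cov P?                                 ≤⟨ #-mono (cov? P?) (between? (suc s) T T I) (λ j c → all j c , ∩-⊆ʳ (sub (suc s) j) T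
                                                     , ∩-least (below a pa T⊈a j c) (below b pb T⊈b j c)) ⟩
        interval (suc s) T I                    ≡⟨ pencil-size (∩-least (∨-⊆ˡ T _) (∨-⊆ˡ T _)) dT ⟩
        θ q (dim I ∸ s)                         ≤⟨ θ-mono q (∸-monoˡ-≤ s dI) ⟩
        θ q (k ∸ s)                             ∎)
      where
      open ≤-Reasoning
      M₁ = T ∨ sub k a
      M₂ = T ∨ sub k b
      I = M₁ ∩ M₂
      dI : dim I ≤ k
      dI = s≤s⁻¹ (≤-trans (dim-strict (∩-⊆ˡ M₁ M₂) λ f → nf (⊆-trans (∨-⊆ʳ T (sub k b))
              (⊆-of-dim (⊆-trans f (∩-⊆ʳ M₁ M₂)) (≤-reflexive (trans (join-dim b pb T⊈b) (sym (join-dim a pa T⊈a)))))))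
            (≤-reflexive (join-dim a pa T⊈a)))

  -- A member F through `T` shares at least s dimensions with the member `a` of the other family,
  -- and not just `T`. Hence `T` and the common part span at least s + 1 dimensions inside F and the
  -- other hull.
  star-hm : ∀ {T} → dim T ≡ s → Cross P₁ P₂ → (H₁ : StarHull P₁ T) (H₂ : StarHull P₂ T) →
    ∀ i → P₁ i → HM T (StarHull.M H₂) (StarHull.M H₁) i
  star-hm {T = T} dT cr H₁ H₂ i p with T ⊆? sub k i
  ... | no T⊈F = inj₂ (StarHull.inside H₁ i p T⊈F , T⊈F)
  ... | yes T⊆F = inj₁ (T⊆F , ≤-trans (s≤s (≤-reflexive (sym dT))) (≤-trans
        (dim-strict (∨-⊆ˡ T FB) (λ f → T⊈a (⊆-trans (⊆-of-dim (⊆-trans (∨-⊆ʳ T FB) f) (≤-trans (≤-reflexive dT) (cr i a p a∈P))) (∩-⊆ʳ F B))))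
        (dim-mono (∨-least (∩-least T⊆F T⊆M) (∩-mono {F} ⊆-refl (inside a a∈P T⊈a))))))
    where
    open StarHull H₂
    F = sub k i
    B = sub k a
    FB = F ∩ B

  -- A member outside the ball meets `Z` in an s-space that every cover must contain, which leaves
  -- only a pencil inside `Z`.
  ball-dichotomy : (P? : Decidable P) → ∀ Z → dim Z ≡ 2 + s → ∃ (CoverAt P) →
    (∀ j → CoverAt P j → sub (suc s) j ⊆ Z) → #cov P? ≤ θ q 2 ⊎ (∀ i → P i → Ball Z i)
  ball-dichotomy {P} P? Z dZ (j₀ , c₀) all with Fin.any? (λ i → P? i ×-dec ¬? (ball? Z i))
  ... | no none = inj₂ λ i p → ≮⇒≥ λ lt → none (i , p , <⇒≱ lt)
  ... | yes (i , p , nb) = inj₁ (≤-trans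
        (#-mono (cov? P?) (between? (suc s) T T Z) (λ j c → T⊆ j c , ∩-⊆ʳ (sub (suc s) j) T , all j c))
        (≤-reflexive (trans (pencil-size (∩-⊆ʳ A Z) dT) (cong (θ q) (trans (cong (_∸ s) dZ) (m+n∸n≡m 2 s))))))
    where
    A = sub k i
    T = A ∩ Z
    AC⊆T : ∀ j → CoverAt P j → A ∩ sub (suc s) j ⊆ T
    AC⊆T j c = ∩-mono {A} ⊆-refl (all j c)
    dT : dim T ≡ s
    dT = ≤-antisym (s≤s⁻¹ (≰⇒> nb)) (≤-trans (c₀ i p) (dim-mono (AC⊆T j₀ c₀)))
    T⊆ : ∀ j → CoverAt P j → T ⊆ sub (suc s) j
    T⊆ j c = ⊆-trans (⊆-of-dim (AC⊆T j c) (≤-trans (≤-reflexive dT) (c i p))) (∩-⊆ʳ A (sub (suc s) j))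

  -- The classical dichotomy for pairwise s-intersecting (s+1)-spaces. Two of them, C₀ and C₁, fix
  -- the candidates T = C₀ ∩ C₁ and Z = C₀ ∨ C₁; a third one not through T lies in Z and forces all
  -- others into Z.
  star-or-ball : {R : Fin (num (suc s)) → Set} (R? : Decidable R) → ∃ R →
    (∀ i j → R i → R j → s ≤ dim (sub (suc s) i ∩ sub (suc s) j)) →
    (∃ λ T → dim T ≡ s × ∀ j → R j → T ⊆ sub (suc s) j) ⊎
    (∃ λ Z → dim Z ≡ 2 + s × ∀ j → R j → sub (suc s) j ⊆ Z)
  star-or-ball {R} R? (j₀ , r₀) pw with Fin.any? (λ j → R? j ×-dec ¬? (j Fin.≟ j₀))
  ... | no none = inj₁ single
    where
    single : ∃ λ T → dim T ≡ s × ∀ j → R j → T ⊆ sub (suc s) j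
    single with interpolate {⊥ˢ} {sub (suc s) j₀} s ⊥-⊆ (≤-trans (≤-reflexive dim-⊥) z≤n) (≤-trans (n≤1+n s) (≤-reflexive (sym (dim-C j₀))))
    ... | T , _ , f , dT = T , dT , only
      where
      only : ∀ j → R j → T ⊆ sub (suc s) j
      only j r with j Fin.≟ j₀
      ... | yes refl = f
      ... | no ne    = ⊥-elim (none (j , r , ne))
  ... | yes (j₁ , r₁ , ne) with Fin.any? (λ j → R? j ×-dec ¬? ((sub (suc s) j₀ ∩ sub (suc s) j₁) ⊆? sub (suc s) j))
  ... | no none = inj₁ (T , dT , all)
    where
    T = sub (suc s) j₀ ∩ sub (suc s) j₁
    dT : dim T ≡ s
    dT = ≤-antisym (s≤s⁻¹ (≤-trans (dim-strict (∩-⊆ʳ _ (sub (suc s) j₁)) (λ f → ne (sub-inj (⊆-trans f (∩-⊆ˡ (sub (suc s) j₀) _))))) (≤-reflexive (dim-C j₁))))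
                   (pw j₀ j₁ r₀ r₁)
    all : ∀ j → R j → T ⊆ sub (suc s) j
    all j r with T ⊆? sub (suc s) j
    ... | yes f = f
    ... | no nf = ⊥-elim (none (j , r , nf))
  ... | yes (j₂ , r₂ , T⊈) = inj₂ (Z , dZ , all)
    where
    C₀ = sub (suc s) j₀
    C₁ = sub (suc s) j₁
    C₂ = sub (suc s) j₂
    T = C₀ ∩ C₁
    Z = C₀ ∨ C₁
    thin : ∀ a b → ¬ (b ≡ a) → dim (sub (suc s) a ∩ sub (suc s) b) ≤ s
    thin a b ne = s≤s⁻¹ (≤-trans (dim-strict (∩-⊆ʳ (sub (suc s) a) (sub (suc s) b)) (λ f → ne (sub-inj (⊆-trans f (∩-⊆ˡ (sub (suc s) a) _))))) (≤-reflexive (dim-C b)))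
    dT : dim T ≡ s
    dT = ≤-antisym (thin j₀ j₁ ne) (pw j₀ j₁ r₀ r₁)
    dZ : dim Z ≡ 2 + s
    dZ = +-cancelˡ-≡ s _ _ (trans (cong (_+ dim Z) (sym dT)) (trans (modular C₀ C₁)
           (trans (cong₂ _+_ (dim-C j₀) (dim-C j₁)) (lem s))))
      where
      lem : ∀ s → suc s + suc s ≡ s + (2 + s)
      lem = solve-∀
    C₂⊆Z : C₂ ⊆ Z
    C₂⊆Z with meet-or-join {C₀} {C₁} {C₂} (≤-reflexive dT) (≤-reflexive (dim-C j₂)) (pw j₂ j₀ r₂ r₀) (pw j₂ j₁ r₂ r₁)
    ... | inj₁ f = ⊥-elim (T⊈ f)
    ... | inj₂ f = f
    all : ∀ j → R j → sub (suc s) j ⊆ Z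
    all j r with meet-or-join {C₀} {C₁} {sub (suc s) j} (≤-reflexive dT) (≤-reflexive (dim-C j)) (pw j j₀ r r₀) (pw j j₁ r r₁)
    ... | inj₂ f = f
    -- A space through T is compared with C₀ and C₂: either it lies in C₀ ∨ C₂, hence in Z, or it
    -- contains C₀ ∩ C₂ as well as C₀ ∩ C₁; these span C₀, so it equals C₀.
    ... | inj₁ T⊆C with meet-or-join {C₀} {C₂} {sub (suc s) j} (thin j₀ j₂ λ { refl → T⊈ (∩-⊆ˡ C₀ C₁) }) (≤-reflexive (dim-C j)) (pw j j₀ r r₀) (pw j j₂ r r₂)
    ... | inj₂ f = ⊆-trans f (∨-least (∨-⊆ˡ C₀ C₁) C₂⊆Z)
    ... | inj₁ f = ⊆-trans (⊆-of-dim (⊆-trans (span-hyperplanes (∩-⊆ˡ C₀ C₂) (∩-⊆ˡ C₀ C₁) (≤-reflexive (dim-C j₀)) (pw j₀ j₂ r₀ r₂)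
             (λ h → T⊈ (⊆-trans h (∩-⊆ʳ C₀ C₂)))) (∨-least f T⊆C)) (≤-reflexive (trans (dim-C j) (sym (dim-C j₀))))) (∨-⊆ˡ C₀ C₁)

  -- As s ≥ 2, `g` is at least θ q 4 = (1 + q²) θ q 2, and 1 + q² ≥ 5. With q = 2 + p the difference
  -- is a polynomial in p with nonnegative coefficients.
  5θ₂≤g : 5 * θ q 2 ≤ g
  5θ₂≤g = ≤-trans (lem q 2≤q) (θ-mono q (s≤s (s≤s 2≤s)))
    where
    lem : ∀ q → 2 ≤ q → 5 * θ q 2 ≤ θ q 4
    lem (suc (suc p)) _ = ≤-trans (m≤m+n _ ((3 + p) * (4 * p + p * p))) (≤-reflexive (id′ p))
      where
      id′ : ∀ p → 5 * (1 + (2 + p) * (1 + (2 + p) * 0)) + (3 + p) * (4 * p + p * p)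
            ≡ 1 + (2 + p) * (1 + (2 + p) * (1 + (2 + p) * (1 + (2 + p) * 0)))
      id′ = solve-∀
    lem (suc zero) (s≤s ())

  θ₂²<g : θ q 2 * θ q 2 < g
  θ₂²<g = ≤-trans (lem q 2≤q) (θ-mono q (s≤s (s≤s 2≤s)))
    where
    lem : ∀ q → 2 ≤ q → θ q 2 * θ q 2 < θ q 4
    lem (suc (suc p)) _ = ≤-trans (m≤m+n _ (5 + p * (11 + p * (6 + p)))) (≤-reflexive (id′ p))
      where
      id′ : ∀ p → suc ((1 + (2 + p) * (1 + (2 + p) * 0)) * (1 + (2 + p) * (1 + (2 + p) * 0))) + (5 + p * (11 + p * (6 + p)))
            ≡ 1 + (2 + p) * (1 + (2 + p) * (1 + (2 + p) * (1 + (2 + p) * 0)))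
      id′ = solve-∀
    lem (suc zero) (s≤s ())

  -- The two hypotheses of `few-covers-small`: the product misses μ², and the linear terms stay
  -- below K.
  Few : ℕ → ℕ → ℕ → Set
  Few μ c₁ c₂ = c₁ * c₂ < μ * μ × c₁ + c₂ + 2 * μ < K

  few-sym : ∀ {μ c₁ c₂} → Few μ c₁ c₂ → Few μ c₂ c₁
  few-sym {μ} {c₁} {c₂} (a , b) = ≤-trans (s≤s (≤-reflexive (*-comm c₂ c₁))) a , ≤-trans (s≤s (≤-reflexive (cong (_+ 2 * μ) (+-comm c₂ c₁)))) b

  module Leading (μ : ℕ) (g≤μ : g ≤ μ) (h≤μ : h ≤ μ) (μ≤ : μ ≤ q ^ suc k) where

    4q≤K : ∀ {x} → x ≤ q ^ (2 + k) → 4 * x ≤ K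
    4q≤K {x} le = ≤-trans (*-mono-≤ (*-mono-≤ 2≤q 2≤q) le) (≤-reflexive (trans (cong (_* q ^ (2 + k)) (lem q)) (trans (sym (^-distribˡ-+-* q 2 (2 + k))) (cong (q ^_) (lem′ k)))))
      where
      lem : ∀ q → q * q ≡ q * (q * 1)
      lem = solve-∀
      lem′ : ∀ k → 2 + (2 + k) ≡ k + 4
      lem′ = solve-∀

    2μ≤ : 2 * μ ≤ q ^ (2 + k)
    2μ≤ = *-mono-≤ 2≤q μ≤

    5≤μ : 5 ≤ μ
    5≤μ = ≤-trans (*-monoʳ-≤ 5 {1} (θ≥1 q 1)) (≤-trans 5θ₂≤g g≤μ)

    few : ∀ {c₁ c₂ a b} → c₁ ≤ a → c₂ ≤ b → a ≤ 2 * μ → b ≤ 2 * μ → a * b < μ * μ → Few μ c₁ c₂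
    few {c₁} {c₂} ca cb a≤ b≤ ab = ≤-trans (s≤s (*-mono-≤ ca cb)) ab , (begin-strict
        c₁ + c₂ + 2 * μ           ≤⟨ +-monoˡ-≤ (2 * μ) (+-mono-≤ (≤-trans ca a≤) (≤-trans cb b≤)) ⟩
        2 * μ + 2 * μ + 2 * μ     <⟨ m<m+n _ (≤-trans (≤-trans (s≤s z≤n) 5≤μ) (m≤m+n μ (μ + 0))) ⟩
        2 * μ + 2 * μ + 2 * μ + 2 * μ ≡⟨ lem (2 * μ) ⟩
        4 * (2 * μ)               ≤⟨ 4q≤K 2μ≤ ⟩
        K                         ∎)
      where
      open ≤-Reasoning
      lem : ∀ x → x + x + x + x ≡ 4 * x
      lem = solve-∀

    μ≤2μ : μ ≤ 2 * μ
    μ≤2μ = m≤m+n μ (μ + 0)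

    θ2≤μ : θ q 2 ≤ μ
    θ2≤μ = ≤-trans (≤-trans (m≤m+n (θ q 2) (4 * θ q 2)) 5θ₂≤g) g≤μ

    few-skew : ∀ {c₁ c₂} → c₁ ≤ θ q 2 * θ q 2 → c₂ ≤ θ q 2 * θ q 2 → Few μ c₁ c₂
    few-skew a b = few a b le le (*-mono-< lt lt)
      where
      lt = ≤-trans θ₂²<g g≤μ
      le = ≤-trans (<⇒≤ lt) μ≤2μ

    few-mixed : ∀ {c₁ c₂} → c₁ ≤ h + g → c₂ ≤ θ q 2 + θ q 2 → Few μ c₁ c₂
    few-mixed a b = few a b (≤-trans (+-mono-≤ h≤μ g≤μ) (≤-reflexive (cong (μ +_) (sym (+-identityʳ μ)))))
      (≤-trans (+-mono-≤ θ2≤μ θ2≤μ) (≤-reflexive (cong (μ +_) (sym (+-identityʳ μ)))))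
      (begin-strict
        (h + g) * (θ q 2 + θ q 2)     ≤⟨ *-monoˡ-≤ (θ q 2 + θ q 2) (+-mono-≤ h≤μ g≤μ) ⟩
        (μ + μ) * (θ q 2 + θ q 2)     ≡⟨ lem μ (θ q 2) ⟩
        μ * (4 * θ q 2)               <⟨ *-monoʳ-< μ {{>-nonZero (≤-trans (s≤s z≤n) 5≤μ)}} (≤-trans (+-monoˡ-≤ (4 * θ q 2) (θ≥1 q 1)) (≤-trans 5θ₂≤g g≤μ)) ⟩
        μ * μ                         ∎)
      where
      open ≤-Reasoning
      lem : ∀ m t → (m + m) * (t + t) ≡ m * (4 * t)
      lem = solve-∀

    h>0 : 1 ≤ h
    h>0 = ≤-trans (θ≥1 q 0) (θ-mono q (m<n⇒0<n∸m (≤-trans s<k (m≤m+n k 1))))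

    few-single : ∀ {c₁ c₂} → c₁ ≤ θ q (suc s) * h → c₂ ≤ 1 → Few μ c₁ c₂
    few-single {c₁} {c₂} a b = (begin-strict
        c₁ * c₂                       ≤⟨ *-mono-≤ a b ⟩
        θ q (suc s) * h * 1           ≡⟨ *-identityʳ _ ⟩
        θ q (suc s) * h               <⟨ *-monoˡ-< h {{>-nonZero h>0}} (θ-strict 1≤q (suc s)) ⟩
        g * h                         ≤⟨ *-mono-≤ g≤μ h≤μ ⟩
        μ * μ                         ∎) , (begin-strict
        c₁ + c₂ + 2 * μ               ≤⟨ +-mono-≤ (+-mono-≤ c₁≤ (≤-trans b (1≤^ (2 + k) 1≤q))) 2μ≤ ⟩
        X + X + X                     <⟨ m<m+n _ (1≤^ (2 + k) 1≤q) ⟩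
        X + X + X + X                 ≡⟨ lem X ⟩
        4 * X                         ≤⟨ 4q≤K ≤-refl ⟩
        K                             ∎)
      where
      open ≤-Reasoning
      X = q ^ (2 + k)
      lem : ∀ x → x + x + x + x ≡ 4 * x
      lem = solve-∀
      c₁≤ : c₁ ≤ X
      c₁≤ = ≤-trans a (≤-trans (*-mono-≤ (<⇒≤ (θ<^ 2≤q (suc s))) (<⇒≤ (θ<^ 2≤q m)))
        (≤-reflexive (trans (sym (^-distribˡ-+-* q (suc s) m)) (cong (q ^_) (trans (cong suc (trans (+-comm s m) m+s)) (cong suc (+-comm k 1)))))))

    few-star : ∀ {c₁ c₂} → c₁ ≤ θ q (k ∸ s) → c₂ ≤ h → Few μ c₁ c₂
    few-star a b = few a b (≤-trans (≤-trans (<⇒≤ lt) h≤μ) μ≤2μ) (≤-trans h≤μ μ≤2μ)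
      (≤-trans (*-monoˡ-< h {{>-nonZero h>0}} lt) (*-mono-≤ h≤μ h≤μ))
      where
      lt : θ q (k ∸ s) < h
      lt = ≤-trans (θ-strict 1≤q (k ∸ s)) (θ-mono q (≤-reflexive (trans (sym (+-∸-assoc 1 (<⇒≤ s<k))) (cong (_∸ s) (+-comm 1 k)))))

    few-ball : ∀ {c₁ c₂} → c₁ ≤ θ q 2 → c₂ ≤ g → Few μ c₁ c₂
    few-ball a b = few a b (≤-trans θ2≤μ μ≤2μ) (≤-trans g≤μ μ≤2μ)
      (≤-trans (*-monoˡ-< g {{>-nonZero (≤-trans (s≤s z≤n) lt)}} lt) (*-mono-≤ g≤μ g≤μ))
      where
      lt : θ q 2 < g
      lt = ≤-trans (+-monoˡ-≤ (θ q 2) (≤-trans (θ≥1 q 1) (m≤m+n _ (3 * θ q 2)))) (≤-trans (≤-reflexive (+-comm (4 * θ q 2) (θ q 2))) 5θ₂≤g)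

    data Shape (P₁ P₂ : Fam) (P₁? : Decidable P₁) (P₂? : Decidable P₂) : Set where
      thin : Few μ (#cov P₁?) (#cov P₂?) → Shape P₁ P₂ P₁? P₂?
      star : ∀ T → dim T ≡ s → StarHull P₁ T → StarHull P₂ T → #cov P₁? ≤ h → #cov P₂? ≤ h → Shape P₁ P₂ P₁? P₂?
      ball : ∀ Z → dim Z ≡ 2 + s → (∀ i → P₁ i → Ball Z i) → (∀ i → P₂ i → Ball Z i) →
             #cov P₁? ≤ g → #cov P₂? ≤ g → Shape P₁ P₂ P₁? P₂?

    -- Either `P₂` has two covers, and (h + g) · 2 θ q 2 loses against μ² because 4 θ q 2 < g; or it
    -- has one, and θ q (s + 1) · h < g · h.
    one-skew : (P₁? : Decidable P₁) (P₂? : Decidable P₂) → Spread P₁ → CrossCov P₁ P₂ → CrossCov P₂ P₁ →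
      ∃ (CoverAt P₂) → Skew P₁ → Pairwise P₂ → Few μ (#cov P₁?) (#cov P₂?)
    one-skew P₁? P₂? sp cr cr′ (j₀ , c₀) sk pw with Fin.any? (λ j → cov? P₂? j ×-dec ¬? (j Fin.≟ j₀))
    ... | yes (j₁ , c₁ , ne) = few-mixed (two-covers-bound P₁? sp cr′ pw j₀ j₁ c₀ c₁ ne)
                                         (skew-pairwise-bound P₂? cr sk pw (j₀ , c₀))
    ... | no none = few-single (one-cover-bound P₁? sp cr′ j₀ c₀) (#-≤1 (cov? P₂?) λ i j ci cj → trans (only i ci) (sym (only j cj)))
      where
      only : ∀ j → CoverAt _ j → j ≡ j₀
      only j c with j Fin.≟ j₀
      ... | yes e = e
      ... | no ne = ⊥-elim (none (j , c , ne))

    -- A skew pair on either side makes the covers few. Otherwise the union of both families of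
    -- covers is pairwise s-intersecting, so `star-or-ball` gives one `T` or one `Z` for both.
    shape : (P₁? : Decidable P₁) (P₂? : Decidable P₂) → Spread P₁ → Spread P₂ → CrossCov P₁ P₂ →
      ∃ (CoverAt P₁) → ∃ (CoverAt P₂) → Shape P₁ P₂ P₁? P₂?
    shape {P₁} {P₂} P₁? P₂? sp₁ sp₂ cr e₁ e₂ with pairwise? P₁? | pairwise? P₂?
    ... | inj₂ sk₁ | inj₂ sk₂ = thin (few-skew (skew-bound P₁? (λ i j ci cj → ≤-trans (cr j i cj ci) (≤-reflexive (dim-∩-comm _ _))) sk₂) (skew-bound P₂? cr sk₁))
    ... | inj₂ sk₁ | inj₁ pw₂ = thin (one-skew P₁? P₂? sp₁ cr (λ i j ci cj → ≤-trans (cr j i cj ci) (≤-reflexive (dim-∩-comm _ _))) e₂ sk₁ pw₂)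
    ... | inj₁ pw₁ | inj₂ sk₂ = thin (few-sym {μ} {#cov P₂?} {#cov P₁?} (one-skew P₂? P₁? sp₂ (λ i j ci cj → ≤-trans (cr j i cj ci) (≤-reflexive (dim-∩-comm _ _))) cr e₁ sk₂ pw₁))
    ... | inj₁ pw₁ | inj₁ pw₂ with star-or-ball (λ j → cov? P₁? j ⊎-dec cov? P₂? j) (proj₁ e₁ , inj₁ (proj₂ e₁)) union
      where
      union : ∀ i j → CoverAt P₁ i ⊎ CoverAt P₂ i → CoverAt P₁ j ⊎ CoverAt P₂ j → s ≤ dim (sub (suc s) i ∩ sub (suc s) j)
      union i j (inj₁ a) (inj₁ b) = pw₁ i j a b
      union i j (inj₁ a) (inj₂ b) = ≤-trans (cr i j a b) (≤-reflexive (dim-∩-comm _ _))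
      union i j (inj₂ a) (inj₁ b) = cr j i b a
      union i j (inj₂ a) (inj₂ b) = pw₂ i j a b
    ... | inj₁ (T , dT , all) = conclude (star-dichotomy P₁? sp₁ T dT e₁ (λ j c → all j (inj₁ c)))
                                         (star-dichotomy P₂? sp₂ T dT e₂ (λ j c → all j (inj₂ c)))
      where
      bound : ∀ {P} (P? : Decidable P) → Spread P → (∀ j → CoverAt P j → T ⊆ sub (suc s) j) → #cov P? ≤ h
      bound P? sp f = ≤-trans (#-mono (cov? P?) (λ j → cov? P? j ×-dec (T ⊆? sub (suc s) j)) (λ j c → c , f j c)) (pencil-covers P? sp dT)
      b₁ = bound P₁? sp₁ (λ j c → all j (inj₁ c))
      b₂ = bound P₂? sp₂ (λ j c → all j (inj₂ c))
      conclude : #cov P₁? ≤ θ q (k ∸ s) ⊎ StarHull P₁ T → #cov P₂? ≤ θ q (k ∸ s) ⊎ StarHull P₂ T → Shape P₁ P₂ P₁? P₂?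
      conclude (inj₁ a)  _         = thin (few-star a b₂)
      conclude (inj₂ _)  (inj₁ b)  = thin (few-sym {μ} {#cov P₂?} {#cov P₁?} (few-star b b₁))
      conclude (inj₂ H₁) (inj₂ H₂) = star T dT H₁ H₂ b₁ b₂
    ... | inj₂ (Z , dZ , all) = conclude (ball-dichotomy P₁? Z dZ e₁ (λ j c → all j (inj₁ c)))
                                         (ball-dichotomy P₂? Z dZ e₂ (λ j c → all j (inj₂ c)))
      where
      bound : ∀ {P} (P? : Decidable P) → (∀ j → CoverAt P j → sub (suc s) j ⊆ Z) → #cov P? ≤ g
      bound P? f = ≤-trans (#-mono (cov? P?) (between? (suc s) ⊥ˢ ⊥ˢ Z) (λ j c → ⊥-⊆ , ∩-⊆ʳ (sub (suc s) j) ⊥ˢ , f j c)) (≤-reflexive (interval-ball dZ))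
      b₁ = bound P₁? (λ j c → all j (inj₁ c))
      b₂ = bound P₂? (λ j c → all j (inj₂ c))
      conclude : #cov P₁? ≤ θ q 2 ⊎ (∀ i → P₁ i → Ball Z i) → #cov P₂? ≤ θ q 2 ⊎ (∀ i → P₂ i → Ball Z i) → Shape P₁ P₂ P₁? P₂?
      conclude (inj₁ a)  _         = thin (few-ball a b₂)
      conclude (inj₂ _)  (inj₁ b)  = thin (few-sym {μ} {#cov P₂?} {#cov P₁?} (few-ball b b₁))
      conclude (inj₂ A₁) (inj₂ A₂) = ball Z dZ A₁ A₂ b₁ b₂

-- The theorem on two cross s-intersecting families

least : {P : ℕ → Set} → Decidable P → ∀ b → P b → ∃ λ a → P a × a ≤ b × (∀ c → c < a → ¬ P c)
least {P} P? b pb = go (suc b) b ≤-refl pb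
  where
  go : ∀ fuel c → c < fuel → P c → ∃ λ a → P a × a ≤ c × (∀ d → d < a → ¬ P d)
  go (suc fuel) c lt pc with anyUpTo? P? c
  ... | no none = c , pc , ≤-refl , λ d d<c pd → none (d , d<c , pd)
  ... | yes (d , d<c , pd) with go fuel d (≤-trans d<c (s≤s⁻¹ lt)) pd
  ... | a , pa , le , min = a , pa , ≤-trans le (<⇒≤ d<c) , min

module PairTheorem (G : Geometry) (k s : ℕ) (2≤s : 2 ≤ s) (s<k : s < k) (big : 4 * k + 6 ≤ Geometry.n G) where
  open CoverShapes G k s 2≤s s<k big public

  private variable
    P P₁ P₂ : Fin (num k) → Set

  abstract
    2k+6+k≤n : 2 * k + 6 + k ≤ n
    2k+6+k≤n = ≤-trans (≤-trans (≤-reflexive (lem k)) (m≤m+n _ k)) (≤-trans (≤-reflexive (lem′ k)) big)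
      where
      lem : ∀ k → 2 * k + 6 + k ≡ 3 * k + 6
      lem = solve-∀
      lem′ : ∀ k → 3 * k + 6 + k ≡ 4 * k + 6
      lem′ = solve-∀

  -- Closedness puts every k-space containing a cover of one family into the other. For covers C and
  -- D, a k-space F through C with F ∩ D ⊆ C, and then F′ through D with F′ ∩ F ⊆ D, give F ∩ F′ ⊆ C
  -- ∩ D.
  closed-cross-cov : (∀ i → Cover P₂ (sub k i) → P₁ i) → (∀ i → Cover P₁ (sub k i) → P₂ i) → Cross P₁ P₂ → CrossCov P₁ P₂
  closed-cross-cov {P₂} {P₁} cl₁ cl₂ cr i j ci cj
    with generic {sub (suc s) i} {sub (suc s) j} (≤-trans (≤-reflexive (dim-C i)) s<k)
           (≤-trans (+-monoˡ-≤ k (≤-trans (≤-reflexive (dim-C j)) (≤-trans s<k (≤-trans (m≤m+n k (k + 0)) (m≤m+n (2 * k) 6))))) 2k+6+k≤n)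
  ... | f , C⊆F , av with generic {sub (suc s) j} {sub k f} (≤-trans (≤-reflexive (dim-C j)) s<k)
           (≤-trans (+-monoˡ-≤ k (≤-trans (≤-reflexive (dim-sub f)) (≤-trans (m≤m+n k (k + 0)) (m≤m+n (2 * k) 6)))) 2k+6+k≤n)
  ... | f′ , D⊆F′ , av′ = ≤-trans (cr f′ f p₁ p₂) (dim-mono (∩-least av′
          (⊆-trans (∩-least (∩-⊆ʳ (sub k f′) (sub k f)) av′) av)))
    where
    p₂ : P₂ f
    p₂ = cl₂ f λ l pl → ≤-trans (ci l pl) (dim-mono (∩-mono {sub k l} ⊆-refl C⊆F))
    p₁ : P₁ f′
    p₁ = cl₁ f′ λ l pl → ≤-trans (cj l pl) (dim-mono (∩-mono {sub k l} ⊆-refl D⊆F′))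

  record Pair (P₁ P₂ : Fam) : Set where
    field
      P₁?   : Decidable P₁
      P₂?   : Decidable P₂
      cross : Cross P₁ P₂
      sp₁   : Spread P₁
      sp₂   : Spread P₂

    product : ℕ
    product = # P₁? * # P₂?

    cross′ : Cross P₂ P₁
    cross′ i j p₂ p₁ = ≤-trans (cross j i p₁ p₂) (≤-reflexive (dim-∩-comm _ _))

  module _ (μ L : ℕ) (g≤μ : g ≤ μ) (h≤μ : h ≤ μ) (μ≤ : μ ≤ q ^ suc k)
           (lower : μ * K * N (suc s) ≤ L * K + N (suc s)) where
    open Threshold μ L g≤μ h≤μ μ≤ lower
    open Leading μ g≤μ h≤μ μ≤

    few-small : (pr : Pair P₁ P₂) → ∃ (CoverAt P₁) → ∃ (CoverAt P₂) →
      Few μ (#cov (Pair.P₁? pr)) (#cov (Pair.P₂? pr)) → Pair.product pr < L * L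
    few-small pr (j₁ , c₁) (j₂ , c₂) (a , b) = few-covers-small {# P₁?} {# P₂?} {#cov P₁?} {#cov P₂?}
        (size-by-cov P₁? P₂? sp₁ sp₂ cross′ j₁ c₁) (size-by-cov P₂? P₁? sp₂ sp₁ cross j₂ c₂) a b
      where open Pair pr

    private
      HasCover : Fam → ℕ → Set
      HasCover P d = ∃ λ (j : Fin (num d)) → Cover P (sub d j)

      least-cover : (P? : Decidable P) → Spread P → ∀ i → Cover P (sub k i) →
        ∃ λ b → (∃ λ W → Cover P W × dim W ≡ s + suc b) × (∀ C → dim C < s + suc b → ¬ Cover P C) × s + suc b ≤ k
      least-cover {P} P? sp i c with least {HasCover P} (λ d → Fin.any? (λ j → cover? P? (sub d j))) k (i , c)
      ... | a , (j , cj) , a≤k , min = a ∸ suc s , (sub a j , cj , trans (dim-sub j) (sym a≡))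
            , (λ C lt cC → none C (≤-trans lt (≤-reflexive a≡)) cC) , ≤-trans (≤-reflexive a≡) a≤k
        where
        a≡ : s + suc (a ∸ suc s) ≡ a
        a≡ = trans (+-suc s _) (m+[n∸m]≡n (≤-trans (Cover-dim sp cj) (≤-reflexive (dim-sub j))))
        none : ∀ C → dim C < a → ¬ Cover P C
        none C lt cC with sub-surj C
        ... | l , f , _ = min (dim C) lt (l , λ m pm → ≤-trans (cC m pm) (dim-mono (∩-mono {sub k m} ⊆-refl f)))

    -- The structured cases carry a conditional bound: if the coefficient of the shape is below μ,
    -- the pair already loses by leading terms. The two ranges of k use this with different μ.
    data Outcome (P₁ P₂ : Fam) (x : ℕ) : Set where
      small : x < L * L → Outcome P₁ P₂ x
      star  : ∀ T → dim T ≡ s → StarHull P₁ T → StarHull P₂ T → (h < μ → x < L * L) → Outcome P₁ P₂ x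
      ball  : ∀ Z → dim Z ≡ 2 + s → (∀ i → P₁ i → Ball Z i) → (∀ i → P₂ i → Ball Z i) → (g < μ → x < L * L) → Outcome P₁ P₂ x

    -- If both least covers have dimension s + 1, `shape` decides; a larger one on either side makes
    -- the product small by `product-by-covers`.
    closed-outcome : (pr : Pair P₁ P₂) → (∀ i → Cover P₂ (sub k i) → P₁ i) → (∀ i → Cover P₁ (sub k i) → P₂ i) →
      Outcome P₁ P₂ (Pair.product pr)
    closed-outcome {P₁} {P₂} pr cl₁ cl₂ = go (least-cover P₁? sp₁ (proj₁ m₂) (λ i p → cross i _ p (proj₂ m₂)))
                                  (least-cover P₂? sp₂ (proj₁ m₁) (λ i p → cross′ i _ p (proj₂ m₁)))
      where
      open Pair pr
      member : Spread P → ∃ P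
      member sp with sp (std s) (dim-std (≤-trans (≤-trans (n≤1+n s) (n≤1+n _)) 2+s≤n))
      ... | i , p , _ = i , p
      m₁ = member sp₁
      m₂ = member sp₂
      LC : Fam → Set
      LC P = ∃ λ b → (∃ λ W → Cover P W × dim W ≡ s + suc b) × (∀ C → dim C < s + suc b → ¬ Cover P C) × s + suc b ≤ k
      big-case : ∀ b₁ b₂ → 1 ≤ b₁ + b₂ →
        (∃ λ W → Cover P₁ W × dim W ≡ s + suc b₁) × (∀ C → dim C < s + suc b₁ → ¬ Cover P₁ C) × s + suc b₁ ≤ k →
        (∃ λ W → Cover P₂ W × dim W ≡ s + suc b₂) × (∀ C → dim C < s + suc b₂ → ¬ Cover P₂ C) × s + suc b₂ ≤ k →
        Outcome P₁ P₂ product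
      big-case b₁ b₂ b ((W₁ , c₁ , d₁) , no₁ , le₁) ((W₂ , c₂ , d₂) , no₂ , le₂) =
        small (no-cover-small {# P₁?} {# P₂?} (product-by-covers {# P₁?} {# P₂?} b₁ b₂ b
          (size-by-covers P₁? P₂? cross′ b₁ b₂ c₁ d₁ no₂ (≤-trans le₂ k≤n))
          (size-by-covers P₂? P₁? cross b₂ b₁ c₂ d₂ no₁ (≤-trans le₁ k≤n))))
      index : ∀ {P} W → Cover P W → dim W ≡ s + 1 → ∃ (CoverAt P)
      index W c d with sub-index W (trans d (+-comm s 1))
      ... | j , f , _ = j , λ l p → ≤-trans (c l p) (dim-mono (∩-mono {sub k l} ⊆-refl f))
      go : LC P₁ → LC P₂ → Outcome P₁ P₂ product
      go (zero , (W₁ , c₁ , d₁) , _) (zero , (W₂ , c₂ , d₂) , _) =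
          from (shape P₁? P₂? sp₁ sp₂ (closed-cross-cov cl₁ cl₂ cross) e₁ e₂)
        where
        e₁ = index W₁ c₁ d₁
        e₂ = index W₂ c₂ d₂
        double : ∀ {x} → x ≤ μ → x ≤ 2 * μ
        double le = ≤-trans le μ≤2μ
        from : Shape P₁ P₂ P₁? P₂? → Outcome P₁ P₂ product
        from (thin f) = small (few-small pr e₁ e₂ f)
        from (star T dT H₁ H₂ b₁ b₂) = star T dT H₁ H₂ λ lt →
          few-small pr e₁ e₂ (few b₁ b₂ (double h≤μ) (double h≤μ) (*-mono-< lt lt))
        from (ball Z dZ A₁ A₂ b₁ b₂) = ball Z dZ A₁ A₂ λ lt →
          few-small pr e₁ e₂ (few b₁ b₂ (double g≤μ) (double g≤μ) (*-mono-< lt lt))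
      go (zero  , l₁) (suc b , l₂) = big-case zero (suc b) (s≤s z≤n) l₁ l₂
      go (suc b , l₁) (b₂    , l₂) = big-case (suc b) b₂ (s≤s z≤n) l₁ l₂

  -- Replacing P₁ by all subspaces compatible with P₂, and then P₂ likewise,
  -- enlarges both families and makes each determine the other.
  module Closure (pr : Pair P₁ P₂) where
    open Pair pr
    P₁ᶜ P₂ᶜ : Fam
    P₁ᶜ i = Cover P₂ (sub k i)
    P₂ᶜ i = Cover P₁ᶜ (sub k i)

    P₁⊆ : ∀ i → P₁ i → P₁ᶜ i
    P₁⊆ i p j p′ = cross′ j i p′ p

    P₂⊆ : ∀ i → P₂ i → P₂ᶜ i
    P₂⊆ i p j c = ≤-trans (c i p) (≤-reflexive (dim-∩-comm _ _))

    closed-pair : Pair P₁ᶜ P₂ᶜ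
    closed-pair = record
      { P₁? = λ i → cover? P₂? (sub k i)
      ; P₂? = λ i → cover? (λ j → cover? P₂? (sub k j)) (sub k i)
      ; cross = λ i j c c′ → c′ i c
      ; sp₁ = λ U dU → let (i , p , nf) = sp₁ U dU in i , P₁⊆ i p , nf
      ; sp₂ = λ U dU → let (i , p , nf) = sp₂ U dU in i , P₂⊆ i p , nf
      }

    product≤ : product ≤ Pair.product closed-pair
    product≤ = *-mono-≤ (#-mono P₁? (Pair.P₁? closed-pair) P₁⊆) (#-mono P₂? (Pair.P₂? closed-pair) P₂⊆)

    closed₁ : ∀ i → Cover P₂ᶜ (sub k i) → P₁ᶜ i
    closed₁ i c j p = c j (P₂⊆ j p)

  -- The (k+1)-spaces cross over: members of `P₁` not containing `T` lie in `M₁`, and it is the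
  -- members of `P₂` through `T` that must meet `M₁` in more than `T`.
  record HMPair (P₁ P₂ : Fam) : Set where
    field
      T M₁ M₂ : Sp
      dim-T   : dim T ≡ s
      T⊆M₁    : T ⊆ M₁
      T⊆M₂    : T ⊆ M₂
      dim-M₁  : dim M₁ ≡ suc k
      dim-M₂  : dim M₂ ≡ suc k
      P₁-hm   : ∀ i → P₁ i → HM T M₂ M₁ i
      P₂-hm   : ∀ i → P₂ i → HM T M₁ M₂ i

  hm-restrict : {Q₁ Q₂ : Fam} → (∀ i → Q₁ i → P₁ i) → (∀ i → Q₂ i → P₂ i) → HMPair P₁ P₂ → HMPair Q₁ Q₂
  hm-restrict f g H = record
    { T = T ; M₁ = M₁ ; M₂ = M₂ ; dim-T = dim-T ; T⊆M₁ = T⊆M₁ ; T⊆M₂ = T⊆M₂ ; dim-M₁ = dim-M₁ ; dim-M₂ = dim-M₂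
    ; P₁-hm = λ i p → P₁-hm i (f i p) ; P₂-hm = λ i p → P₂-hm i (g i p) }
    where open HMPair H

  hulls-hm : ∀ {T} → dim T ≡ s → (pr : Pair P₁ P₂) → StarHull P₁ T → StarHull P₂ T → HMPair P₁ P₂
  hulls-hm {T = T} dT pr H₁ H₂ = record
    { T = T ; M₁ = StarHull.M H₁ ; M₂ = StarHull.M H₂ ; dim-T = dT
    ; T⊆M₁ = StarHull.T⊆M H₁ ; T⊆M₂ = StarHull.T⊆M H₂ ; dim-M₁ = StarHull.dim-M H₁ ; dim-M₂ = StarHull.dim-M H₂
    ; P₁-hm = star-hm dT (Pair.cross pr) H₁ H₂ ; P₂-hm = star-hm dT (Pair.cross′ pr) H₂ H₁ }

  -- Here s + 2 < k + 1 - s, hence g < h; with μ = h the ball shape loses by its leading term.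
  pair-theorem-large : 2 * s + 2 ≤ k → (pr : Pair P₁ P₂) → ∀ {T M} → T ⊆ M → dim T ≡ s → dim M ≡ suc k →
    let L = # (hm? T M M) in Pair.product pr < L * L ⊎ HMPair P₁ P₂
  pair-theorem-large {P₁} {P₂} k≥ pr {T₀} {M₀} T⊆M dT dM = from (closed-outcome h L (<⇒≤ g<h) ≤-refl h≤ (hm-lower T⊆M dT dM) closed-pair closed₁ (λ i → id))
    where
    open Closure pr
    L = # (hm? T₀ M₀ M₀)
    g<h : g < h
    g<h = ≤-trans (θ-strict 1≤q (2 + s)) (θ-mono q (m+n≤o⇒m≤o∸n (3 + s) (≤-trans (≤-reflexive (lem s)) (+-monoˡ-≤ 1 k≥))))
      where
      lem : ∀ s → 3 + s + s ≡ 2 * s + 2 + 1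
      lem = solve-∀
    from : Outcome h L (<⇒≤ g<h) ≤-refl h≤ (hm-lower T⊆M dT dM) P₁ᶜ P₂ᶜ (Pair.product closed-pair) → Pair.product pr < L * L ⊎ HMPair P₁ P₂
    from (small lt) = inj₁ (≤-trans (s≤s product≤) lt)
    from (ball _ _ _ _ lt) = inj₁ (≤-trans (s≤s product≤) (lt g<h))
    from (star _ dT H₁ H₂ _) = inj₂ (hm-restrict P₁⊆ P₂⊆ (hulls-hm dT closed-pair H₁ H₂))

  -- Now g = h, so the terms in N₂ decide. The ball falls short of g N₁ by q t N₂, where t = θ q (s
  -- + 1). The star falls short by at least q for each of its D members meeting `M` in s + 2 or more
  -- dimensions, and q D is at least (5/2) q t N₂; the rest adds at most N₂.
  hm<ball : k ≡ 2 * s + 1 → ∀ {T M M′ Z} → T ⊆ M → T ⊆ M′ → dim T ≡ s → dim M ≡ suc k → dim M′ ≡ suc k → dim Z ≡ 2 + s →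
    # (hm? T M M′) < # (ball? Z)
  hm<ball k≡ {T} {M} {M′} {Z} T⊆M T⊆M′ dT dM dM′ dZ = *-cancelˡ-< 2 _ _ (+-cancelʳ-< (2 * (q * t * N₂)) _ _ (begin-strict
      2 * # (hm? T M M′) + 2 * (q * t * N₂)           ≡⟨ cong (λ z → 2 * z + 2 * (q * t * N₂)) (hm-size {T} {M} {M′}) ⟩
      2 * (H + R) + 2 * (q * t * N₂)                  ≤⟨ +-monoˡ-≤ (2 * (q * t * N₂)) (*-monoʳ-≤ 2 (+-monoʳ-≤ H R≤N₂)) ⟩
      2 * (H + N₂) + 2 * (q * t * N₂)                 <⟨ m<m+n _ N₂>0 ⟩
      2 * (H + N₂) + 2 * (q * t * N₂) + N₂            ≡⟨ lem₁ H N₂ (q * t) ⟩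
      2 * H + 2 * (q * t * N₂) + 3 * (1 * N₂)         ≤⟨ +-monoʳ-≤ (2 * H + 2 * (q * t * N₂)) (*-monoʳ-≤ 3 (*-monoˡ-≤ N₂ (*-mono-≤ 1≤q (θ≥1 q s)))) ⟩
      2 * H + 2 * (q * t * N₂) + 3 * (q * t * N₂)     ≡⟨ lem₂ H (q * t) N₂ ⟩
      2 * H + 5 * (q * t) * N₂                        ≤⟨ +-monoʳ-≤ (2 * H) (*-monoʳ-≤ (5 * (q * t)) N₂≤2c) ⟩
      2 * H + 5 * (q * t) * (2 * c)                   ≡⟨ lem₃ H q t c ⟩
      2 * (H + 5 * t * c * q)                         ≤⟨ *-monoʳ-≤ 2 (+-monoʳ-≤ H (*-monoˡ-≤ q (≤-trans (*-monoˡ-≤ c l≥5t) D≥))) ⟩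
      2 * (H + D * q)                                 ≤⟨ *-monoʳ-≤ 2 weighted ⟩
      2 * (g * N₁)                                    ≡⟨ cong (2 *_) (sym exact) ⟩
      2 * (# (ball? Z) + q * t * N₂)                  ≡⟨ *-distribˡ-+ 2 (# (ball? Z)) _ ⟩
      2 * # (ball? Z) + 2 * (q * t * N₂)              ∎))
    where
    open ≤-Reasoning
    t = θ q (suc s)
    N₁ = N (suc s)
    N₂ = N (2 + s)
    N₃ = N (3 + s)
    H = # (star? T M)
    R = # (rest? T M′)
    deep? = λ i → (T ⊆? sub k i) ×-dec (2 + s ≤? dim (sub k i ∩ M))
    D = # deep?
    w = q ^ suc k * N₃
    -- A lower bound for the number of k-spaces meeting `M` exactly in a given (s+2)-space; by
    -- `N₂≤2c` it is at least half of N₂.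
    c = N₂ ∸ w
    lem₁ : ∀ H n x → 2 * (H + n) + 2 * (x * n) + n ≡ 2 * H + 2 * (x * n) + 3 * (1 * n)
    lem₁ = solve-∀
    lem₂ : ∀ H x n → 2 * H + 2 * (x * n) + 3 * (x * n) ≡ 2 * H + 5 * x * n
    lem₂ = solve-∀
    lem₃ : ∀ H q t c → 2 * H + 5 * (q * t) * (2 * c) ≡ 2 * (H + 5 * t * c * q)
    lem₃ = solve-∀
    3+s≤k : 3 + s ≤ k
    3+s≤k = ≤-trans (+-monoˡ-≤ s {3} {s + 1} (+-monoˡ-≤ 1 2≤s)) (≤-reflexive (trans (lem s) (sym k≡)))
      where
      lem : ∀ s → s + 1 + s ≡ 2 * s + 1
      lem = solve-∀
    N₂>0 : 1 ≤ N₂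
    N₂>0 = N-pos (≤-trans (n≤1+n _) 3+s≤k)
    tail : N₃ * q ^ (3 * k + 6) ≤ N₂
    tail = N-tail (≤-trans 3+s≤k k≤n)
    pow : 2 * q ^ suc k ≤ q ^ (3 * k + 6)
    pow = ≤-trans (*-monoˡ-≤ (q ^ suc k) 2≤q) (q^-mono (≤-trans (m≤m+n (2 + k) (2 * k + 4)) (≤-reflexive (lem k))))
      where
      lem : ∀ k → 2 + k + (2 * k + 4) ≡ 3 * k + 6
      lem = solve-∀
    R≤N₂ : R ≤ N₂
    R≤N₂ = begin
      R                                        ≤⟨ #-mono (rest? T M′) (between? k ⊥ˢ ⊥ˢ M′) (λ i p → ⊥-⊆ , ∩-⊆ʳ (sub k i) ⊥ˢ , proj₁ p) ⟩
      interval k ⊥ˢ M′                         ≡⟨ hyperplanes-size k ⊥-⊆ (cong (_+ k) dim-⊥) dM′ ⟩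
      θ q (suc k)                              ≤⟨ <⇒≤ (θ<^ 2≤q (suc k)) ⟩
      q ^ suc k                                ≤⟨ m≤n*m _ 2 ⟩
      2 * q ^ suc k                            ≤⟨ pow ⟩
      q ^ (3 * k + 6)                          ≤⟨ m≤n*m _ N₃ {{>-nonZero (N-pos 3+s≤k)}} ⟩
      N₃ * q ^ (3 * k + 6)                     ≤⟨ tail ⟩
      N₂                                       ∎
    N₂≤2c : N₂ ≤ 2 * c
    N₂≤2c = +-cancelʳ-≤ N₂ _ _ (begin
      N₂ + N₂                                  ≡⟨ cong (N₂ +_) (sym (+-identityʳ N₂)) ⟩
      2 * N₂                                   ≤⟨ *-monoʳ-≤ 2 (m≤n+m∸n N₂ w) ⟩
      2 * (w + c)                              ≡⟨ lem (q ^ suc k) N₃ c ⟩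
      2 * c + N₃ * (2 * q ^ suc k)             ≤⟨ +-monoʳ-≤ (2 * c) (≤-trans (*-monoʳ-≤ N₃ pow) tail) ⟩
      2 * c + N₂                               ∎)
      where
      lem : ∀ a n c → 2 * (a * n + c) ≡ 2 * c + n * (2 * a)
      lem = solve-∀
    M∸s : dim M ∸ s ≡ 2 + s
    M∸s = trans (cong (_∸ s) (trans dM (trans (cong suc k≡) (lem s)))) (m+n∸n≡m (2 + s) s)
      where
      lem : ∀ s → suc (2 * s + 1) ≡ 2 + s + s
      lem = solve-∀
    M∸1+s : dim M ∸ suc s ≡ suc s
    M∸1+s = trans (cong (_∸ suc s) (trans dM (trans (cong suc k≡) (lem s)))) (m+n∸n≡m (suc s) (suc s))
      where
      lem : ∀ s → suc (2 * s + 1) ≡ suc s + suc s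
      lem = solve-∀
    l≥5t : 5 * t ≤ interval (2 + s) T M
    l≥5t = *-cancelʳ-≤ _ _ (θ q 2) (begin
      5 * t * θ q 2                            ≡⟨ lem t (θ q 2) ⟩
      5 * θ q 2 * t                            ≤⟨ *-monoˡ-≤ t 5θ₂≤g ⟩
      g * t                                    ≡⟨ cong₂ (λ a b → θ q a * θ q b) (sym M∸s) (sym M∸1+s) ⟩
      θ q (dim M ∸ s) * θ q (dim M ∸ suc s)    ≡⟨ sym (colines-size T⊆M dT (≤-trans (s≤s (≤-trans (≤-reflexive dT) (<⇒≤ s<k))) (≤-reflexive (sym dM)))) ⟩
      interval (2 + s) T M * θ q 2             ∎)
      where
      lem : ∀ t x → 5 * t * x ≡ 5 * x * t
      lem = solve-∀
    D≥ : interval (2 + s) T M * c ≤ D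
    D≥ = slices deep? c (λ i j a b p → ⊆-trans a (proj₁ p) , between-dim p b) λ j _ f → m≤n+o⇒m∸n≤o N₂ w (begin
      N₂                                               ≡⟨ sym (above-N (dim-sub j)) ⟩
      above k (sub (2 + s) j)                          ≤⟨ above≤E+ f (dim-sub j) ⟩
      E k (sub (2 + s) j) M ⊤ˢ + q ^ dim M * N₃        ≡⟨ cong (λ z → E k (sub (2 + s) j) M ⊤ˢ + q ^ z * N₃) dM ⟩
      E k (sub (2 + s) j) M ⊤ˢ + w                     ≡⟨ +-comm _ w ⟩
      w + E k (sub (2 + s) j) M ⊤ˢ                     ∎)
    exact : # (ball? Z) + q * t * N₂ ≡ g * N₁
    exact = +-cancelʳ-≡ N₂ _ _ (trans (lem (# (ball? Z)) (q * t) N₂) (ball-size dZ))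
      where
      lem : ∀ b x n → b + x * n + n ≡ b + suc x * n
      lem = solve-∀
    -- each F in the star contains θ q (dim (F ∩ M) ∸ s) members of the pencil of T in M
    weighted : H + D * q ≤ g * N₁
    weighted = begin
      H + D * q                                              ≡⟨ cong (H +_) (sym (∑-* (num k) _ q)) ⟩
      H + ∑ (num k) (λ i → ⟦ deep? i ⟧ * q)                  ≡⟨ sym (∑-+ (num k) _ _) ⟩
      ∑ (num k) (λ i → ⟦ star? T M i ⟧ + ⟦ deep? i ⟧ * q)    ≤⟨ ∑-mono (num k) (λ i → row i (star? T M i) (deep? i)) ⟩
      ∑ (num k) (λ i → ⟦ star? T M i ⟧ * # (R? i))           ≤⟨ weighted-count-≤ (star? T M) (between? (suc s) T T M) R? N₁
                                                                 (λ j p → ≤-trans (#-mono _ (between? k (sub (suc s) j) (sub (suc s) j) ⊤ˢ)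
                                                                    (λ i r → ⊆-trans (proj₂ (proj₂ (proj₂ r))) (∩-⊆ˡ (sub k i) M) , ∩-⊆ʳ (sub k i) (sub (suc s) j) , ⊆-⊤))
                                                                    (≤-reflexive (above-N (dim-sub j))))
                                                                 (λ i j _ r → proj₁ r , proj₁ (proj₂ r) , ⊆-trans (proj₂ (proj₂ r)) (∩-⊆ʳ (sub k i) M)) ⟩
      interval (suc s) T M * N₁                              ≡⟨ cong (_* N₁) (trans (pencil-size T⊆M dT) (cong (θ q) M∸s)) ⟩
      g * N₁                                                 ∎
      where
      R? = λ i j → between? (suc s) T T (sub k i ∩ M) j
      row : ∀ i (a : Dec (Star T M i)) (b : Dec (T ⊆ sub k i × 2 + s ≤ dim (sub k i ∩ M))) → ⟦ a ⟧ + ⟦ b ⟧ * q ≤ ⟦ a ⟧ * # (R? i)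
      size : ∀ i → T ⊆ sub k i → # (R? i) ≡ θ q (dim (sub k i ∩ M) ∸ s)
      size i f = pencil-size (∩-least f T⊆M) dT
      row i (no na) (yes b) = ⊥-elim (na (proj₁ b , ≤-trans (n≤1+n _) (proj₂ b)))
      row i (no na) (no _)  = z≤n
      row i (yes a) (no _)  = ≤-trans (≤-trans (θ≥1 q 0) (≤-trans (θ-mono q (m<n⇒0<n∸m (proj₂ a))) (≤-reflexive (sym (size i (proj₁ a)))))) (m≤m+n _ 0)
      row i (yes a) (yes b) = ≤-trans (≤-trans (≤-reflexive (lem q)) (≤-trans (θ-mono q (m+n≤o⇒m≤o∸n 2 (proj₂ b))) (≤-reflexive (sym (size i (proj₁ a)))))) (m≤m+n _ 0)
        where
        lem : ∀ q → 1 + 1 * q ≡ 1 + q * (1 + q * 0)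
        lem = solve-∀

  pair-theorem-small : k ≤ 2 * s + 1 → (pr : Pair P₁ P₂) → ∀ {Z₀} → dim Z₀ ≡ 2 + s →
    let L = # (ball? Z₀) in Pair.product pr < L * L ⊎ ∃ λ Z → dim Z ≡ 2 + s × (∀ i → P₁ i → Ball Z i) × (∀ i → P₂ i → Ball Z i)
  pair-theorem-small {P₁} {P₂} k≤ pr {Z₀} dZ₀ = from (closed-outcome g L ≤-refl h≤g g≤ (ball-lower dZ₀) closed-pair closed₁ (λ i → id))
    where
    open Closure pr
    L = # (ball? Z₀)
    h≤g : h ≤ g
    h≤g = θ-mono q (≤-trans (∸-monoˡ-≤ s (+-monoˡ-≤ 1 k≤)) (≤-reflexive (trans (cong (_∸ s) (lem s)) (m+n∸n≡m (2 + s) s))))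
      where
      lem : ∀ s → 2 * s + 1 + 1 ≡ 2 + s + s
      lem = solve-∀
    from : Outcome g L ≤-refl h≤g g≤ (ball-lower dZ₀) P₁ᶜ P₂ᶜ (Pair.product closed-pair) →
      Pair.product pr < L * L ⊎ ∃ λ Z → dim Z ≡ 2 + s × (∀ i → P₁ i → Ball Z i) × (∀ i → P₂ i → Ball Z i)
    from (small lt) = inj₁ (≤-trans (s≤s product≤) lt)
    from (ball Z dZ A₁ A₂ _) = inj₂ (Z , dZ , (λ i p → A₁ i (P₁⊆ i p)) , λ i p → A₂ i (P₂⊆ i p))
    from (star _ dT H₁ H₂ lt) = inj₁ (≤-trans (s≤s product≤) (starred (m≤n⇒m<n∨m≡n k≤)))
      where
      open HMPair (hulls-hm dT closed-pair H₁ H₂)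
      open Pair closed-pair using (P₁?; P₂?)
      -- Below the threshold h < g, so leading terms suffice; at the threshold `hm<ball` compares
      -- each factor separately.
      starred : k < 2 * s + 1 ⊎ k ≡ 2 * s + 1 → Pair.product closed-pair < L * L
      starred (inj₁ k<) = lt (≤-trans (s≤s (θ-mono q (≤-trans (∸-monoˡ-≤ s (≤-trans (≤-reflexive (+-comm k 1)) k<)) (≤-reflexive (trans (cong (_∸ s) (lem s)) (m+n∸n≡m (1 + s) s)))))) (θ-strict 1≤q (suc s)))
        where
        lem : ∀ s → 2 * s + 1 ≡ 1 + s + s
        lem = solve-∀
      starred (inj₂ k≡) = *-mono-< (≤-trans (s≤s (#-mono P₁? (hm? T M₂ M₁) P₁-hm)) (hm<ball k≡ T⊆M₂ T⊆M₁ dim-T dim-M₂ dim-M₁ dZ₀))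
                                   (≤-trans (s≤s (#-mono P₂? (hm? T M₁ M₂) P₂-hm)) (hm<ball k≡ T⊆M₁ T⊆M₂ dim-T dim-M₁ dim-M₂ dZ₀))

-- More than two families

module Products (L : ℕ) where

  L^ : ℕ → ℕ
  L^ r = prodFin r (λ _ → L)

  PairBound : ∀ {r} → (Fin r → ℕ) → Set
  PairBound x = ∀ i j → ¬ (i ≡ j) → x i * x j ≤ L * L

  private
    drop₂ : ∀ {r} → (Fin (2 + r) → ℕ) → Fin r → ℕ
    drop₂ x i = x (suc (suc i))

    tail₂ : ∀ {r} (x : Fin (2 + r) → ℕ) → PairBound x → PairBound (drop₂ x)
    tail₂ x pb i j ne = pb (suc (suc i)) (suc (suc j)) (λ e → ne (Fin.suc-injective (Fin.suc-injective e)))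

    square-≤ : ∀ {a b} → a * a ≤ b * b → a ≤ b
    square-≤ {a} {b} h with a ≤? b
    ... | yes le = le
    ... | no nle = ⊥-elim (<⇒≱ (*-mono-< (≰⇒> nle) (≰⇒> nle)) h)

    triple-square : ∀ a b c → a * (b * (c * 1)) * (a * (b * (c * 1))) ≡ a * b * ((a * c) * (b * c))
    triple-square = solve-∀

    L-square : ∀ l → l * (l * (l * 1)) * (l * (l * (l * 1))) ≡ l * l * ((l * l) * (l * l))
    L-square = solve-∀

  -- Factors are grouped in pairs. For an odd number three are left over, and the square of their
  -- product is the product of their three pairwise products.
  prod-≤ : ∀ r (x : Fin (2 + r) → ℕ) → PairBound x → prodFin (2 + r) x ≤ L^ (2 + r)
  prod-≤ zero x pb = ≤-trans (≤-reflexive (sym (*-assoc (x zero) (x (suc zero)) 1)))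
    (≤-trans (*-monoˡ-≤ 1 (pb zero (suc zero) λ ())) (≤-reflexive (*-assoc L L 1)))
  prod-≤ (suc zero) x pb = square-≤ (≤-trans (≤-reflexive (triple-square (x zero) (x (suc zero)) (x (suc (suc zero)))))
    (≤-trans (*-mono-≤ (pb zero (suc zero) λ ()) (*-mono-≤ (pb zero (suc (suc zero)) λ ()) (pb (suc zero) (suc (suc zero)) λ ())))
             (≤-reflexive (sym (L-square L)))))
  prod-≤ (suc (suc r)) x pb = ≤-trans (≤-reflexive (sym (*-assoc (x zero) (x (suc zero)) _)))
    (≤-trans (*-mono-≤ (pb zero (suc zero) λ ()) (prod-≤ r (drop₂ x) (tail₂ x pb))) (≤-reflexive (*-assoc L L _)))

  private
    L^>0 : 1 ≤ L → ∀ r → 1 ≤ L^ r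
    L^>0 h zero    = ≤-refl
    L^>0 h (suc r) = *-mono-≤ h (L^>0 h r)

  -- A deficit in the first pair cannot be made up elsewhere: two or more remaining factors are
  -- bounded by their power of L, and a single one is treated together with the first two by
  -- squaring.
  first-pair-≥ : 1 ≤ L → ∀ r (x : Fin (3 + r) → ℕ) → PairBound x → L^ (3 + r) ≤ prodFin (3 + r) x → L * L ≤ x zero * x (suc zero)
  first-pair-≥ L>0 zero x pb le with L * L ≤? x zero * x (suc zero)
  ... | yes h = h
  ... | no nh = ⊥-elim (<⇒≱ (begin-strict
        prodFin 3 x * prodFin 3 x                 ≡⟨ triple-square (x zero) (x (suc zero)) (x (suc (suc zero))) ⟩
        x zero * x (suc zero) * _                 ≤⟨ *-monoʳ-≤ (x zero * x (suc zero)) (*-mono-≤ (pb zero (suc (suc zero)) λ ()) (pb (suc zero) (suc (suc zero)) λ ())) ⟩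
        x zero * x (suc zero) * ((L * L) * (L * L)) <⟨ *-monoˡ-< ((L * L) * (L * L)) {{>-nonZero (*-mono-≤ (*-mono-≤ L>0 L>0) (*-mono-≤ L>0 L>0))}} (≰⇒> nh) ⟩
        L * L * ((L * L) * (L * L))               ≡⟨ sym (L-square L) ⟩
        L^ 3 * L^ 3                               ∎) (*-mono-≤ le le))
    where open ≤-Reasoning
  first-pair-≥ L>0 (suc r) x pb le = *-cancelʳ-≤ _ _ (L^ (2 + r)) {{>-nonZero (L^>0 L>0 (2 + r))}} (begin
      L * L * L^ (2 + r)                                   ≡⟨ *-assoc L L _ ⟩
      L^ (4 + r)                                           ≤⟨ le ⟩
      prodFin (4 + r) x                                    ≡⟨ sym (*-assoc (x zero) (x (suc zero)) _) ⟩
      x zero * x (suc zero) * prodFin (2 + r) (drop₂ x) ≤⟨ *-monoʳ-≤ (x zero * x (suc zero)) (prod-≤ r (drop₂ x) (tail₂ x pb)) ⟩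
      x zero * x (suc zero) * L^ (2 + r)                   ∎)
    where open ≤-Reasoning

  factors-≥ : 1 ≤ L → ∀ r (x : Fin r → ℕ) → (∀ i → x i ≤ L) → L^ r ≤ prodFin r x → ∀ i → L ≤ x i
  factors-≥ L>0 (suc r) x hi le zero = *-cancelʳ-≤ _ _ (L^ r) {{>-nonZero (L^>0 L>0 r)}}
      (≤-trans le (*-monoʳ-≤ (x zero) (upper r (x ∘ suc) (hi ∘ suc))))
    where
    upper : ∀ r (x : Fin r → ℕ) → (∀ i → x i ≤ L) → prodFin r x ≤ L^ r
    upper zero    x h = ≤-refl
    upper (suc r) x h = *-mono-≤ (h zero) (upper r (x ∘ suc) (h ∘ suc))
  factors-≥ L>0 (suc r) x hi le (suc i) = factors-≥ L>0 r (x ∘ suc) (hi ∘ suc)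
    (*-cancelˡ-≤ L {{>-nonZero L>0}} (≤-trans le (*-monoˡ-≤ _ (hi zero)))) i

module Families (G : Geometry) (k s : ℕ) (2≤s : 2 ≤ s) (s<k : s < k) (big : 4 * k + 6 ≤ Geometry.n G) where
  open PairTheorem G k s 2≤s s<k big public

  private
    abstract
      +k≤n : ∀ {x} → x ≤ 2 * k + 6 → x + k ≤ n
      +k≤n le = ≤-trans (+-monoˡ-≤ k le) 2k+6+k≤n

    abstract
      k≤2k+6 : k ≤ 2 * k + 6
      k≤2k+6 = ≤-trans (m≤m+n k (k + 0)) (m≤m+n (2 * k) 6)

  -- A k-space through `add T x` in general position belongs to the star and meets `B` only inside
  -- `add T x`, so the hypothesis descends to that space.
  star-slices : ∀ {T M} B → dim T ≡ s → T ⊆ M → dim B ≡ k → (∀ i → Star T M i → s ≤ dim (sub k i ∩ B)) →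
    ∀ x → x ∈ M → ¬ (x ∈ T) → s ≤ dim (add T x ∩ B)
  star-slices {T} {M} B dT T⊆M dB meets x x∈ x∉ = go (generic {add T x} {B} (≤-trans (≤-reflexive dX) s<k) (+k≤n (≤-trans (≤-reflexive dB) k≤2k+6)))
    where
    dX : dim (add T x) ≡ suc s
    dX = trans (dim-add x∉) (cong suc dT)
    go : (∃ λ i → add T x ⊆ sub k i × sub k i ∩ B ⊆ add T x) → s ≤ dim (add T x ∩ B)
    go (i , f , av) = ≤-trans (meets i (⊆-trans (add-⊆ T x) f , ≤-trans (≤-reflexive (sym dX)) (dim-mono (∩-least f (add-least T⊆M x∈)))))
                              (dim-mono (∩-least av (∩-⊆ʳ (sub k i) B)))

  -- As `B` does not contain `T`, each slice is spanned by `T` and its part in `B`, so M ⊆ T ∨ B. A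
  -- single slice also gives dim (T ∩ B) ≥ s - 1, which bounds dim (T ∨ B) by k + 1, and the two
  -- spaces agree.
  slices-join : ∀ {T M} B → dim T ≡ s → T ⊆ M → dim B ≡ k → dim M ≡ suc k → ¬ (T ⊆ B) →
    (∀ x → x ∈ M → ¬ (x ∈ T) → s ≤ dim (add T x ∩ B)) → B ⊆ M
  slices-join {T} {M} B dT T⊆M dB dM T⊈B slice = ⊆-trans (∨-⊆ʳ T B) (⊆-of-dim M⊆ (≤-trans
      (dim-join (⊈-witness {M} {T} (dim<⇒⊈ (≤-trans (s≤s (≤-trans (≤-reflexive dT) (<⇒≤ s<k))) (≤-reflexive (sym dM))))))
      (≤-reflexive (sym dM))))
    where
    dX : ∀ {x} → ¬ (x ∈ T) → dim (add T x) ≡ suc s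
    dX x∉ = trans (dim-add x∉) (cong suc dT)
    M⊆ : M ⊆ T ∨ B
    M⊆ x x∈ = go (x ∈? T)
      where
      X : Sp
      X = add T x
      go : Dec (x ∈ T) → x ∈ T ∨ B
      go (yes x∈T) = ∨-⊆ˡ T B x x∈T
      go (no x∉T)  = ⊆-trans (span-hyperplanes (add-⊆ T x) (∩-⊆ˡ X B) (≤-reflexive (dX x∉T)) (≤-reflexive (sym dT))
            (λ f → T⊈B (⊆-trans (⊆-of-dim f (≤-trans (≤-reflexive dT) (slice x x∈ x∉T))) (∩-⊆ʳ X B))))
          (∨-least (∨-⊆ˡ T B) (⊆-trans (∩-⊆ʳ X B) (∨-⊆ʳ T B))) x (add-∈ T x)
    dim-join : (∃ λ x → x ∈ M × ¬ (x ∈ T)) → dim (T ∨ B) ≤ suc k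
    dim-join (x , x∈ , x∉) = +-cancelˡ-≤ s (dim (T ∨ B)) (suc k) (begin
        s + dim (T ∨ B)                     ≤⟨ +-monoˡ-≤ (dim (T ∨ B)) low ⟩
        suc (dim (T ∩ B)) + dim (T ∨ B)     ≡⟨ cong suc (trans (modular T B) (cong₂ _+_ dT dB)) ⟩
        suc (s + k)                         ≡⟨ sym (+-suc s k) ⟩
        s + suc k                           ∎)
      where
      open ≤-Reasoning
      X : Sp
      X = add T x
      low : s ≤ suc (dim (T ∩ B))
      low = +-cancelʳ-≤ s s (suc (dim (T ∩ B))) (begin
        s + s                               ≤⟨ +-mono-≤ (≤-reflexive (sym dT)) (slice x x∈ x∉) ⟩
        dim T + dim (X ∩ B)                 ≤⟨ dim-sum-≤ (add-⊆ T x) (∩-⊆ˡ X B) ⟩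
        dim (T ∩ (X ∩ B)) + dim X           ≤⟨ +-mono-≤ (dim-mono (∩-mono {T} ⊆-refl (∩-⊆ʳ X B))) (≤-reflexive (dX x∉)) ⟩
        dim (T ∩ B) + suc s                 ≡⟨ +-suc (dim (T ∩ B)) s ⟩
        suc (dim (T ∩ B)) + s               ∎)

  -- The member `a` inside `M₁` forces a space through `T` to meet `M₁` in more than `T`; the star
  -- in `M₂` forces a space not through `T` into `M₂`.
  hm-dual : ∀ {T M₁ M₂} → dim T ≡ s → T ⊆ M₁ → T ⊆ M₂ → dim M₂ ≡ suc k →
    ∀ a → Rest T M₁ a → ∀ b → (∀ i → HM T M₂ M₁ i → s ≤ dim (sub k i ∩ sub k b)) → HM T M₁ M₂ b
  hm-dual {T} {M₁} {M₂} dT T⊆M₁ T⊆M₂ dM₂ a (A⊆M₁ , T⊈A) b meets = go (T ⊆? B)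
    where
    B AB : Sp
    B = sub k b
    AB = sub k a ∩ B
    go : Dec (T ⊆ B) → HM T M₁ M₂ b
    go (yes T⊆B) = inj₁ (T⊆B , ≤-trans (s≤s (≤-reflexive (sym dT))) (≤-trans
          (dim-strict (∨-⊆ˡ T AB) (λ f → T⊈A (⊆-trans (⊆-of-dim (⊆-trans (∨-⊆ʳ T AB) f)
             (≤-trans (≤-reflexive dT) (meets a (inj₂ (A⊆M₁ , T⊈A))))) (∩-⊆ˡ (sub k a) B))))
          (dim-mono (∨-least (∩-least T⊆B T⊆M₁) (∩-least (∩-⊆ʳ (sub k a) B) (⊆-trans (∩-⊆ˡ (sub k a) B) A⊆M₁))))))
    go (no T⊈B) = inj₂ (slices-join B dT T⊆M₂ (dim-sub b) dM₂ T⊈B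
          (star-slices B dT T⊆M₂ (dim-sub b) (λ i σ → meets i (inj₁ σ))) , T⊈B)

  line : Fin Q → Sp
  line x = add ⊥ˢ x

  dim-line : ∀ {x} → dim (line x) ≤ 1
  dim-line = ≤-trans dim-add-≤ (≤-reflexive (cong suc dim-⊥))

  complement-point : ∀ {x Z d} → dim Z ≡ suc d → ¬ (x ∈ ⊥ˢ) → ∃ λ X → X ⊆ Z × dim X ≡ d × ¬ (x ∈ X)
  complement-point {x} {Z} {d} dZ x∉ with extend-avoiding {⊥ˢ} {Z} {line x} d ⊥-⊆
     (≤-trans (+-monoˡ-≤ d (≤-trans (dim-mono (∨-least (add-⊆ ⊥ˢ x) ⊆-refl)) dim-line)) (≤-reflexive (sym dZ)))
  ... | X , _ , f , dX , av = X , f , trans dX (cong (_+ d) dim-⊥) , λ x∈X → x∉ (av x (∩-intro x x∈X (add-∈ ⊥ˢ x)))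

  generic-point : ∀ {U x} → dim U ≤ k → ¬ (x ∈ U) → ∃ λ i → U ⊆ sub k i × ¬ (x ∈ sub k i)
  generic-point {U} {x} dU x∉ with generic {U} {line x} dU (+k≤n (≤-trans dim-line (≤-trans (s≤s z≤n) (m≤n+m 6 (2 * k)))))
  ... | i , f , av = i , f , λ x∈ → x∉ (av x (∩-intro x x∈ (add-∈ ⊥ˢ x)))

  ball-slices : ∀ {Z} B → dim B ≡ k → (∀ i → Ball Z i → s ≤ dim (sub k i ∩ B)) →
    ∀ X → X ⊆ Z → dim X ≡ suc s → s ≤ dim (X ∩ B)
  ball-slices {Z} B dB meets X X⊆Z dX = go (generic {X} {B} (≤-trans (≤-reflexive dX) s<k) (+k≤n (≤-trans (≤-reflexive dB) k≤2k+6)))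
    where
    go : (∃ λ i → X ⊆ sub k i × sub k i ∩ B ⊆ X) → s ≤ dim (X ∩ B)
    go (i , f , av) = ≤-trans (meets i (≤-trans (≤-reflexive (sym dX)) (dim-mono (∩-least f X⊆Z)))) (dim-mono (∩-least av (∩-⊆ʳ (sub k i) B)))

  -- B ∩ Z contains a nonzero vector v, since its dimension is at least s. A hyperplane of `Z`
  -- missing v still meets `B` in s dimensions, and v adds one more.
  slices-ball : ∀ {Z} B → dim Z ≡ 2 + s → (∀ X → X ⊆ Z → dim X ≡ suc s → s ≤ dim (X ∩ B)) → suc s ≤ dim (B ∩ Z)
  slices-ball {Z} B dZ slice = go (interpolate {⊥ˢ} {Z} (suc s) ⊥-⊆ (≤-trans (≤-reflexive dim-⊥) z≤n) (≤-trans (n≤1+n _) (≤-reflexive (sym dZ))))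
    where
    point : s ≤ dim (B ∩ Z) → (∃ λ v → v ∈ B ∩ Z × ¬ (v ∈ ⊥ˢ)) → suc s ≤ dim (B ∩ Z)
    point _ (v , v∈ , v∉) = hyper (complement-point dZ v∉)
      where
      hyper : (∃ λ X → X ⊆ Z × dim X ≡ suc s × ¬ (v ∈ X)) → suc s ≤ dim (B ∩ Z)
      hyper (X , f , dX , v∉X) = ≤-trans (s≤s (slice X f dX)) (dim-strict (∩-least (∩-⊆ʳ X B) (⊆-trans (∩-⊆ˡ X B) f))
            (λ h → v∉X (∩-⊆ˡ X B v (h v v∈))))
    go : (∃ λ X → ⊥ˢ ⊆ X × X ⊆ Z × dim X ≡ suc s) → suc s ≤ dim (B ∩ Z)
    go (X , _ , f , dX) = point low (⊈-witness (dim<⇒⊈ {⊥ˢ} {B ∩ Z} (≤-trans (s≤s (≤-reflexive dim-⊥)) (≤-trans (s≤s z≤n) (≤-trans 2≤s low)))))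
      where
      low : s ≤ dim (B ∩ Z)
      low = ≤-trans (slice X f dX) (dim-mono (∩-least (∩-⊆ʳ X B) (⊆-trans (∩-⊆ˡ X B) f)))

  ball-dual : ∀ {Z} → dim Z ≡ 2 + s → ∀ b → (∀ i → Ball Z i → s ≤ dim (sub k i ∩ sub k b)) → Ball Z b
  ball-dual dZ b meets = slices-ball (sub k b) dZ (ball-slices (sub k b) (dim-sub b) meets)

  nonzero : ∃ λ x → ¬ (x ∈ ⊥ˢ)
  nonzero = go (⊈-witness {⊤ˢ} {⊥ˢ} (dim<⇒⊈ (≤-trans (s≤s (≤-reflexive dim-⊥)) (≤-trans (≤-trans (s≤s z≤n) 2+s≤n) (≤-reflexive (sym dim-⊤))))))
    where
    go : (∃ λ x → x ∈ ⊤ˢ × ¬ (x ∈ ⊥ˢ)) → ∃ λ x → ¬ (x ∈ ⊥ˢ)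
    go (x , _ , x∉) = x , x∉

  ball-size-dims : ∀ {Z Z′} → dim Z ≡ 2 + s → dim Z′ ≡ 2 + s → # (ball? Z) ≡ # (ball? Z′)
  ball-size-dims dZ dZ′ = +-cancelʳ-≡ (g * N (2 + s)) _ _ (trans (ball-size dZ) (sym (ball-size dZ′)))

  ball-avoids : ∀ {Z x} → dim Z ≡ 2 + s → ¬ (x ∈ ⊥ˢ) → ∃ λ i → Ball Z i × ¬ (x ∈ sub k i)
  ball-avoids dZ x∉ with complement-point dZ x∉
  ... | X , f , dX , x∉X with generic-point (≤-trans (≤-reflexive dX) s<k) x∉X
  ... | i , a , x∉F = i , ≤-trans (≤-reflexive (sym dX)) (dim-mono (∩-least a f)) , x∉F

  -- This makes the kernel of the extremal family zero, hence of dimension below t. For x in `T` a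
  -- k-subspace of `M` missing x serves; otherwise `T` is extended within `M` away from x and then
  -- generically.
  hm-avoids : ∀ {T M x} → T ⊆ M → dim T ≡ s → dim M ≡ suc k → ¬ (x ∈ ⊥ˢ) → ∃ λ i → HM T M M i × ¬ (x ∈ sub k i)
  hm-avoids {T} {M} {x} T⊆M dT dM x∉ = go (x ∈? T)
    where
    Goal : Set
    Goal = ∃ λ i → HM T M M i × ¬ (x ∈ sub k i)
    inT : x ∈ T → (∃ λ X → X ⊆ M × dim X ≡ k × ¬ (x ∈ X)) → Goal
    inT x∈T (X , f , dX , x∉X) = index (sub-index X dX)
      where
      index : (∃ λ i → X ⊆ sub k i × sub k i ⊆ X) → Goal
      index (i , a , b) = i , inj₂ (⊆-trans b f , λ h → x∉X (b x (h x x∈T))) , x∉X ∘ b x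
    outT : ¬ (x ∈ T) → (∃ λ X → T ⊆ X × X ⊆ M × dim X ≡ dim T + 1 × X ∩ line x ⊆ T) → Goal
    outT x∉T (X , T⊆X , X⊆M , dX , av) = member (generic-point {X} {x} (≤-trans (≤-reflexive dX′) s<k) (λ x∈X → x∉T (av x (∩-intro x x∈X (add-∈ ⊥ˢ x)))))
      where
      dX′ : dim X ≡ suc s
      dX′ = trans dX (trans (cong (_+ 1) dT) (+-comm s 1))
      member : (∃ λ i → X ⊆ sub k i × ¬ (x ∈ sub k i)) → Goal
      member (i , f , x∉F) = i , inj₁ (⊆-trans T⊆X f , ≤-trans (≤-reflexive (sym dX′)) (dim-mono (∩-least f X⊆M))) , x∉F
    room : dim (T ∨ line x) + 1 ≤ dim M
    room = begin
      dim (T ∨ line x) + 1      ≤⟨ +-monoˡ-≤ 1 (dim-mono (∨-least (add-⊆ T x) (add-least ⊥-⊆ (add-∈ T x)))) ⟩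
      dim (add T x) + 1         ≤⟨ +-monoˡ-≤ 1 (≤-trans dim-add-≤ (≤-trans (s≤s (≤-reflexive dT)) s<k)) ⟩
      k + 1                     ≡⟨ trans (+-comm k 1) (sym dM) ⟩
      dim M                     ∎
      where open ≤-Reasoning
    go : Dec (x ∈ T) → Goal
    go (yes x∈T) = inT x∈T (complement-point dM x∉)
    go (no x∉T)  = outT x∉T (extend-avoiding {T} {M} {line x} 1 T⊆M room)

  ⋂ : ∀ {r} → (Fin r → Fin (num k)) → Sp
  ⋂ {zero}  f = ⊤ˢ
  ⋂ {suc r} f = sub k (f zero) ∩ ⋂ (f ∘ suc)

  ⋂-⊆ : ∀ {r} (f : Fin r → Fin (num k)) i → ⋂ f ⊆ sub k (f i)
  ⋂-⊆ f zero    = ∩-⊆ˡ (sub k (f zero)) (⋂ (f ∘ suc))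
  ⋂-⊆ f (suc i) = ⊆-trans (∩-⊆ʳ (sub k (f zero)) (⋂ (f ∘ suc))) (⋂-⊆ (f ∘ suc) i)

  dim-meet-drop : ∀ {F Z Y c} → dim Z ≤ dim (F ∩ Z) + c → Y ⊆ Z → dim Y ≤ dim (F ∩ Y) + c
  dim-meet-drop {F} {Z} {Y} {c} h Y⊆Z = +-cancelʳ-≤ (dim Z) _ _ (begin
      dim Y + dim Z                              ≤⟨ +-monoʳ-≤ (dim Y) h ⟩
      dim Y + (dim (F ∩ Z) + c)                  ≡⟨ sym (+-assoc (dim Y) _ c) ⟩
      dim Y + dim (F ∩ Z) + c                    ≤⟨ +-monoˡ-≤ c (dim-sum-≤ Y⊆Z (∩-⊆ʳ F Z)) ⟩
      dim (Y ∩ (F ∩ Z)) + dim Z + c              ≤⟨ +-monoˡ-≤ c (+-monoˡ-≤ (dim Z) (dim-mono (∩-least (⊆-trans (∩-⊆ʳ Y (F ∩ Z)) (∩-⊆ˡ F Z)) (∩-⊆ˡ Y (F ∩ Z))))) ⟩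
      dim (F ∩ Y) + dim Z + c                    ≡⟨ trans (+-assoc (dim (F ∩ Y)) _ c) (trans (cong (dim (F ∩ Y) +_) (+-comm (dim Z) c)) (sym (+-assoc (dim (F ∩ Y)) c _))) ⟩
      dim (F ∩ Y) + c + dim Z                    ∎)
    where open ≤-Reasoning

  private
    assoc-⊆ : ∀ {A B C} → A ∩ (B ∩ C) ⊆ (A ∩ B) ∩ C
    assoc-⊆ {A} {B} {C} = ∩-least (∩-mono {A} ⊆-refl (∩-⊆ˡ B C)) (⊆-trans (∩-⊆ʳ A (B ∩ C)) (∩-⊆ʳ B C))

    meet-step : ∀ {F Z I d c e} → dim Z ≤ dim (F ∩ Z) + c → d ≤ dim (I ∩ Z) + e → d ≤ dim ((F ∩ I) ∩ Z) + (c + e)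
    meet-step {F} {Z} {I} {d} {c} {e} h h′ = ≤-trans h′ (≤-trans (+-monoˡ-≤ e (≤-trans (dim-meet-drop h (∩-⊆ʳ I Z))
      (+-monoˡ-≤ c (dim-mono assoc-⊆)))) (≤-reflexive (+-assoc _ c e)))

  -- Each member cuts `Z` in codimension at most one, and codimensions add up.
  ball-⋂ : ∀ {Z} → dim Z ≡ 2 + s → ∀ {r} (f : Fin r → Fin (num k)) → (∀ i → Ball Z (f i)) → 2 + s ≤ dim (⋂ f ∩ Z) + r
  ball-⋂ {Z} dZ {zero} f b = ≤-trans (≤-reflexive (sym dZ)) (≤-trans (dim-mono (∩-least ⊆-⊤ ⊆-refl)) (m≤m+n _ 0))
  ball-⋂ {Z} dZ {suc r} f b = meet-step (≤-trans (≤-reflexive dZ) (≤-trans (s≤s (b zero)) (≤-reflexive (+-comm 1 _))))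
                                        (ball-⋂ dZ (f ∘ suc) (b ∘ suc))

  -- a counts the members containing T and b those inside M.
  record HM⋂ (T M I : Sp) (r : ℕ) : Set where
    constructor hm⋂
    field
      a b  : ℕ
      sum  : a + b ≡ r
      base : s ≤ dim (I ∩ T) + b
      none : a ≡ 0 → suc k ≤ dim (I ∩ M) + b
      one  : a ≡ 1 → suc s ≤ dim (I ∩ M) + b

  hm-⋂ : ∀ {T M} → T ⊆ M → dim T ≡ s → dim M ≡ suc k → ∀ {r} (f : Fin r → Fin (num k)) → (∀ i → HM T M M (f i)) → HM⋂ T M (⋂ f) r
  hm-⋂ {T} {M} T⊆M dT dM {zero} f hm = hm⋂ 0 0 refl
    (≤-trans (≤-reflexive (sym dT)) (≤-trans (dim-mono (∩-least ⊆-⊤ ⊆-refl)) (m≤m+n _ 0)))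
    (λ _ → ≤-trans (≤-reflexive (sym dM)) (≤-trans (dim-mono (∩-least ⊆-⊤ ⊆-refl)) (m≤m+n _ 0)))
    λ ()
  hm-⋂ {T} {M} T⊆M dT dM {suc r} f hm with hm-⋂ T⊆M dT dM (f ∘ suc) (hm ∘ suc) | hm zero
  ... | hm⋂ a b e base none one | inj₁ (T⊆F , deep) = hm⋂ (suc a) b (cong suc e)
        (meet-step {F} {T} {I} {c = 0} (≤-trans (dim-mono (∩-least T⊆F ⊆-refl)) (m≤m+n _ 0)) base)
        (λ ())
        (λ { refl → +-cancelʳ-≤ (suc k) _ _ (begin
           suc s + suc k                                 ≤⟨ +-mono-≤ deep (none refl) ⟩
           dim (F ∩ M) + (dim (I ∩ M) + b)               ≡⟨ sym (+-assoc (dim (F ∩ M)) _ b) ⟩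
           dim (F ∩ M) + dim (I ∩ M) + b                 ≤⟨ +-monoˡ-≤ b (dim-sum-≤ (∩-⊆ʳ F M) (∩-⊆ʳ I M)) ⟩
           dim ((F ∩ M) ∩ (I ∩ M)) + dim M + b           ≤⟨ +-monoˡ-≤ b (+-mono-≤ (dim-mono (∩-least (∩-mono (∩-⊆ˡ F M) (∩-⊆ˡ I M)) (⊆-trans (∩-⊆ˡ (F ∩ M) (I ∩ M)) (∩-⊆ʳ F M)))) (≤-reflexive dM)) ⟩
           dim ((F ∩ I) ∩ M) + suc k + b                 ≡⟨ lem (dim ((F ∩ I) ∩ M)) (suc k) b ⟩
           dim ((F ∩ I) ∩ M) + b + suc k                 ∎) })
    where
    open ≤-Reasoning
    F = sub k (f zero)
    I = ⋂ (f ∘ suc)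
    lem : ∀ x y z → x + y + z ≡ x + z + y
    lem = solve-∀
  ... | hm⋂ a b e base none one | inj₂ (F⊆M , T⊈F) = hm⋂ a (suc b) (trans (+-suc a b) (cong suc e))
        (meet-step {F} {T} {I} dropT base) (λ z → meet-step {F} {M} {I} dropM (none z)) (λ o → meet-step {F} {M} {I} dropM (one o))
    where
    F = sub k (f zero)
    I = ⋂ (f ∘ suc)
    dropM : dim M ≤ dim (F ∩ M) + 1
    dropM = ≤-trans (≤-reflexive (trans dM (trans (cong suc (sym (dim-sub (f zero)))) (+-comm 1 _)))) (+-monoˡ-≤ 1 (dim-mono (∩-least ⊆-refl F⊆M)))
    dropT : dim T ≤ dim (F ∩ T) + 1
    dropT = dim-meet-drop dropM T⊆M

  -- With no member through `T`, at least k + 1 - r dimensions of `M` remain; with exactly one, s +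
  -- 1 - (r - 1) = t of them; with two or more, `T` loses at most r - 2 dimensions and s - (r - 2) =
  -- t remain.
  hm-⋂-dim : ∀ {T M t r} → T ⊆ M → dim T ≡ s → dim M ≡ suc k → 2 + s ≡ t + r → r + t ≤ suc k →
    (f : Fin r → Fin (num k)) → (∀ i → HM T M M (f i)) → t ≤ dim (⋂ f)
  hm-⋂-dim {T} {M} {t} {r} T⊆M dT dM st rk f hm with hm-⋂ T⊆M dT dM f hm
  ... | hm⋂ zero b refl base none one = ≤-trans (+-cancelʳ-≤ b _ _ (≤-trans (≤-trans (≤-reflexive (+-comm t b)) rk) (none refl))) (dim-mono (∩-⊆ˡ (⋂ f) M))
  ... | hm⋂ (suc zero) b refl base none one = ≤-trans (+-cancelʳ-≤ b _ _ (≤-trans (≤-reflexive (suc-injective (trans (sym (+-suc t b)) (sym st)))) (one refl))) (dim-mono (∩-⊆ˡ (⋂ f) M))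
  ... | hm⋂ (suc (suc a)) b refl base none one = ≤-trans (+-cancelʳ-≤ b _ _ (≤-trans (≤-trans (+-monoʳ-≤ t (m≤n+m b a))
          (≤-reflexive (+-cancelˡ-≡ 2 _ _ (trans (lem t (a + b)) (sym st))))) base)) (dim-mono (∩-⊆ˡ (⋂ f) T))
    where
    lem : ∀ t x → 2 + (t + x) ≡ t + (2 + x)
    lem = solve-∀

  record System (r : ℕ) : Set₁ where
    field
      P      : Fin r → Fam
      P?     : ∀ i → Decidable (P i)
      cross  : ∀ {i j} → ¬ (i ≡ j) → Cross (P i) (P j)
      spread : ∀ i → Spread (P i)

    pair : ∀ {i j} → ¬ (i ≡ j) → Pair (P i) (P j)
    pair {i} {j} ne = record { P₁? = P? i ; P₂? = P? j ; cross = cross ne ; sp₁ = spread i ; sp₂ = spread j }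

    size : Fin r → ℕ
    size i = # (P? i)

  private
    exact-factors : ∀ {x y L} → x ≤ L → y ≤ L → 1 ≤ L → L * L ≤ x * y → L ≤ x × L ≤ y
    exact-factors {x} {y} {L} hx hy L>0 h =
      *-cancelʳ-≤ _ _ L {{>-nonZero L>0}} (≤-trans h (*-monoʳ-≤ x hy)) ,
      *-cancelˡ-≤ L {{>-nonZero L>0}} (≤-trans h (*-monoˡ-≤ y hx))

  -- As no pair exceeds L², maximality forces L² for the first pair, so these two families are the
  -- full crossed ones; `hm-dual` then places each later family inside both of them.
  system-large : 2 * s + 2 ≤ k → ∀ {r} (𝓢 : System (3 + r)) → ∀ {T₀ M₀} → T₀ ⊆ M₀ → dim T₀ ≡ s → dim M₀ ≡ suc k →
    prodFin (3 + r) (λ _ → # (hm? T₀ M₀ M₀)) ≤ prodFin (3 + r) (System.size 𝓢) →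
    ∃ λ T → ∃ λ M → T ⊆ M × dim T ≡ s × dim M ≡ suc k × (∀ i F → (System.P 𝓢 i F → HM T M M F) × (HM T M M F → System.P 𝓢 i F))
  system-large k≥ {r} 𝓢 {T₀} {M₀} T₀⊆M₀ dT₀ dM₀ le = finish (pair-theorem-large k≥ (pair {zero} {suc zero} (λ ())) T₀⊆M₀ dT₀ dM₀)
    where
    open System 𝓢
    L = # (hm? T₀ M₀ M₀)
    open Products L
    L>0 : 1 ≤ L
    L>0 = go (hm-avoids T₀⊆M₀ dT₀ dM₀ (proj₂ nonzero))
      where
      go : (∃ λ i → HM T₀ M₀ M₀ i × ¬ (proj₁ nonzero ∈ sub k i)) → 1 ≤ L
      go (i , h , _) = #-pos (hm? T₀ M₀ M₀) i h
    module _ {P₁ P₂ : Fam} (H : HMPair P₁ P₂) where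
      open HMPair H
      size₁ : # (hm? T M₂ M₁) ≡ L
      size₁ = hm-size-dims T⊆M₂ T⊆M₁ T₀⊆M₀ T₀⊆M₀ dim-T dT₀ (trans dim-M₂ (sym dM₀)) (trans dim-M₁ (sym dM₀))
      size₂ : # (hm? T M₁ M₂) ≡ L
      size₂ = hm-size-dims T⊆M₁ T⊆M₂ T₀⊆M₀ T₀⊆M₀ dim-T dT₀ (trans dim-M₁ (sym dM₀)) (trans dim-M₂ (sym dM₀))
    bound : PairBound size
    bound i j ne = go (pair-theorem-large k≥ (pair ne) T₀⊆M₀ dT₀ dM₀)
      where
      go : size i * size j < L * L ⊎ HMPair (P i) (P j) → size i * size j ≤ L * L
      go (inj₁ lt) = <⇒≤ lt
      go (inj₂ H)  = *-mono-≤ (≤-trans (#-mono (P? i) (hm? T M₂ M₁) P₁-hm) (≤-reflexive (size₁ H)))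
                              (≤-trans (#-mono (P? j) (hm? T M₁ M₂) P₂-hm) (≤-reflexive (size₂ H)))
        where open HMPair H
    finish : size zero * size (suc zero) < L * L ⊎ HMPair (P zero) (P (suc zero)) →
      ∃ λ T → ∃ λ M → T ⊆ M × dim T ≡ s × dim M ≡ suc k × (∀ i F → (P i F → HM T M M F) × (HM T M M F → P i F))
    finish (inj₁ lt) = ⊥-elim (<⇒≱ lt (first-pair-≥ L>0 r size bound le))
    finish (inj₂ H) = T , M₁ , T⊆M₁ , dim-T , dim-M₁ , λ i F → in-hm i F , #-subset-eq (P? i) (hm? T M₁ M₁) (in-hm i)
        (≤-trans (≤-reflexive (hm-size-dims T⊆M₁ T⊆M₁ T₀⊆M₀ T₀⊆M₀ dim-T dT₀ (trans dim-M₁ (sym dM₀)) (trans dim-M₁ (sym dM₀)))) (full i)) F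
      where
      open HMPair H
      0≢1 : ¬ (Fin.zero {suc (suc r)} ≡ suc zero)
      0≢1 ()
      x₀≤ : size zero ≤ L
      x₀≤ = ≤-trans (#-mono (P? zero) (hm? T M₂ M₁) P₁-hm) (≤-reflexive (size₁ H))
      x₁≤ : size (suc zero) ≤ L
      x₁≤ = ≤-trans (#-mono (P? (suc zero)) (hm? T M₁ M₂) P₂-hm) (≤-reflexive (size₂ H))
      ex = exact-factors x₀≤ x₁≤ L>0 (first-pair-≥ L>0 r size bound le)
      eq₀ : ∀ F → HM T M₂ M₁ F → P zero F
      eq₀ = #-subset-eq (P? zero) (hm? T M₂ M₁) P₁-hm (≤-trans (≤-reflexive (size₁ H)) (proj₁ ex))
      eq₁ : ∀ F → HM T M₁ M₂ F → P (suc zero) F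
      eq₁ = #-subset-eq (P? (suc zero)) (hm? T M₁ M₂) P₂-hm (≤-trans (≤-reflexive (size₂ H)) (proj₂ ex))
      rest-of : ∀ {M M′ F} → ¬ (T ⊆ sub k F) → HM T M M′ F → Rest T M′ F
      rest-of T⊈ (inj₁ (T⊆ , _)) = ⊥-elim (T⊈ T⊆)
      rest-of T⊈ (inj₂ ρ)        = ρ
      w₁ : ∃ (Rest T M₁)
      w₁ = let (a , p , T⊈) = spread zero T dim-T in a , rest-of T⊈ (P₁-hm a p)
      w₂ : ∃ (Rest T M₂)
      w₂ = let (a , p , T⊈) = spread (suc zero) T dim-T in a , rest-of T⊈ (P₂-hm a p)
      late₁ : ∀ i F → P (suc (suc i)) F → HM T M₁ M₂ F
      late₁ i F p = hm-dual dim-T T⊆M₁ T⊆M₂ dim-M₂ (proj₁ w₁) (proj₂ w₁) F λ j hm → cross {zero} {suc (suc i)} (λ ()) j F (eq₀ j hm) p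
      late₂ : ∀ i F → P (suc (suc i)) F → HM T M₂ M₁ F
      late₂ i F p = hm-dual dim-T T⊆M₂ T⊆M₁ dim-M₁ (proj₁ w₂) (proj₂ w₂) F λ j hm → cross {suc zero} {suc (suc i)} (λ ()) j F (eq₁ j hm) p
      size≤ : ∀ i → size i ≤ L
      size≤ zero          = x₀≤
      size≤ (suc zero)    = x₁≤
      size≤ (suc (suc i)) = ≤-trans (#-mono (P? (suc (suc i))) (hm? T M₁ M₂) (late₁ i)) (≤-reflexive (size₂ H))
      full : ∀ i → L ≤ size i
      full = factors-≥ L>0 (3 + r) size size≤ le
      two : Fin (3 + r)
      two = suc (suc zero)
      -- A member A of the first family not containing `T` lies in `M₁`. The third family has full
      -- size, so it contains A too, and this puts A into `M₂`; together with `T` it spans `M₁`.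
      M₁⊆M₂ : M₁ ⊆ M₂
      M₁⊆M₂ = let (a , A⊆M₁ , T⊈A) = w₁ in ⊆-trans (⊆-of-dim (∨-least T⊆M₁ A⊆M₁) (≤-trans (≤-reflexive (trans dim-M₁ (cong suc (sym (dim-sub a)))))
                (dim-strict (∨-⊆ʳ T (sub k a)) (λ f → T⊈A (⊆-trans (∨-⊆ˡ T (sub k a)) f)))))
              (∨-least T⊆M₂ (proj₁ (rest-of T⊈A (late₁ zero a (#-subset-eq (P? two) (hm? T M₂ M₁) (late₂ zero)
                (≤-trans (≤-reflexive (size₁ H)) (full two)) a (inj₂ (A⊆M₁ , T⊈A)))))))
      M₂⊆M₁ : M₂ ⊆ M₁
      M₂⊆M₁ = ⊆-of-dim M₁⊆M₂ (≤-reflexive (trans dim-M₂ (sym dim-M₁)))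
      merge : ∀ {F} → HM T M₂ M₁ F → HM T M₁ M₁ F
      merge (inj₁ (a , b)) = inj₁ (a , ≤-trans b (dim-mono (∩-mono ⊆-refl M₂⊆M₁)))
      merge (inj₂ ρ) = inj₂ ρ
      merge′ : ∀ {F} → HM T M₁ M₂ F → HM T M₁ M₁ F
      merge′ (inj₁ σ) = inj₁ σ
      merge′ (inj₂ (a , b)) = inj₂ (⊆-trans a M₂⊆M₁ , b)
      in-hm : ∀ i F → P i F → HM T M₁ M₁ F
      in-hm zero F p          = merge (P₁-hm F p)
      in-hm (suc zero) F p    = merge′ (P₂-hm F p)
      in-hm (suc (suc i)) F p = merge (late₂ i F p)

  system-small : k ≤ 2 * s + 1 → ∀ {r} (𝓢 : System (3 + r)) → ∀ {Z₀} → dim Z₀ ≡ 2 + s →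
    prodFin (3 + r) (λ _ → # (ball? Z₀)) ≤ prodFin (3 + r) (System.size 𝓢) →
    ∃ λ Z → dim Z ≡ 2 + s × (∀ i F → (System.P 𝓢 i F → Ball Z F) × (Ball Z F → System.P 𝓢 i F))
  system-small k≤ {r} 𝓢 {Z₀} dZ₀ le = finish (pair-theorem-small k≤ (pair {zero} {suc zero} (λ ())) dZ₀)
    where
    open System 𝓢
    L = # (ball? Z₀)
    open Products L
    L>0 : 1 ≤ L
    L>0 = go (ball-avoids dZ₀ (proj₂ nonzero))
      where
      go : (∃ λ i → Ball Z₀ i × ¬ (proj₁ nonzero ∈ sub k i)) → 1 ≤ L
      go (i , h , _) = #-pos (ball? Z₀) i h
    size-of : ∀ {Z} i → dim Z ≡ 2 + s → (∀ F → P i F → Ball Z F) → size i ≤ L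
    size-of {Z} i dZ f = ≤-trans (#-mono (P? i) (ball? Z) f) (≤-reflexive (ball-size-dims dZ dZ₀))
    eq-of : ∀ {Z} i → dim Z ≡ 2 + s → (∀ F → P i F → Ball Z F) → L ≤ size i → ∀ F → Ball Z F → P i F
    eq-of {Z} i dZ f full = #-subset-eq (P? i) (ball? Z) f (≤-trans (≤-reflexive (ball-size-dims dZ dZ₀)) full)
    bound : PairBound size
    bound i j ne = go (pair-theorem-small k≤ (pair ne) dZ₀)
      where
      go : size i * size j < L * L ⊎ (∃ λ Z → dim Z ≡ 2 + s × (∀ F → P i F → Ball Z F) × (∀ F → P j F → Ball Z F)) → size i * size j ≤ L * L
      go (inj₁ lt)                = <⇒≤ lt
      go (inj₂ (Z , dZ , f , f′)) = *-mono-≤ (size-of i dZ f) (size-of j dZ f′)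
    finish : size zero * size (suc zero) < L * L ⊎ (∃ λ Z → dim Z ≡ 2 + s × (∀ i → P zero i → Ball Z i) × (∀ i → P (suc zero) i → Ball Z i)) →
      ∃ λ Z → dim Z ≡ 2 + s × (∀ i F → (P i F → Ball Z F) × (Ball Z F → P i F))
    finish (inj₁ lt) = ⊥-elim (<⇒≱ lt (first-pair-≥ L>0 r size bound le))
    finish (inj₂ (Z , dZ , f₀ , f₁)) = Z , dZ , λ i F → in-ball i F , eq-of i dZ (in-ball i) (factors-≥ L>0 (3 + r) size (λ j → size-of j dZ (in-ball j)) le i) F
      where
      eq₀ : ∀ F → Ball Z F → P zero F
      eq₀ = eq-of zero dZ f₀ (proj₁ (exact-factors (size-of zero dZ f₀) (size-of (suc zero) dZ f₁) L>0 (first-pair-≥ L>0 r size bound le)))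
      in-ball : ∀ i F → P i F → Ball Z F
      in-ball zero F p = f₀ F p
      in-ball (suc i) F p = ball-dual dZ F λ j b → cross {zero} {suc i} (λ ()) j F (eq₀ j b) p

-- Linear algebra over a finite field

#-all : ∀ N → # {N} (λ _ → yes tt) ≡ N
#-all zero    = refl
#-all (suc N) = cong suc (#-all N)

#-image : ∀ {M N} {P : Fin N → Set} (P? : Decidable P) (f : Fin M → Fin N) →
  (∀ i → P (f i)) → (∀ x → P x → ∃ λ i → f i ≡ x) → (∀ i j → f i ≡ f j → i ≡ j) → # P? ≡ M
#-image {M} P? f mem onto inj = begin
    # P?                        ≡⟨ sym (*-identityʳ _) ⟩
    # P? * 1                    ≡⟨ ≤-antisym
        (double-count-≤ P? all? R? 1 1 (λ x p → let (i , e) = onto x p in #-pos (R? x) i e) col≤ (λ _ _ _ _ → tt))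
        (double-count-≥ P? all? R? 1 1 (λ x _ → #-≤1 (R? x) λ i j e e′ → inj i j (trans e (sym e′)))
          (λ i _ → #-pos (λ x → P? x ×-dec R? x i) (f i) (mem i , refl))) ⟩
    # all? * 1                  ≡⟨ *-identityʳ _ ⟩
    # all?                      ≡⟨ #-all M ⟩
    M                           ∎
  where
  open ≡-Reasoning
  all? : Decidable {A = Fin M} (λ _ → _)
  all? _ = yes tt
  R? = λ x i → f i Fin.≟ x
  col≤ : ∀ i → _ → # (λ x → P? x ×-dec R? x i) ≤ 1
  col≤ i _ = #-≤1 (λ x → P? x ×-dec R? x i) λ x y p p′ → trans (sym (proj₂ p)) (proj₂ p′)

record Enumeration {M : ℕ} (P : Fin M → Set) : Set where
  field
    count : ℕ
    elem  : Fin count → Fin M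
    mem   : ∀ i → P (elem i)
    onto  : ∀ x → P x → ∃ λ i → elem i ≡ x
    inj   : ∀ i j → elem i ≡ elem j → i ≡ j

enumerate : ∀ {M} {P : Fin M → Set} → Decidable P → Enumeration P
enumerate {zero} P? = record { count = 0 ; elem = λ () ; mem = λ () ; onto = λ () ; inj = λ () }
enumerate {suc M} {P} P? = extend (enumerate (P? ∘ suc)) (P? zero)
  where
  extend : Enumeration (P ∘ suc) → Dec (P zero) → Enumeration P
  extend e (yes p) = record
    { count = suc count
    ; elem  = λ { zero → zero ; (suc i) → suc (elem i) }
    ; mem   = λ { zero → p ; (suc i) → mem i }
    ; onto  = λ { zero _ → zero , refl ; (suc x) px → let (i , q) = onto x px in suc i , cong suc q }
    ; inj   = λ { zero zero _ → refl ; (suc i) (suc j) q → cong suc (inj i j (Fin.suc-injective q)) }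
    } where open Enumeration e
  extend e (no ¬p) = record
    { count = count
    ; elem  = suc ∘ elem
    ; mem   = mem
    ; onto  = λ { zero p → ⊥-elim (¬p p) ; (suc x) px → let (i , q) = onto x px in i , cong suc q }
    ; inj   = λ i j q → inj i j (Fin.suc-injective q)
    } where open Enumeration e

funToFin-cong : ∀ {m n} {f g : Fin m → Fin n} → (∀ i → f i ≡ g i) → funToFin f ≡ funToFin g
funToFin-cong {zero}  h = refl
funToFin-cong {suc m} h = cong₂ combine (h zero) (funToFin-cong (h ∘ suc))

module Space (𝔽 : FiniteField) (n : ℕ) where
  open FiniteField 𝔽 renaming (_+_ to _⊞_)
  open LinAlg 𝔽 n public

  R : CommutativeRing _ _
  R = record { isCommutativeRing = isCommutativeRing }

  private module F = CommutativeRing R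
  open RingProperties F.ring using (-‿distribˡ-*)

  private variable
    m d e : ℕ

  _≟ᶜ_ : (x y : Carrier) → Dec (x ≡ y)
  x ≟ᶜ y = map′ (λ p → trans (sym (inverseˡ′ x)) (trans (cong to p) (inverseˡ′ y))) (cong from) (from x Fin.≟ from y)
    where
    open Inverse enum using (to; from; inverseˡ)
    inverseˡ′ : ∀ x → to (from x) ≡ x
    inverseˡ′ x = inverseˡ refl

  q : ℕ
  q = size

  2≤q : 2 ≤ q
  2≤q = go size enum
    where
    go : ∀ N → Fin N ↔ Carrier → 2 ≤ N
    go (suc (suc N)) _ = s≤s (s≤s z≤n)
    go zero iso with Inverse.from iso 0#
    ... | ()
    go (suc zero) iso = ⊥-elim (0≢1 (trans (sym (Inverse.inverseˡ iso refl)) (trans (cong (Inverse.to iso) (one (Inverse.from iso 0#) (Inverse.from iso 1#))) (Inverse.inverseˡ iso refl))))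
      where
      one : (a b : Fin 1) → a ≡ b
      one zero zero = refl

  decode : Fin (q ^ m) → Fin m → Carrier
  decode x i = Inverse.to enum (finToFun x i)

  encode : (Fin m → Carrier) → Fin (q ^ m)
  encode v = funToFin (λ i → Inverse.from enum (v i))

  decode-encode : (v : Fin m → Carrier) → ∀ i → decode (encode v) i ≡ v i
  decode-encode v i = trans (cong (Inverse.to enum) (Fin.finToFun-funToFin (λ i → Inverse.from enum (v i)) i)) (Inverse.inverseˡ enum refl)

  encode-cong : {u v : Fin m → Carrier} → (∀ i → u i ≡ v i) → encode u ≡ encode v
  encode-cong h = funToFin-cong (λ i → cong (Inverse.from enum) (h i))

  encode-decode : ∀ m (x : Fin (q ^ m)) → encode (decode {m} x) ≡ x
  encode-decode m x = trans (funToFin-cong {m} {f = λ i → Inverse.from enum (decode {m} x i)} {finToFun {q} {m} x} (λ i → Inverse.inverseʳ enum refl)) (Fin.funToFin-finToFin {m} x)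

  ≋-refl : {u : V} → u ≋ u
  ≋-refl i = refl

  ≋-sym : {u v : V} → u ≋ v → v ≋ u
  ≋-sym p i = sym (p i)

  ≋-trans : {u v w : V} → u ≋ v → v ≋ w → u ≋ w
  ≋-trans p r i = trans (p i) (r i)

  lincomb-cong : ∀ m {c d : Fin m → Carrier} {b b′ : Fin m → V} → (∀ j → c j ≡ d j) → (∀ j → b j ≋ b′ j) →
    lincomb m c b ≋ lincomb m d b′
  lincomb-cong zero    f g i = refl
  lincomb-cong (suc m) f g i = cong₂ _⊞_ (cong₂ _·_ (f zero) (g zero i)) (lincomb-cong m (f ∘ suc) (g ∘ suc) i)

  lincomb-+ : ∀ m (c d : Fin m → Carrier) (b : Fin m → V) →
    lincomb m (λ j → c j ⊞ d j) b ≋ (lincomb m c b ⊕ lincomb m d b)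
  lincomb-+ zero    c d b i = sym (F.+-identityˡ 0#)
  lincomb-+ (suc m) c d b i = trans (cong₂ _⊞_ (F.distribʳ (b zero i) (c zero) (d zero)) (lincomb-+ m (c ∘ suc) (d ∘ suc) (b ∘ suc) i))
                                    (interchange _ _ _ _)
    where open import Algebra.Properties.CommutativeSemigroup (CommutativeRing.+-commutativeSemigroup R) using (interchange)

  lincomb-· : ∀ m a (c : Fin m → Carrier) (b : Fin m → V) →
    lincomb m (λ j → a · c j) b ≋ (a ⊙ lincomb m c b)
  lincomb-· zero    a c b i = sym (F.zeroʳ a)
  lincomb-· (suc m) a c b i = trans (cong₂ _⊞_ (F.*-assoc a (c zero) (b zero i)) (lincomb-· m a (c ∘ suc) (b ∘ suc) i))
                                    (sym (F.distribˡ a _ _))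

  ∈-resp : (S : Sub m) {u v : V} → u ≋ v → u ∈ S → v ∈ S
  ∈-resp S p (c , e) = c , ≋-trans e p

  ∈-⊕ : (S : Sub m) {u v : V} → u ∈ S → v ∈ S → (u ⊕ v) ∈ S
  ∈-⊕ {m} (b , _) (c , e) (d , e′) = (λ j → c j ⊞ d j) , λ i → trans (lincomb-+ m c d b i) (cong₂ _⊞_ (e i) (e′ i))

  ∈-⊙ : (S : Sub m) (a : Carrier) {v : V} → v ∈ S → (a ⊙ v) ∈ S
  ∈-⊙ {m} (b , _) a (c , e) = (λ j → a · c j) , λ i → trans (lincomb-· m a c b i) (cong (a ·_) (e i))

  lincomb-0 : ∀ m (b : Fin m → V) → lincomb m (λ _ → 0#) b ≋ 0V
  lincomb-0 zero    b i = refl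
  lincomb-0 (suc m) b i = trans (cong₂ _⊞_ (F.zeroˡ (b zero i)) (lincomb-0 m (b ∘ suc) i)) (F.+-identityˡ 0#)

  ∈-0 : (S : Sub m) → 0V ∈ S
  ∈-0 {m} (b , _) = (λ _ → 0#) , lincomb-0 m b

  ∈-basis : (S : Sub m) → ∀ j → proj₁ S j ∈ S
  ∈-basis (b , _) j = unit j , go _ b j
    where
    unit : ∀ {m} → Fin m → Fin m → Carrier
    unit zero    zero    = 1#
    unit zero    (suc _) = 0#
    unit (suc j) zero    = 0#
    unit (suc j) (suc i) = unit j i
    go : ∀ m (b : Fin m → V) j → lincomb m (unit j) b ≋ b j
    go (suc m) b zero    i = trans (cong₂ _⊞_ (F.*-identityˡ (b zero i)) (lincomb-0 m (b ∘ suc) i)) (F.+-identityʳ (b zero i))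
    go (suc m) b (suc j) i = trans (cong₂ _⊞_ (F.zeroˡ (b zero i)) (go m (b ∘ suc) j i)) (F.+-identityˡ (b (suc j) i))

  ∈-lincomb : ∀ {l} (S : Sub l) m (c : Fin m → Carrier) (b : Fin m → V) → (∀ j → b j ∈ S) → lincomb m c b ∈ S
  ∈-lincomb S zero    c b h = ∈-0 S
  ∈-lincomb S (suc m) c b h = ∈-⊕ S (∈-⊙ S (c zero) (h zero)) (∈-lincomb S m (c ∘ suc) (b ∘ suc) (h ∘ suc))

  cancel : ∀ {x a y z} → x ≡ (a · y) ⊞ z → z ≡ x ⊞ ((- a) · y)
  cancel {x} {a} {y} {z} e = sym (begin
    x ⊞ ((- a) · y)                  ≡⟨ cong₂ _⊞_ e (sym (-‿distribˡ-* a y)) ⟩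
    ((a · y) ⊞ z) ⊞ (- (a · y))      ≡⟨ cong (_⊞ (- (a · y))) (F.+-comm (a · y) z) ⟩
    (z ⊞ (a · y)) ⊞ (- (a · y))      ≡⟨ F.+-assoc z _ _ ⟩
    z ⊞ ((a · y) ⊞ (- (a · y)))      ≡⟨ cong (z ⊞_) (F.-‿inverseʳ (a · y)) ⟩
    z ⊞ 0#                           ≡⟨ F.+-identityʳ z ⟩
    z                                ∎)
    where open ≡-Reasoning

  ∈-remainder : (S : Sub m) {v w y : V} (a : Carrier) → v ∈ S → w ∈ S → v ≋ ((a ⊙ w) ⊕ y) → y ∈ S
  ∈-remainder S {v} {w} {y} a v∈ w∈ e = ∈-resp S (λ i → sym (cancel (e i))) (∈-⊕ S v∈ (∈-⊙ S (- a) w∈))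

  cons : V → (Fin m → V) → Fin (suc m) → V
  cons v b zero    = v
  cons v b (suc j) = b j

  cons-indep : (S : Sub m) (v : V) → ¬ (v ∈ S) → LinIndep (suc m) (cons v (proj₁ S))
  cons-indep {m} S@(b , ind) v v∉ c e = zeros
    where
    c₀ : Carrier
    c₀ = c zero
    rest : V
    rest = lincomb m (c ∘ suc) b
    c₀≡0 : c₀ ≡ 0#
    c₀≡0 with c₀ ≟ᶜ 0#
    ... | yes p = p
    ... | no c₀≢0 = ⊥-elim (v∉ (∈-resp S back (∈-⊙ S y (∈-resp S (λ i → sym (solve i)) (∈-⊙ S (- 1#) (c ∘ suc , ≋-refl))))))
      where
      y : Carrier
      y = proj₁ (inverse c₀ c₀≢0)
      solve : ∀ i → c₀ · v i ≡ (- 1#) · rest i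
      solve i = begin
        c₀ · v i                                  ≡⟨ sym (F.+-identityʳ _) ⟩
        (c₀ · v i) ⊞ 0#                           ≡⟨ cong ((c₀ · v i) ⊞_) (sym (F.-‿inverseʳ (rest i))) ⟩
        (c₀ · v i) ⊞ (rest i ⊞ (- rest i))        ≡⟨ sym (F.+-assoc _ _ _) ⟩
        ((c₀ · v i) ⊞ rest i) ⊞ (- rest i)        ≡⟨ cong (_⊞ (- rest i)) (e i) ⟩
        0# ⊞ (- rest i)                           ≡⟨ F.+-identityˡ _ ⟩
        - rest i                                  ≡⟨ cong -_ (sym (F.*-identityˡ (rest i))) ⟩
        - (1# · rest i)                           ≡⟨ -‿distribˡ-* 1# (rest i) ⟩
        (- 1#) · rest i                           ∎
        where open ≡-Reasoning
      back : (y ⊙ (λ i → c₀ · v i)) ≋ v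
      back i = trans (sym (F.*-assoc y c₀ (v i))) (trans (cong (_· v i) (trans (F.*-comm y c₀) (proj₂ (inverse c₀ c₀≢0)))) (F.*-identityˡ (v i)))
    zeros : ∀ j → c j ≡ 0#
    zeros zero    = c₀≡0
    zeros (suc j) = ind (c ∘ suc) (λ i → trans (sym (trans (cong (_⊞ rest i) (trans (cong (_· v i) c₀≡0) (F.zeroˡ (v i)))) (F.+-identityˡ (rest i)))) (e i)) j

  Q : ℕ
  Q = q ^ n

  Sp : Set
  Sp = Σ ℕ Sub

  dim : Sp → ℕ
  dim = proj₁

  infix 4 _∈ᵖ_ _⊆ᵖ_
  record _∈ᵖ_ (x : Fin Q) (U : Sp) : Set where
    constructor ⟨_⟩
    field vector : decode {n} x ∈ proj₂ U
  open _∈ᵖ_ using (vector)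

  _⊆ᵖ_ : Sp → Sp → Set
  U ⊆ᵖ W = ∀ x → x ∈ᵖ U → x ∈ᵖ W

  point : {v : V} (U : Sp) → v ∈ proj₂ U → encode v ∈ᵖ U
  point {v} U v∈ = ⟨ ∈-resp (proj₂ U) (λ i → sym (decode-encode v i)) v∈ ⟩

  unpoint : {v : V} (U : Sp) → encode v ∈ᵖ U → v ∈ proj₂ U
  unpoint {v} U ⟨ v∈ ⟩ = ∈-resp (proj₂ U) (decode-encode v) v∈

  ⊆ᵖ⇒⊆ : ∀ {U W} → U ⊆ᵖ W → proj₂ U ⊆ proj₂ W
  ⊆ᵖ⇒⊆ {U} {W} f v v∈ = unpoint W (f _ (point U v∈))

  ⊆⇒⊆ᵖ : ∀ {U W} → proj₂ U ⊆ proj₂ W → U ⊆ᵖ W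
  ⊆⇒⊆ᵖ f x ⟨ x∈ ⟩ = ⟨ f (decode {n} x) x∈ ⟩

  _≋?_ : (u v : V) → Dec (u ≋ v)
  u ≋? v = Fin.all? (λ i → u i ≟ᶜ v i)

  abstract
    spans? : ∀ m (b : Fin m → V) v → Dec (∃ λ c → lincomb m c b ≋ v)
    spans? m b v = map′ (λ (y , e) → decode {m} y , e)
      (λ (c , e) → encode c , ≋-trans (lincomb-cong m (decode-encode c) (λ _ → ≋-refl)) e)
      (Fin.any? (λ y → lincomb m (decode {m} y) b ≋? v))

  _∈ᵖ?_ : ∀ x U → Dec (x ∈ᵖ U)
  x ∈ᵖ? (m , b , _) = map′ ⟨_⟩ vector (spans? m b (decode {n} x))

  abstract
    indep? : ∀ m (b : Fin m → V) → Dec (LinIndep m b)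
    indep? m b = map′
      (λ h c e j → trans (sym (decode-encode c j)) (h (encode c) (≋-trans (lincomb-cong m (decode-encode c) (λ _ → ≋-refl)) e) j))
      (λ h y e j → h (decode {m} y) e j)
      (Fin.all? (λ y → (lincomb m (decode {m} y) b ≋? 0V) →-dec Fin.all? (λ j → decode {m} y j ≟ᶜ 0#)))

  lincomb-injective : (S : Sub m) (c d : Fin m → Carrier) → lincomb m c (proj₁ S) ≋ lincomb m d (proj₁ S) → ∀ j → c j ≡ d j
  lincomb-injective {m} (b , ind) c d e j = begin
      c j                          ≡⟨ sym (F.+-identityʳ _) ⟩
      c j ⊞ 0#                     ≡⟨ cong (c j ⊞_) (sym (F.-‿inverseˡ (d j))) ⟩
      c j ⊞ ((- d j) ⊞ d j)        ≡⟨ sym (F.+-assoc _ _ _) ⟩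
      (c j ⊞ (- d j)) ⊞ d j        ≡⟨ cong (λ z → (c j ⊞ z) ⊞ d j) (neg (d j)) ⟩
      (c j ⊞ ((- 1#) · d j)) ⊞ d j ≡⟨ cong (_⊞ d j) (ind (λ j → c j ⊞ ((- 1#) · d j)) zero-sum j) ⟩
      0# ⊞ d j                     ≡⟨ F.+-identityˡ _ ⟩
      d j                          ∎
    where
    open ≡-Reasoning
    neg : ∀ x → - x ≡ (- 1#) · x
    neg x = trans (cong -_ (sym (F.*-identityˡ x))) (-‿distribˡ-* 1# x)
    zero-sum : lincomb m (λ j → c j ⊞ ((- 1#) · d j)) b ≋ 0V
    zero-sum i = begin
      lincomb m (λ j → c j ⊞ ((- 1#) · d j)) b i           ≡⟨ lincomb-+ m c _ b i ⟩
      lincomb m c b i ⊞ lincomb m (λ j → (- 1#) · d j) b i ≡⟨ cong₂ _⊞_ (e i) (lincomb-· m (- 1#) d b i) ⟩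
      lincomb m d b i ⊞ ((- 1#) · lincomb m d b i)         ≡⟨ cong (lincomb m d b i ⊞_) (sym (neg _)) ⟩
      lincomb m d b i ⊞ (- lincomb m d b i)                ≡⟨ F.-‿inverseʳ _ ⟩
      0#                                                   ∎

  abstract
    card : ∀ U → # (_∈ᵖ? U) ≡ q ^ dim U
    card U@(m , S@(b , _)) = #-image (_∈ᵖ? U) vec
        (λ y → point U (decode {m} y , ≋-refl))
        (λ x x∈ → let (c , e) = vector x∈ in encode c , trans (encode-cong (≋-trans (lincomb-cong m (decode-encode c) (λ _ → ≋-refl)) e)) (encode-decode n x))
        λ y z e → trans (sym (encode-decode m y)) (trans (encode-cong (lincomb-injective S (decode {m} y) (decode {m} z) λ i →
          trans (sym (decode-encode (lincomb m (decode {m} y) b) i)) (trans (cong (λ w → decode {n} w i) e) (decode-encode (lincomb m (decode {m} z) b) i)))) (encode-decode m z))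
      where
      vec : Fin (q ^ m) → Fin Q
      vec y = encode (lincomb m (decode {m} y) b)

  private
    q^-reflects : ∀ {a b} → q ^ a ≤ q ^ b → a ≤ b
    q^-reflects {a} {b} le with a ≤? b
    ... | yes p = p
    ... | no np = ⊥-elim (<⇒≱ (^-monoʳ-< q 2≤q (≰⇒> np)) le)

    q^-injective : ∀ {a b} → q ^ a ≡ q ^ b → a ≡ b
    q^-injective e = ≤-antisym (q^-reflects (≤-reflexive e)) (q^-reflects (≤-reflexive (sym e)))

  abstract
    -- Dimensions are compared through the numbers q^dim of vectors, so finiteness replaces the
    -- exchange argument for bases.
    dim-mono : ∀ {U W} → U ⊆ᵖ W → dim U ≤ dim W
    dim-mono {U} {W} f = q^-reflects (≤-trans (≤-reflexive (sym (card U)))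
      (≤-trans (#-mono (_∈ᵖ? U) (_∈ᵖ? W) f) (≤-reflexive (card W))))

  dim-≤n : ∀ U → dim U ≤ n
  dim-≤n U = q^-reflects (≤-trans (≤-reflexive (sym (card U)))
    (≤-trans (#-mono (_∈ᵖ? U) (λ _ → yes tt) (λ _ _ → tt)) (≤-reflexive (#-all Q))))

  ⊥ᵖ : Sp
  ⊥ᵖ = 0 , (λ ()) , λ c _ ()

  ⊥-least : ∀ U → ⊥ᵖ ⊆ᵖ U
  ⊥-least U x ⟨ c , e ⟩ = ⟨ ∈-resp (proj₂ U) e (∈-0 (proj₂ U)) ⟩

  adjoin : (U : Sp) (x : Fin Q) → Dec (x ∈ᵖ U) → Sp
  adjoin U x (yes _) = U
  adjoin (m , S) x (no x∉) = suc m , cons (decode {n} x) (proj₁ S) , cons-indep S (decode {n} x) (λ h → x∉ ⟨ h ⟩)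

  add : Sp → Fin Q → Sp
  add U x = adjoin U x (x ∈ᵖ? U)

  add-⊆ : ∀ U x → U ⊆ᵖ add U x
  add-⊆ U x = go (x ∈ᵖ? U)
    where
    go : (p : Dec (x ∈ᵖ U)) → U ⊆ᵖ adjoin U x p
    go (yes _) y y∈ = y∈
    go (no x∉) y ⟨ c , e ⟩ = ⟨ cons₀ , (λ i → trans (trans (cong (_⊞ lincomb (dim U) c (proj₁ (proj₂ U)) i) (F.zeroˡ (decode {n} x i))) (F.+-identityˡ _)) (e i)) ⟩
      where
      cons₀ : Fin (suc (dim U)) → Carrier
      cons₀ zero    = 0#
      cons₀ (suc j) = c j

  add-∈ : ∀ U x → x ∈ᵖ add U x
  add-∈ U x = go (x ∈ᵖ? U)
    where
    go : (p : Dec (x ∈ᵖ U)) → x ∈ᵖ adjoin U x p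
    go (yes x∈) = x∈
    go (no x∉)  = ⟨ ∈-basis (proj₂ (adjoin U x (no x∉))) zero ⟩

  add-split : ∀ U x {y} → y ∈ᵖ add U x → y ∈ᵖ U ⊎ (∃ λ a → ∃ λ u → u ∈ proj₂ U × decode {n} y ≋ ((a ⊙ decode {n} x) ⊕ u))
  add-split U x {y} = go (x ∈ᵖ? U)
    where
    go : (p : Dec (x ∈ᵖ U)) → y ∈ᵖ adjoin U x p → y ∈ᵖ U ⊎ (∃ λ a → ∃ λ u → u ∈ proj₂ U × decode {n} y ≋ ((a ⊙ decode {n} x) ⊕ u))
    go (yes _) y∈ = inj₁ y∈
    go (no _) ⟨ c , e ⟩ = inj₂ (c zero , lincomb (dim U) (c ∘ suc) (proj₁ (proj₂ U)) , (c ∘ suc , ≋-refl) , ≋-sym e)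

  abstract
    add-least : ∀ {U W x} → U ⊆ᵖ W → x ∈ᵖ W → add U x ⊆ᵖ W
    add-least {U} {W} {x} f x∈ y y∈ = go (add-split U x y∈)
      where
      go : y ∈ᵖ U ⊎ (∃ λ a → ∃ λ u → u ∈ proj₂ U × decode {n} y ≋ ((a ⊙ decode {n} x) ⊕ u)) → y ∈ᵖ W
      go (inj₁ y∈U) = f y y∈U
      go (inj₂ (a , u , u∈ , e)) = ⟨ ∈-resp (proj₂ W) (≋-sym e) (∈-⊕ (proj₂ W) (∈-⊙ (proj₂ W) a (vector x∈)) (⊆ᵖ⇒⊆ {U} {W} f u u∈)) ⟩

  dim-add : ∀ {U x} → ¬ (x ∈ᵖ U) → dim (add U x) ≡ suc (dim U)
  dim-add {U} {x} x∉ = go (x ∈ᵖ? U)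
    where
    go : (p : Dec (x ∈ᵖ U)) → dim (adjoin U x p) ≡ suc (dim U)
    go (yes x∈) = ⊥-elim (x∉ x∈)
    go (no _)   = refl

  abstract
    -- Vectors of `P` are adjoined greedily until none is left outside; dimensions are bounded by n,
    -- so this stops. The whole space and intersections obtain their bases in this way.
    carve : (P : Fin Q → Set) → Decidable P → (∀ U x → (∀ y → y ∈ᵖ U → P y) → P x → ∀ y → y ∈ᵖ add U x → P y) →
      (∀ y → y ∈ᵖ ⊥ᵖ → P y) → ∃ λ U → (∀ y → y ∈ᵖ U → P y) × (∀ y → P y → y ∈ᵖ U)
    carve P P? closed base = go (suc n) ⊥ᵖ (≤-reflexive refl) base
      where
      go : ∀ fuel U → suc n ≤ dim U + fuel → (∀ y → y ∈ᵖ U → P y) → ∃ λ U → (∀ y → y ∈ᵖ U → P y) × (∀ y → P y → y ∈ᵖ U)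
      go zero U le _ = ⊥-elim (<⇒≱ le (≤-trans (≤-reflexive (+-identityʳ _)) (dim-≤n U)))
      go (suc fuel) U le U⊆P = step (Fin.any? (λ x → P? x ×-dec ¬? (x ∈ᵖ? U)))
        where
        step : Dec (∃ λ x → P x × ¬ (x ∈ᵖ U)) → ∃ λ U → (∀ y → y ∈ᵖ U → P y) × (∀ y → P y → y ∈ᵖ U)
        step (yes (x , px , x∉)) = go fuel (add U x) (≤-trans le (≤-reflexive (trans (+-suc _ fuel) (cong (_+ fuel) (sym (dim-add {U} x∉)))))) (closed U x U⊆P px)
        step (no none) = U , U⊆P , λ y py → decide y py (y ∈ᵖ? U)
          where
          decide : ∀ y → P y → Dec (y ∈ᵖ U) → y ∈ᵖ U
          decide y py (yes p) = p
          decide y py (no ¬p) = ⊥-elim (none (y , py , ¬p))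

  private
    abstract
      top : ∃ λ U → (∀ y → y ∈ᵖ U → Unit) × (∀ y → Unit → y ∈ᵖ U)
      top = carve (λ _ → Unit) (λ _ → yes tt) (λ _ _ _ _ _ _ → tt) (λ _ _ → tt)

    abstract
      meet : ∀ U W → ∃ λ X → (∀ y → y ∈ᵖ X → y ∈ᵖ U × y ∈ᵖ W) × (∀ y → y ∈ᵖ U × y ∈ᵖ W → y ∈ᵖ X)
      meet U W = carve (λ y → y ∈ᵖ U × y ∈ᵖ W) (λ y → (y ∈ᵖ? U) ×-dec (y ∈ᵖ? W))
        (λ X x f p y y∈ → add-least {X} {U} (λ z z∈ → proj₁ (f z z∈)) (proj₁ p) y y∈ , add-least {X} {W} (λ z z∈ → proj₂ (f z z∈)) (proj₂ p) y y∈)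
        (λ y y∈ → ⊥-least U y y∈ , ⊥-least W y y∈)

  ⊤ᵖ : Sp
  ⊤ᵖ = proj₁ top

  abstract
    dim-⊤ : dim ⊤ᵖ ≡ n
    dim-⊤ = q^-injective (trans (sym (card ⊤ᵖ)) (trans (#-cong (_∈ᵖ? ⊤ᵖ) (λ _ → yes tt) (λ _ _ → tt) (λ y _ → proj₂ (proj₂ top) y tt)) (#-all Q)))

  _∩ᵖ_ : Sp → Sp → Sp
  U ∩ᵖ W = proj₁ (meet U W)

  abstract
    -- If y = a x + u with u in `U`, then u = y - a x lies in `W` as well.
    add-mod : ∀ {U W x y} → x ∈ᵖ W → y ∈ᵖ W → y ∈ᵖ add U x → y ∈ᵖ add (U ∩ᵖ W) x
    add-mod {U} {W} {x} {y} x∈ y∈ y∈add = go (add-split U x y∈add)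
      where
      I A : Sp
      I = U ∩ᵖ W
      A = add I x
      go : y ∈ᵖ U ⊎ (∃ λ a → ∃ λ u → u ∈ proj₂ U × decode {n} y ≋ ((a ⊙ decode {n} x) ⊕ u)) → y ∈ᵖ A
      go (inj₁ y∈U) = add-⊆ I x y (proj₂ (proj₂ (meet U W)) y (y∈U , y∈))
      go (inj₂ (a , u , u∈ , e)) = ⟨ ∈-resp (proj₂ A) (≋-sym e) (∈-⊕ (proj₂ A) (∈-⊙ (proj₂ A) a (vector (add-∈ I x))) (unpoint A (add-⊆ I x _
        (proj₂ (proj₂ (meet U W)) _ (point U u∈ , point W (∈-remainder (proj₂ W) a (vector y∈) (vector x∈) e)))))) ⟩

  ⊆ᵖ-of-dim : ∀ {U W} → U ⊆ᵖ W → dim W ≤ dim U → W ⊆ᵖ U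
  ⊆ᵖ-of-dim {U} {W} f le = #-subset-eq (_∈ᵖ? U) (_∈ᵖ? W) f (≤-trans (≤-reflexive (card W))
    (≤-trans (^-monoʳ-≤ q {{>-nonZero (≤-trans (s≤s z≤n) 2≤q)}} le) (≤-reflexive (sym (card U)))))

  tuple : ∀ d → Fin (Q ^ d) → Fin d → V
  tuple d t j = decode {n} (finToFun {Q} {d} t j)

  -- Subspaces are listed through their characteristic functions, so that
  -- distinct indices give distinct sets.
  Characteristic : ℕ → Fin (2 ^ Q) → Set
  Characteristic d z = ∃ λ (t : Fin (Q ^ d)) → LinIndep d (tuple d t) ×
    (∀ x → ((∃ λ c → lincomb d c (tuple d t) ≋ decode {n} x) → finToFun {2} {Q} z x ≡ suc zero) ×
           (finToFun {2} {Q} z x ≡ suc zero → ∃ λ c → lincomb d c (tuple d t) ≋ decode {n} x))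

  characteristic? : ∀ d → Decidable (Characteristic d)
  characteristic? d z = Fin.any? λ t → indep? d (tuple d t) ×-dec Fin.all? λ x →
    (spans? d (tuple d t) (decode {n} x) →-dec (finToFun {2} {Q} z x Fin.≟ suc zero)) ×-dec ((finToFun {2} {Q} z x Fin.≟ suc zero) →-dec spans? d (tuple d t) (decode {n} x))

  abstract
    subspaces : ∀ d → Enumeration (Characteristic d)
    subspaces d = enumerate (characteristic? d)

  num : ℕ → ℕ
  num d = Enumeration.count (subspaces d)

  sub : ∀ d → Fin (num d) → Sp
  sub d i = let (t , ind , _) = Enumeration.mem (subspaces d) i in d , tuple d t , ind

  private
    χ : ∀ d → Fin (num d) → Fin (2 ^ Q)
    χ d = Enumeration.elem (subspaces d)

    χ⇒ : ∀ d i x → x ∈ᵖ sub d i → finToFun {2} {Q} (χ d i) x ≡ suc zero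
    χ⇒ d i x ⟨ x∈ ⟩ = proj₁ (proj₂ (proj₂ (Enumeration.mem (subspaces d) i)) x) x∈

    χ⇐ : ∀ d i x → finToFun {2} {Q} (χ d i) x ≡ suc zero → x ∈ᵖ sub d i
    χ⇐ d i x e = ⟨ proj₂ (proj₂ (proj₂ (Enumeration.mem (subspaces d) i)) x) e ⟩

  abstract
    sub-inj : ∀ {d i j} → sub d i ⊆ᵖ sub d j → i ≡ j
    sub-inj {d} {i} {j} f = Enumeration.inj (subspaces d) i j (trans (sym (Fin.funToFin-finToFin {Q} {2} (χ d i)))
        (trans (funToFin-cong same) (Fin.funToFin-finToFin {Q} {2} (χ d j))))
      where
      bit : (a b : Fin 2) → (a ≡ suc zero → b ≡ suc zero) → (b ≡ suc zero → a ≡ suc zero) → a ≡ b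
      bit zero       zero       _ _ = refl
      bit zero       (suc zero) _ g = g refl
      bit (suc zero) b          f _ = sym (f refl)
      same : ∀ x → finToFun {2} {Q} (χ d i) x ≡ finToFun {2} {Q} (χ d j) x
      same x = bit _ _ (λ e → χ⇒ d j x (f x (χ⇐ d i x e))) (λ e → χ⇒ d i x (⊆ᵖ-of-dim {sub d i} {sub d j} f ≤-refl x (χ⇐ d j x e)))

  abstract
    sub-surj : ∀ U → Σ (Fin (num (dim U))) λ i → U ⊆ᵖ sub (dim U) i × sub (dim U) i ⊆ᵖ U
    sub-surj U@(d , b , ind) = i , (λ x x∈ → χ⇐ d i x (trans (cong (λ w → finToFun {2} {Q} w x) χ≡) (trans (Fin.finToFun-funToFin bits x) (bit₁ x x∈ (x ∈ᵖ? U)))))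
                               , (λ x x∈ → bit₂ x (x ∈ᵖ? U) (trans (sym (Fin.finToFun-funToFin bits x)) (trans (cong (λ w → finToFun {2} {Q} w x) (sym χ≡)) (χ⇒ d i x x∈))))
      where
      toBit : ∀ {A : Set} → Dec A → Fin 2
      toBit (yes _) = suc zero
      toBit (no _)  = zero
      bits : Fin Q → Fin 2
      bits x = toBit (x ∈ᵖ? U)
      bit₁ : ∀ x → x ∈ᵖ U → (p : Dec (x ∈ᵖ U)) → toBit p ≡ suc zero
      bit₁ x x∈ (yes _) = refl
      bit₁ x x∈ (no ¬p) = ⊥-elim (¬p x∈)
      bit₂ : ∀ x (p : Dec (x ∈ᵖ U)) → toBit p ≡ suc zero → x ∈ᵖ U
      bit₂ x (yes p) _ = p
      z : Fin (2 ^ Q)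
      z = funToFin bits
      t : Fin (Q ^ d)
      t = funToFin (λ j → encode (b j))
      t≋ : ∀ j → tuple d t j ≋ b j
      t≋ j k = trans (cong (λ w → decode {n} w k) (Fin.finToFun-funToFin (λ j → encode (b j)) j)) (decode-encode (b j) k)
      char : Characteristic d z
      char = t , (λ c e → ind c (≋-trans (lincomb-cong d (λ _ → refl) (λ j → ≋-sym (t≋ j))) e))
        , λ x → (λ (c , e) → trans (Fin.finToFun-funToFin bits x) (bit₁ x ⟨ c , ≋-trans (lincomb-cong d (λ _ → refl) (λ j → ≋-sym (t≋ j))) e ⟩ (x ∈ᵖ? U)))
              , (λ e → let ⟨ c , e′ ⟩ = bit₂ x (x ∈ᵖ? U) (trans (sym (Fin.finToFun-funToFin bits x)) e) in c , ≋-trans (lincomb-cong d (λ _ → refl) t≋) e′)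
      i : Fin (num d)
      i = proj₁ (Enumeration.onto (subspaces d) z char)
      χ≡ : χ d i ≡ z
      χ≡ = proj₂ (Enumeration.onto (subspaces d) z char)

  geometry : Geometry
  geometry = record
    { q = q ; n = n ; Q = Q ; 2≤q = 2≤q ; Sp = Sp ; dim = dim ; _∈_ = _∈ᵖ_ ; _∈?_ = _∈ᵖ?_
    ; dim-mono = λ {U} {W} → dim-mono {U} {W} ; ⊥ˢ = ⊥ᵖ ; ⊤ˢ = ⊤ᵖ ; dim-⊥ = refl ; dim-⊤ = dim-⊤
    ; ∈-⊤ = λ x → proj₂ (proj₂ top) x tt
    ; add = add ; add-⊆ = add-⊆ ; add-∈ = add-∈ ; add-least = λ {U} {W} {x} → add-least {U} {W} {x}
    ; dim-add = λ {U} {x} → dim-add {U} {x}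
    ; _∩_ = _∩ᵖ_ ; ∩-intro = λ {U} {W} x a b → proj₂ (proj₂ (meet U W)) x (a , b)
    ; ∩-⊆ˡ = λ U W x x∈ → proj₁ (proj₁ (proj₂ (meet U W)) x x∈)
    ; ∩-⊆ʳ = λ U W x x∈ → proj₂ (proj₁ (proj₂ (meet U W)) x x∈)
    ; add-mod = λ {U} {W} {x} {y} → add-mod {U} {W} {x} {y}
    ; card = card ; num = num ; sub = sub ; dim-sub = λ _ → refl
    ; sub-inj = λ {d} {i} {j} → sub-inj {d} {i} {j} ; sub-surj = sub-surj
    }

-- Between families of presented subspaces and families of indices

insert : ∀ {m} {B : Fin (suc m) → Set} i → B i → (∀ x → B (punchIn i x)) → ∀ l → B l
insert             zero    b f zero    = b
insert             zero    b f (suc l) = f l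
insert {m = suc m} (suc i) b f zero    = f zero
insert {m = suc m} {B} (suc i) b f (suc l) = insert {B = B ∘ suc} i b (f ∘ suc) l

insert-at : ∀ {m} {B : Fin (suc m) → Set} i (b : B i) (f : ∀ x → B (punchIn i x)) → insert {B = B} i b f i ≡ b
insert-at             zero    b f = refl
insert-at {m = suc m} {B} (suc i) b f = insert-at {B = B ∘ suc} i b (f ∘ suc)

insert-punchIn : ∀ {m} {B : Fin (suc m) → Set} i (b : B i) (f : ∀ x → B (punchIn i x)) x → insert {B = B} i b f (punchIn i x) ≡ f x
insert-punchIn             zero    b f x       = refl
insert-punchIn {m = suc m} (suc i) b f zero    = refl
insert-punchIn {m = suc m} {B} (suc i) b f (suc x) = insert-punchIn {B = B ∘ suc} i b (f ∘ suc) x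

prodFin-cong : ∀ r {x y : Fin r → ℕ} → (∀ i → x i ≡ y i) → prodFin r x ≡ prodFin r y
prodFin-cong zero    h = refl
prodFin-cong (suc r) h = cong₂ _*_ (h zero) (prodFin-cong r (h ∘ suc))

module Bridge (𝔽 : FiniteField) (n : ℕ) where
  private
    module L = LinAlg 𝔽 n
    module S = Space 𝔽 n
  open Lattice S.geometry using (Sp; dim; sub; num; sub-index; sub-inj; interpolate; ⊥ˢ; ⊥-⊆; dim-⊥; _⊆?_; ⊆-trans; ⊈-witness; dim<⇒⊈)
    renaming (_∈_ to _∈ᵍ_; _⊆_ to _⊆ᵍ_; _∩_ to _∩ᵍ_)

  private variable
    k d : ℕ

  ⟪_⟫ : L.Sub k → Sp
  ⟪ F ⟫ = _ , F

  flat : ∀ {k} → Fin (num k) → L.Sub k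
  flat {k} i = proj₂ (sub k i)

  module _ {k : ℕ} (F : L.Sub k) where
    private
      found : Σ (Fin (num k)) λ i → ⟪ F ⟫ ⊆ᵍ sub k i × sub k i ⊆ᵍ ⟪ F ⟫
      found = sub-index ⟪ F ⟫ refl

    index : Fin (num k)
    index = proj₁ found

    ⊆-index : ⟪ F ⟫ ⊆ᵍ sub k index
    ⊆-index = proj₁ (proj₂ found)

    index-⊆ : sub k index ⊆ᵍ ⟪ F ⟫
    index-⊆ = proj₂ (proj₂ found)

    ≐-index : F L.≐ flat index
    ≐-index = S.⊆ᵖ⇒⊆ {⟪ F ⟫} {sub k index} ⊆-index , S.⊆ᵖ⇒⊆ {sub k index} {⟪ F ⟫} index-⊆

    index-≐ : flat index L.≐ F
    index-≐ = proj₂ ≐-index , proj₁ ≐-index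

  dimGE-intro : ∀ {P : L.V → Set} (Y : Sp) → d ≤ dim Y → (∀ v → v L.∈ proj₂ Y → P v) → L.DimGE d P
  dimGE-intro {d} {P} Y le f = go (interpolate {⊥ˢ} {Y} d ⊥-⊆ (≤-trans (≤-reflexive dim-⊥) z≤n) le)
    where
    go : (∃ λ X → ⊥ˢ ⊆ᵍ X × X ⊆ᵍ Y × dim X ≡ d) → L.DimGE d P
    go (X@(_ , b , ind) , _ , X⊆Y , refl) = b , ind , λ j → f (b j) (S.⊆ᵖ⇒⊆ {X} {Y} X⊆Y (b j) (S.∈-basis (b , ind) j))

  dimGE-span : ∀ {P : L.V → Set} → ((b , ind , _) : L.DimGE d P) → ∀ (W : Sp) → (∀ v → P v → v L.∈ proj₂ W) → ⟪ b , ind ⟫ ⊆ᵍ W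
  dimGE-span {d} (b , ind , p) W f = S.⊆⇒⊆ᵖ {d , b , ind} {W} λ v (c , e) →
    S.∈-resp (proj₂ W) e (S.∈-lincomb (proj₂ W) d c b (λ j → f (b j) (p j)))

  dimGE-elim : ∀ {P : L.V → Set} → L.DimGE d P → ∀ (W : Sp) → (∀ v → P v → v L.∈ proj₂ W) → d ≤ dim W
  dimGE-elim {d} D@(b , ind , _) W f = S.dim-mono {d , b , ind} {W} (dimGE-span D W f)

  ∩-elim : ∀ (U W : Sp) v → v L.∈ proj₂ (U ∩ᵍ W) → v L.∈ proj₂ U × v L.∈ proj₂ W
  ∩-elim U W v v∈ = S.⊆ᵖ⇒⊆ {U ∩ᵍ W} {U} (Lattice.∩-⊆ˡ S.geometry U W) v v∈ , S.⊆ᵖ⇒⊆ {U ∩ᵍ W} {W} (Lattice.∩-⊆ʳ S.geometry U W) v v∈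

  ∩-intro′ : ∀ (U W : Sp) v → v L.∈ proj₂ U → v L.∈ proj₂ W → v L.∈ proj₂ (U ∩ᵍ W)
  ∩-intro′ U W v a b = S.unpoint (U ∩ᵍ W) (Lattice.∩-intro S.geometry {U} {W} _ (S.point U a) (S.point W b))

  dimGE-∩⇒ : ∀ (U W : Sp) → L.DimGE d (λ v → v L.∈ proj₂ U × v L.∈ proj₂ W) → d ≤ dim (U ∩ᵍ W)
  dimGE-∩⇒ U W D = dimGE-elim {P = λ v → v L.∈ proj₂ U × v L.∈ proj₂ W} D (U ∩ᵍ W) (λ v (a , b) → ∩-intro′ U W v a b)

  dimGE-∩⇐ : ∀ (U W : Sp) → d ≤ dim (U ∩ᵍ W) → L.DimGE d (λ v → v L.∈ proj₂ U × v L.∈ proj₂ W)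
  dimGE-∩⇐ U W le = dimGE-intro {P = λ v → v L.∈ proj₂ U × v L.∈ proj₂ W} (U ∩ᵍ W) le (∩-elim U W)

  module _ {𝓕 : L.Family k} (wd : L.WellDefined 𝓕) where

    -- A family is an arbitrary predicate; the finite list inside `HasSize` makes it decidable, as
    -- inclusion of subspaces can be tested.
    hasSize-dec : ∀ {m} → L.HasSize 𝓕 m → Decidable {A = Fin (num k)} (λ i → 𝓕 (flat i))
    hasSize-dec (xs , mem , _ , onto) i = map′
      (λ (j , f , g) → wd (xs j) (flat i) (S.⊆ᵖ⇒⊆ {⟪ xs j ⟫} {sub k i} g , S.⊆ᵖ⇒⊆ {sub k i} {⟪ xs j ⟫} f) (mem j))
      (λ p → let (j , f , g) = onto (flat i) p in j , S.⊆⇒⊆ᵖ {sub k i} {⟪ xs j ⟫} f , S.⊆⇒⊆ᵖ {⟪ xs j ⟫} {sub k i} g)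
      (Fin.any? (λ j → (sub k i ⊆? ⟪ xs j ⟫) ×-dec (⟪ xs j ⟫ ⊆? sub k i)))

    hasSize-# : ∀ {m} → L.HasSize 𝓕 m → (P? : Decidable {A = Fin (num k)} (λ i → 𝓕 (flat i))) → m ≡ # P?
    hasSize-# (xs , mem , inj , onto) P? = sym (#-image P? (λ j → index (xs j))
      (λ j → wd (xs j) (flat (index (xs j))) (≐-index (xs j)) (mem j))
      (λ x p → let (j , f , g) = onto (flat x) p in j , sym (sub-inj {i = x} {j = index (xs j)}
         (⊆-trans (S.⊆⇒⊆ᵖ {sub k x} {⟪ xs j ⟫} f) (⊆-index (xs j)))))
      λ i j e → inj i j
        ( S.⊆ᵖ⇒⊆ {⟪ xs i ⟫} {⟪ xs j ⟫} (⊆-trans (⊆-index (xs i)) (subst (λ l → sub k l ⊆ᵍ ⟪ xs j ⟫) (sym e) (index-⊆ (xs j))))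
        , S.⊆ᵖ⇒⊆ {⟪ xs j ⟫} {⟪ xs i ⟫} (⊆-trans (⊆-index (xs j)) (subst (λ l → sub k l ⊆ᵍ ⟪ xs i ⟫) e (index-⊆ (xs i))))))

    #-hasSize : (P? : Decidable {A = Fin (num k)} (λ i → 𝓕 (flat i))) → L.HasSize 𝓕 (# P?)
    #-hasSize P? = subst (L.HasSize 𝓕) (sym (#-image P? elem mem onto inj))
        ((λ j → flat (elem j)) , mem
        , (λ i j (f , _) → inj i j (sub-inj (S.⊆⇒⊆ᵖ {sub k (elem i)} {sub k (elem j)} f)))
        , λ F p → let (j , e) = onto (index F) (wd F (flat (index F)) (≐-index F) p) in
            j , subst (λ l → F L.≐ flat l) (sym e) (≐-index F))
      where open Enumeration (enumerate P?)

  module Admissibility {r t : ℕ} (𝓕 : Fin r → L.Family k) (adm : L.Admissible r t 𝓕)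
                       (P? : ∀ i → Decidable {A = Fin (num k)} (λ F → 𝓕 i (flat F))) where
    private
      wd = proj₁ adm
      nonempty = proj₁ (proj₂ adm)
      cross = proj₁ (proj₂ (proj₂ adm))
      kernel = proj₂ (proj₂ (proj₂ adm))

    -- If every member contained `U`, the kernel would have dimension at least t.
    escape : ∀ i U → t ≤ dim U → ∃ λ F → 𝓕 i (flat F) × ¬ (U ⊆ᵍ sub k F)
    escape i U le = go (Fin.any? (λ F → P? i F ×-dec ¬? (U ⊆? sub k F)))
      where
      decide : ∀ F → ¬ (∃ λ F → 𝓕 i (flat F) × ¬ (U ⊆ᵍ sub k F)) → 𝓕 i (flat F) → Dec (U ⊆ᵍ sub k F) → U ⊆ᵍ sub k F
      decide F none p (yes f) = f
      decide F none p (no nf) = ⊥-elim (none (F , p , nf))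
      go : Dec (∃ λ F → 𝓕 i (flat F) × ¬ (U ⊆ᵍ sub k F)) → ∃ λ F → 𝓕 i (flat F) × ¬ (U ⊆ᵍ sub k F)
      go (yes w)   = w
      go (no none) = ⊥-elim (kernel i (dimGE-intro U le λ v v∈ F p →
        S.⊆ᵖ⇒⊆ {U} {⟪ F ⟫} (⊆-trans (decide (index F) none (wd i F (flat (index F)) (≐-index F) p) (U ⊆? sub k (index F))) (index-⊆ F)) v v∈))

    member : ∀ i → ∃ λ F → 𝓕 i (flat F)
    member i = let (F , p) = nonempty i in index F , wd i F (flat (index F)) (≐-index F) p

    -- While dim U ≥ t, some member of the next family fails to contain U and
    -- intersecting with it lowers the dimension.
    descend : ∀ m (l : Fin m → Fin r) (U : Sp) → dim U < t + m →
      Σ (∀ x → ∃ λ F → 𝓕 (l x) (flat F)) λ F → ∃ λ W → dim W < t × (∀ v → v ∈ᵍ U → (∀ x → v ∈ᵍ sub k (proj₁ (F x))) → v ∈ᵍ W)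
    descend zero l U lt = (λ ()) , U , ≤-trans lt (≤-reflexive (+-identityʳ t)) , λ v v∈ _ → v∈
    descend (suc m) l U lt = continue (choose (t ≤? dim U))
      where
      choose : Dec (t ≤ dim U) → Σ (∃ λ F → 𝓕 (l zero) (flat F)) λ F → dim (U ∩ᵍ sub k (proj₁ F)) < t + m
      choose (yes le) = let (F , p , nf) = escape (l zero) U le in (F , p) ,
        ≤-trans (Lattice.dim-strict S.geometry (Lattice.∩-⊆ˡ S.geometry U (sub k F)) (λ f → nf (⊆-trans f (Lattice.∩-⊆ʳ S.geometry U (sub k F)))))
                (s≤s⁻¹ (≤-trans lt (≤-reflexive (+-suc t m))))
      choose (no nle) = member (l zero) , ≤-trans (s≤s (Lattice.dim-mono S.geometry (Lattice.∩-⊆ˡ S.geometry U _))) (≤-trans (≰⇒> nle) (m≤m+n t m))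
      continue : (Σ (∃ λ F → 𝓕 (l zero) (flat F)) λ F → dim (U ∩ᵍ sub k (proj₁ F)) < t + m) →
        Σ (∀ x → ∃ λ F → 𝓕 (l x) (flat F)) λ F → ∃ λ W → dim W < t × (∀ v → v ∈ᵍ U → (∀ x → v ∈ᵍ sub k (proj₁ (F x))) → v ∈ᵍ W)
      continue ((F₀ , p₀) , lt₀) = prepend (descend m (l ∘ suc) (U ∩ᵍ sub k F₀) lt₀)
        where
        prepend : (Σ (∀ x → ∃ λ F → 𝓕 (l (suc x)) (flat F)) λ F → ∃ λ W → dim W < t × (∀ v → v ∈ᵍ U ∩ᵍ sub k F₀ → (∀ x → v ∈ᵍ sub k (proj₁ (F x))) → v ∈ᵍ W)) →
          Σ (∀ x → ∃ λ F → 𝓕 (l x) (flat F)) λ F → ∃ λ W → dim W < t × (∀ v → v ∈ᵍ U → (∀ x → v ∈ᵍ sub k (proj₁ (F x))) → v ∈ᵍ W)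
        prepend (F , W , lt , f) = F′ , W , lt , λ v v∈ h → f v (Lattice.∩-intro S.geometry {U} {sub k F₀} v v∈ (h zero)) (h ∘ suc)
          where
          F′ : ∀ x → ∃ λ F → 𝓕 (l x) (flat F)
          F′ zero    = F₀ , p₀
          F′ (suc x) = F x

    no-small-meet : (F : ∀ i → ∃ λ F → 𝓕 i (flat F)) (W : Sp) → (∀ v → (∀ i → v ∈ᵍ sub k (proj₁ (F i))) → v ∈ᵍ W) → t ≤ dim W
    no-small-meet F W f = dimGE-elim {P = λ v → ∀ i → v L.∈ flat (proj₁ (F i))} (cross (λ i → flat (proj₁ (F i))) (λ i → proj₂ (F i))) W
      λ v h → S.unpoint W (f (S.encode v) (λ i → S.point (sub k (proj₁ (F i))) (h i)))

  -- Descent from a member of the first family: if k < t + r, the r further families bring the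
  -- dimension below t, against the cross condition.
  member-dim : ∀ {r t} (𝓕 : Fin (suc r) → L.Family k) → L.Admissible (suc r) t 𝓕 →
    (∀ i → Decidable {A = Fin (num k)} (λ F → 𝓕 i (flat F))) → t + r ≤ k
  member-dim {k} {r} {t} 𝓕 adm P? = ≮⇒≥ λ lt → absurd (descend r suc (sub k (proj₁ (member zero))) lt)
    where
    open Admissibility 𝓕 adm P?
    A : Fin (num k)
    A = proj₁ (member zero)
    absurd : ¬ (Σ (∀ x → ∃ λ F → 𝓕 (suc x) (flat F)) λ F → ∃ λ W → dim W < t × (∀ v → v ∈ᵍ sub k A → (∀ x → v ∈ᵍ sub k (proj₁ (F x))) → v ∈ᵍ W))
    absurd (F , W , lt , f) = <⇒≱ lt (no-small-meet F′ W λ v h → f v (h zero) (h ∘ suc))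
      where
      F′ : ∀ x → ∃ λ F → 𝓕 x (flat F)
      F′ zero    = member zero
      F′ (suc x) = F x

  -- The same descent, from A ∩ B through the r families other than i and j; `insert` assembles A, B
  -- and the chosen members into one selection over all indices.
  pair-meet : ∀ {r t} (𝓕 : Fin (2 + r) → L.Family k) → L.Admissible (2 + r) t 𝓕 →
    (∀ i → Decidable {A = Fin (num k)} (λ F → 𝓕 i (flat F))) →
    ∀ {i j} → ¬ (i ≡ j) → ∀ A B → 𝓕 i (flat A) → 𝓕 j (flat B) → t + r ≤ dim (sub k A ∩ᵍ sub k B)
  pair-meet {k} {r} {t} 𝓕 adm P? {i} {j} ne A B pA pB = ≮⇒≥ λ lt → absurd (descend r (λ x → punchIn i (punchIn j′ x)) (sub k A ∩ᵍ sub k B) lt)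
    where
    open Admissibility 𝓕 adm P?
    j′ : Fin (suc r)
    j′ = punchOut ne
    C : Fin (2 + r) → Set
    C l = ∃ λ F → 𝓕 l (flat F)
    absurd : ¬ (Σ (∀ x → C (punchIn i (punchIn j′ x))) λ F → ∃ λ W → dim W < t × (∀ v → v ∈ᵍ sub k A ∩ᵍ sub k B → (∀ x → v ∈ᵍ sub k (proj₁ (F x))) → v ∈ᵍ W))
    absurd (F , W , lt , f) = <⇒≱ lt (no-small-meet all W λ v h → f v
        (Lattice.∩-intro S.geometry {sub k A} {sub k B} v
          (subst (λ z → v ∈ᵍ sub k (proj₁ z)) (insert-at {B = C} i (A , pA) others) (h i))
          (subst (λ z → v ∈ᵍ sub k (proj₁ z)) (trans (insert-punchIn {B = C} i (A , pA) others j′) (insert-at {B = C ∘ punchIn i} j′ b F)) (h (punchIn i j′))))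
        λ x → subst (λ z → v ∈ᵍ sub k (proj₁ z)) (trans (insert-punchIn {B = C} i (A , pA) others (punchIn j′ x)) (insert-punchIn {B = C ∘ punchIn i} j′ b F x)) (h (punchIn i (punchIn j′ x))))
      where
      b : C (punchIn i j′)
      b = B , subst (λ l → 𝓕 l (flat B)) (sym (Fin.punchIn-punchOut ne)) pB
      others : ∀ x → C (punchIn i x)
      others = insert {B = C ∘ punchIn i} j′ b F
      all : ∀ l → C l
      all = insert {B = C} i (A , pA) others

-- Assembly for three or more families

module Main (𝔽 : FiniteField) (n k r t : ℕ) (1≤t : 1 ≤ t) (big : 4 * k + 6 ≤ n) (room : 2 + t + r ≤ k)
  (𝓕 : Fin (3 + r) → LinAlg.Family 𝔽 n k) (adm : LinAlg.Admissible 𝔽 n (3 + r) t 𝓕)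
  (m : Fin (3 + r) → ℕ) (sizes : ∀ i → LinAlg.HasSize 𝔽 n (𝓕 i) (m i))
  (maximal : (𝓖 : Fin (3 + r) → LinAlg.Family 𝔽 n k) → LinAlg.Admissible 𝔽 n (3 + r) t 𝓖 →
    (m′ : Fin (3 + r) → ℕ) → (∀ i → LinAlg.HasSize 𝔽 n (𝓖 i) (m′ i)) → prodFin (3 + r) m′ ≤ prodFin (3 + r) m) where
  private
    module L = LinAlg 𝔽 n
    module S = Space 𝔽 n
  open Bridge 𝔽 n

  -- There are 3 + r families here, so this is t + (3 + r) - 2.
  s : ℕ
  s = suc (t + r)

  open Families S.geometry k s (s≤s (≤-trans 1≤t (m≤m+n t r))) room big hiding (m; n)

  wd : ∀ i → L.WellDefined (𝓕 i)
  wd = proj₁ adm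

  P? : ∀ i → Decidable {A = Fin (num k)} (λ F → 𝓕 i (flat F))
  P? i = hasSize-dec (wd i) (sizes i)

  system : System (3 + r)
  system = record
    { P      = λ i F → 𝓕 i (flat F)
    ; P?     = P?
    ; cross  = λ ne A B pA pB → ≤-trans (≤-reflexive (sym (+-suc t r))) (pair-meet 𝓕 adm P? ne A B pA pB)
    ; spread = λ i U dU → Admissibility.escape 𝓕 adm P? i U (≤-trans (≤-trans (m≤m+n t r) (n≤1+n _)) (≤-reflexive (sym dU)))
    }

  m≡ : prodFin (3 + r) m ≡ prodFin (3 + r) (System.size system)
  m≡ = prodFin-cong (3 + r) (λ i → hasSize-# (wd i) (sizes i) (P? i))

  -- Makes an extremal family, repeated in every position, a competitor in the maximality
  -- hypothesis.
  model-admissible : (𝓖 : L.Family k) → L.WellDefined 𝓖 →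
    (∀ x → ¬ (x ∈ ⊥ˢ) → ∃ λ i → 𝓖 (flat i) × ¬ (x ∈ sub k i)) →
    ((f : Fin (3 + r) → Fin (num k)) → (∀ i → 𝓖 (flat (f i))) → t ≤ dim (⋂ f)) →
    L.Admissible (3 + r) t (λ _ → 𝓖)
  model-admissible 𝓖 wd𝓖 avoid meets = (λ _ → wd𝓖) , (λ _ → let (i , p , _) = avoid _ (proj₂ nonzero) in flat i , p) , crossing , λ _ → kernel
    where
    crossing : L.CrossIntersecting (3 + r) t (λ _ → 𝓖)
    crossing F p = dimGE-intro (⋂ f) (meets f (λ i → wd𝓖 (F i) (flat (f i)) (≐-index (F i)) (p i)))
        λ v v∈ i → S.⊆ᵖ⇒⊆ {⋂ f} {⟪ F i ⟫} (⊆-trans (⋂-⊆ f i) (index-⊆ (F i))) v v∈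
      where
      f : Fin (3 + r) → Fin (num k)
      f i = index (F i)
    kernel : L.KernelDimLT t 𝓖
    kernel D@(b , ind , p) = absurd (⊈-witness {X} {⊥ˢ} (dim<⇒⊈ {⊥ˢ} {X} 1≤t))
      where
      X : Sp
      X = t , b , ind
      absurd : ¬ (∃ λ x → x ∈ X × ¬ (x ∈ ⊥ˢ))
      absurd (x , x∈ , x∉) = let (i , q , x∉F) = avoid x x∉ in x∉F (dimGE-span {P = λ v → ∀ S → 𝓖 S → v L.∈ S} D (sub k i) (λ v h → h (flat i) q) x x∈)

  ∩-mono-≐ : ∀ {F F′ : L.Sub k} Z → F L.≐ F′ → dim (⟪ F ⟫ ∩ Z) ≤ dim (⟪ F′ ⟫ ∩ Z)
  ∩-mono-≐ {F} {F′} Z (f , _) = dim-mono (∩-mono {⟪ F ⟫} {⟪ F′ ⟫} {Z} {Z} (S.⊆⇒⊆ᵖ {⟪ F ⟫} {⟪ F′ ⟫} f) (⊆-refl {Z}))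

  BallFamily : Sp → L.Family k
  BallFamily Z F = suc s ≤ dim (⟪ F ⟫ ∩ Z)

  HMFamily : Sp → Sp → L.Family k
  HMFamily T M F = (T ⊆ ⟪ F ⟫ × suc s ≤ dim (⟪ F ⟫ ∩ M)) ⊎ (⟪ F ⟫ ⊆ M × ¬ (T ⊆ ⟪ F ⟫))

  ball-wd : ∀ Z → L.WellDefined (BallFamily Z)
  ball-wd Z F F′ e p = ≤-trans p (∩-mono-≐ Z e)

  hm-wd : ∀ T M → L.WellDefined (HMFamily T M)
  hm-wd T M F F′ e (inj₁ (a , b)) = inj₁ (⊆-trans a (S.⊆⇒⊆ᵖ {⟪ F ⟫} {⟪ F′ ⟫} (proj₁ e)) , ≤-trans b (∩-mono-≐ M e))
  hm-wd T M F F′ e (inj₂ (a , b)) = inj₂ (⊆-trans (S.⊆⇒⊆ᵖ {⟪ F′ ⟫} {⟪ F ⟫} (proj₂ e)) a , λ h → b (⊆-trans h (S.⊆⇒⊆ᵖ {⟪ F′ ⟫} {⟪ F ⟫} (proj₂ e))))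

  2+s≡ : 2 + s ≡ t + (3 + r)
  2+s≡ = lem t r
    where
    lem : ∀ t r → 2 + suc (t + r) ≡ t + (3 + r)
    lem = solve-∀

  large-structure : 2 * s + 2 ≤ k → ∃ λ T → ∃ λ M → T ⊆ M × dim T ≡ s × dim M ≡ suc k × (∀ i F → (𝓕 i (flat F) → HM T M M F) × (HM T M M F → 𝓕 i (flat F)))
  large-structure k≥ = system-large k≥ system T₀⊆M₀ dT₀ dM₀ (≤-trans
      (maximal (λ _ → HMFamily T₀ M₀) (model-admissible (HMFamily T₀ M₀) (hm-wd T₀ M₀) (λ x → hm-avoids T₀⊆M₀ dT₀ dM₀)
          (hm-⋂-dim T₀⊆M₀ dT₀ dM₀ 2+s≡ (≤-trans (≤-reflexive (lem t r)) (s≤s room))))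
        (λ _ → # (hm? T₀ M₀ M₀)) (λ _ → #-hasSize (hm-wd T₀ M₀) (hm? T₀ M₀ M₀)))
      (≤-reflexive m≡))
    where
    lem : ∀ t r → 3 + r + t ≡ suc (2 + t + r)
    lem = solve-∀
    T₀ M₀ : Sp
    T₀ = std s
    k<n : suc k ≤ n
    k<n = ≤-trans (≤-reflexive (+-comm 1 k)) (≤-trans (+-mono-≤ (m≤m+n k (3 * k)) (s≤s {n = 5} z≤n)) big)
    dT₀ : dim T₀ ≡ s
    dT₀ = dim-std (≤-trans (≤-trans (n≤1+n s) (n≤1+n _)) 2+s≤n)
    M₀′ : ∃ λ X → T₀ ⊆ X × X ⊆ ⊤ˢ × dim X ≡ suc k
    M₀′ = interpolate (suc k) ⊆-⊤ (≤-trans (≤-reflexive dT₀) (≤-trans (<⇒≤ room) (n≤1+n k))) (≤-trans k<n (≤-reflexive (sym dim-⊤)))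
    M₀ = proj₁ M₀′
    T₀⊆M₀ : T₀ ⊆ M₀
    T₀⊆M₀ = proj₁ (proj₂ M₀′)
    dM₀ : dim M₀ ≡ suc k
    dM₀ = proj₂ (proj₂ (proj₂ M₀′))

  small-structure : k ≤ 2 * s + 1 → ∃ λ Z → dim Z ≡ 2 + s × (∀ i F → (𝓕 i (flat F) → Ball Z F) × (Ball Z F → 𝓕 i (flat F)))
  small-structure k≤ = system-small k≤ system dZ₀ (≤-trans
      (maximal (λ _ → BallFamily Z₀) (model-admissible (BallFamily Z₀) (ball-wd Z₀) (λ x → ball-avoids dZ₀)
          (λ f p → ≤-trans (+-cancelʳ-≤ (3 + r) _ _ (≤-trans (≤-reflexive (sym 2+s≡)) (ball-⋂ dZ₀ f p))) (dim-mono (∩-⊆ˡ (⋂ f) Z₀))))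
        (λ _ → # (ball? Z₀)) (λ _ → #-hasSize (ball-wd Z₀) (ball? Z₀)))
      (≤-reflexive m≡))
    where
    Z₀ : Sp
    Z₀ = std (2 + s)
    dZ₀ : dim Z₀ ≡ 2 + s
    dZ₀ = dim-std 2+s≤n

  iff : ∀ {𝓖 : L.Family k} → L.WellDefined 𝓖 → (∀ i F → (𝓕 i (flat F) → 𝓖 (flat F)) × (𝓖 (flat F) → 𝓕 i (flat F))) →
    ∀ i F → (𝓕 i F → 𝓖 F) × (𝓖 F → 𝓕 i F)
  iff wd𝓖 h i F = (λ p → wd𝓖 (flat (index F)) F (index-≐ F) (proj₁ (h i (index F)) (wd i F (flat (index F)) (≐-index F) p)))
                , (λ p → wd i (flat (index F)) F (index-≐ F) (proj₂ (h i (index F)) (wd𝓖 F (flat (index F)) (≐-index F) p)))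

  -- The dimensions a, b, c are left open so that the expressions occurring in the theorem can be
  -- matched with the successor forms used for the construction.
  large-statement : ∀ {a b c} → a ≡ suc k → b ≡ s → c ≡ suc s → 2 * s + 2 ≤ k →
    Σ (L.Sub a) λ M → Σ (L.Sub b) λ T → (T L.⊆ M) × ((i : Fin (3 + r)) (F : L.Sub k) →
      𝓕 i F ⇔ (((T L.⊆ F) × L.DimGE c (λ v → (v L.∈ F) × (v L.∈ M))) ⊎ ((F L.⊆ M) × ¬ (T L.⊆ F))))
  large-statement refl refl refl k≥ = go (large-structure k≥)
    where
    go : (∃ λ T → ∃ λ M → T ⊆ M × dim T ≡ s × dim M ≡ suc k × (∀ i F → (𝓕 i (flat F) → HM T M M F) × (HM T M M F → 𝓕 i (flat F)))) →
      Σ (L.Sub (suc k)) λ M → Σ (L.Sub s) λ T → (T L.⊆ M) × ((i : Fin (3 + r)) (F : L.Sub k) →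
        𝓕 i F ⇔ (((T L.⊆ F) × L.DimGE (suc s) (λ v → (v L.∈ F) × (v L.∈ M))) ⊎ ((F L.⊆ M) × ¬ (T L.⊆ F))))
    go ((_ , T) , (_ , M) , T⊆M , refl , refl , h) = M , T , S.⊆ᵖ⇒⊆ {⟪ T ⟫} {⟪ M ⟫} T⊆M , λ i F →
        let (to , from) = iff (hm-wd ⟪ T ⟫ ⟪ M ⟫) h i F in mk⇔ (there F ∘ to) (from ∘ back F)
      where
      there : ∀ F → HMFamily ⟪ T ⟫ ⟪ M ⟫ F → ((T L.⊆ F) × L.DimGE (suc s) (λ v → (v L.∈ F) × (v L.∈ M))) ⊎ ((F L.⊆ M) × ¬ (T L.⊆ F))
      there F (inj₁ (a , b)) = inj₁ (S.⊆ᵖ⇒⊆ {⟪ T ⟫} {⟪ F ⟫} a , dimGE-∩⇐ ⟪ F ⟫ ⟪ M ⟫ b)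
      there F (inj₂ (a , b)) = inj₂ (S.⊆ᵖ⇒⊆ {⟪ F ⟫} {⟪ M ⟫} a , b ∘ S.⊆⇒⊆ᵖ {⟪ T ⟫} {⟪ F ⟫})
      back : ∀ F → ((T L.⊆ F) × L.DimGE (suc s) (λ v → (v L.∈ F) × (v L.∈ M))) ⊎ ((F L.⊆ M) × ¬ (T L.⊆ F)) → HMFamily ⟪ T ⟫ ⟪ M ⟫ F
      back F (inj₁ (a , b)) = inj₁ (S.⊆⇒⊆ᵖ {⟪ T ⟫} {⟪ F ⟫} a , dimGE-∩⇒ ⟪ F ⟫ ⟪ M ⟫ b)
      back F (inj₂ (a , b)) = inj₂ (S.⊆⇒⊆ᵖ {⟪ F ⟫} {⟪ M ⟫} a , b ∘ S.⊆ᵖ⇒⊆ {⟪ T ⟫} {⟪ F ⟫})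

  small-statement : ∀ {a c} → a ≡ 2 + s → c ≡ suc s → k ≤ 2 * s + 1 →
    Σ (L.Sub a) λ Z → (i : Fin (3 + r)) (F : L.Sub k) → 𝓕 i F ⇔ L.DimGE c (λ v → (v L.∈ F) × (v L.∈ Z))
  small-statement refl refl k≤ = go (small-structure k≤)
    where
    go : (∃ λ Z → dim Z ≡ 2 + s × (∀ i F → (𝓕 i (flat F) → Ball Z F) × (Ball Z F → 𝓕 i (flat F)))) →
      Σ (L.Sub (2 + s)) λ Z → (i : Fin (3 + r)) (F : L.Sub k) → 𝓕 i F ⇔ L.DimGE (suc s) (λ v → (v L.∈ F) × (v L.∈ Z))
    go ((_ , Z) , refl , h) = Z , λ i F → let (to , from) = iff (ball-wd ⟪ Z ⟫) h i F in
      mk⇔ (dimGE-∩⇐ ⟪ F ⟫ ⟪ Z ⟫ ∘ to) (from ∘ dimGE-∩⇒ ⟪ F ⟫ ⟪ Z ⟫)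

theorem1p4 : (𝔽 : FiniteField) (n r k t : ℕ) →
    1 ≤ n → 1 ≤ r → 1 ≤ k → 1 ≤ t →
    3 ≤ r → t + 1 ≤ k → 4 * k + 6 ≤ n →
    let open LinAlg 𝔽 n in
    (𝓕 : Fin r → Family k) → Admissible r t 𝓕 →
    (m : Fin r → ℕ) → (∀ i → HasSize (𝓕 i) (m i)) →
    ((𝓖 : Fin r → Family k) → Admissible r t 𝓖 →
    (m' : Fin r → ℕ) → (∀ i → HasSize (𝓖 i) (m' i)) →
    prodFin r m' ≤ prodFin r m) →
    (r ≤ k ∸ t + 1)
    × (2 * t + 2 * r ∸ 3 < k →
    Σ (Sub (k + 1)) λ M → Σ (Sub (t + r ∸ 2)) λ T → (T ⊆ M) ×
    ((i : Fin r) (F : Sub k) →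
    𝓕 i F ⇔ (((T ⊆ F) × DimGE (t + r ∸ 1) (λ v → (v ∈ F) × (v ∈ M)))
    ⊎ ((F ⊆ M) × ¬ (T ⊆ F)))))
    × (k ≤ 2 * t + 2 * r ∸ 3 →
    Σ (Sub (t + r)) λ Z →
    ((i : Fin r) (F : Sub k) →
    𝓕 i F ⇔ DimGE (t + r ∸ 1) (λ v → (v ∈ F) × (v ∈ Z))))
theorem1p4 𝔽 n (suc (suc (suc r))) k t _ _ _ 1≤t (s≤s (s≤s (s≤s z≤n))) _ big 𝓕 adm m sizes maximal =
    (≤-trans (≤-reflexive (+-comm 1 (2 + r))) (+-monoˡ-≤ 1 (m+n≤o⇒m≤o∸n (2 + r) (≤-trans (≤-reflexive (+-comm (2 + r) t)) fits))))
  , (λ lt → large-statement (+-comm k 1) (cong (_∸ 2) (sym 2+s≡)) (cong (_∸ 1) (sym 2+s≡)) (≤-trans (≤-reflexive (trans (lem₁ s) (cong suc (sym threshold)))) lt))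
  , (λ le → small-statement (sym 2+s≡) (cong (_∸ 1) (sym 2+s≡)) (≤-trans le (≤-reflexive threshold)))
  where
  lem₀ : ∀ t r → 2 + t + r ≡ t + (2 + r)
  lem₀ = solve-∀
  -- The number of families is 3 + r, so this bounds it by k - t + 1; it also provides s < k for
  -- `Main`.
  fits : t + (2 + r) ≤ k
  fits = Bridge.member-dim 𝔽 n 𝓕 adm (λ i → Bridge.hasSize-dec 𝔽 n (proj₁ adm i) (sizes i))
  open Main 𝔽 n k r t 1≤t big (≤-trans (≤-reflexive (lem₀ t r)) fits) 𝓕 adm m sizes maximal using (s; large-statement; small-statement; 2+s≡)
  lem₁ : ∀ s → 2 * s + 2 ≡ suc (2 * s + 1)
  lem₁ = solve-∀
  -- The bound separating (i) from (ii) is the value of k at which `h` and `g` coincide.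
  threshold : 2 * t + 2 * (3 + r) ∸ 3 ≡ 2 * s + 1
  threshold = cong (_∸ 3) (lem₂ t r)
    where
    lem₂ : ∀ t r → 2 * t + 2 * (3 + r) ≡ 3 + (2 * suc (t + r) + 1)
    lem₂ = solve-∀
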